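{- Let $n$ be a positive integer with $n\equiv 3\pmod 4$, and let $a,b$ be indeterminates. Then, modulo $[n](1-aq^n)(a-q^n)(b-q^n)$, \[ \sum_{k=0}^{n-1}[6k+1]\frac{(q,aq,q/a;q^2)_k(q/b^3;q^4)_k}{(q^4,q^4/a,aq^4;q^4)_k(b^3q^2;q^2)_k}q^{k^2+k}b^{3k} \equiv \frac{(b-q^n)(ab-1-a^2+aq^n)}{(a-b)(1-ab)}\frac{(q^3,1/b^3;q^4)_{(n+1)/4}}{(1/q,b^3q^2;q^4)_{(n+1)/4}}\bigg(\frac{b^3}{q}\bigg)^{\frac{n+1}{4}} +\frac{(1-aq^n)(a-q^n)}{(a-b)(1-ab)}\frac{(q^3,q^5;q^4)_{(3n-1)/4}}{(aq^4,q^4/a;q^4)_{(3n-1)/4}}. \]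
   Context: For $x$ and integer $n\ge 0$, $(x;q)_n=\prod_{j=0}^{n-1}(1-xq^j)$, and $(x_1,\dots,x_m;q)_n=(x_1;q)_n\cdots(x_m;q)_n$. $[r]=(1-q^r)/(1-q)$ is the $q$-integer. A congruence modulo a polynomial $P$ in $q,a,b$ between rational functions whose denominators are coprime to $P$ means that the difference is a rational function whose numerator is divisible by $P$ and whose denominator is coprime to $P$. -}

module Defs where

open import Data.Nat using (ℕ; zero; suc)
import Data.Nat as N
open import Data.Integer as Z using (ℤ)
open import Data.Product using (Σ; _×_)
open import Relation.Binary.PropositionalEquality using (_≡_)

-- Polynomials in ℤ[q,a,b], as syntax.  Two polynomials are identified when
-- they agree at every integer point (ℤ is an infinite integral domain, so
-- this is exactly equality in ℤ[q,a,b]).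
infixl 6 _⊕_ _⊝_
infixl 7 _⊗_
data Poly : Set where
  con  : ℤ → Poly
  varq : Poly
  vara : Poly
  varb : Poly
  _⊕_  : Poly → Poly → Poly
  _⊗_  : Poly → Poly → Poly
  ⊖_   : Poly → Poly

_⊝_ : Poly → Poly → Poly
p ⊝ r = p ⊕ (⊖ r)

evalP : ℤ → ℤ → ℤ → Poly → ℤ
evalP q a b (con c) = c
evalP q a b varq = q
evalP q a b vara = a
evalP q a b varb = b
evalP q a b (p ⊕ r) = evalP q a b p Z.+ evalP q a b r
evalP q a b (p ⊗ r) = evalP q a b p Z.* evalP q a b r
evalP q a b (⊖ p) = Z.- evalP q a b p

infix 4 _≈P_ _∣P_
_≈P_ : Poly → Poly → Set
p ≈P r = ∀ q a b → evalP q a b p ≡ evalP q a b r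

𝟘 𝟙 : Poly
𝟘 = con (Z.+ 0)
𝟙 = con (Z.+ 1)

_∣P_ : Poly → Poly → Set
d ∣P p = Σ Poly (λ r → p ≈P d ⊗ r)

CoprimeP : Poly → Poly → Set
CoprimeP d p = ∀ e → e ∣P d → e ∣P p → e ∣P 𝟙

infixr 8 _^P_
_^P_ : Poly → ℕ → Poly
p ^P zero = 𝟙
p ^P suc k = p ⊗ (p ^P k)

qint : ℕ → Poly
qint zero = 𝟘
qint (suc n) = qint n ⊕ varq ^P n

record Frac : Set where
  constructor _⁄_
  field
    num : Poly
    den : Poly
open Frac public

↑ : Poly → Frac
↑ p = p ⁄ 𝟙

infixl 6 _+F_ _-F_
infixl 7 _*F_ _/F_
_+F_ : Frac → Frac → Frac
(n₁ ⁄ d₁) +F (n₂ ⁄ d₂) = (n₁ ⊗ d₂ ⊕ n₂ ⊗ d₁) ⁄ (d₁ ⊗ d₂)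

_-F_ : Frac → Frac → Frac
(n₁ ⁄ d₁) -F (n₂ ⁄ d₂) = (n₁ ⊗ d₂ ⊝ n₂ ⊗ d₁) ⁄ (d₁ ⊗ d₂)

_*F_ : Frac → Frac → Frac
(n₁ ⁄ d₁) *F (n₂ ⁄ d₂) = (n₁ ⊗ n₂) ⁄ (d₁ ⊗ d₂)

_/F_ : Frac → Frac → Frac
(n₁ ⁄ d₁) /F (n₂ ⁄ d₂) = (n₁ ⊗ d₂) ⁄ (d₁ ⊗ n₂)

infixr 8 _^F_
_^F_ : Frac → ℕ → Frac
x ^F zero = ↑ 𝟙
x ^F suc k = x *F (x ^F k)

infix 4 _≈F_
_≈F_ : Frac → Frac → Set
x ≈F y = num x ⊗ den y ≈P num y ⊗ den x

poch : Frac → Frac → ℕ → Frac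
poch x p zero = ↑ 𝟙
poch x p (suc k) = poch x p k *F (↑ 𝟙 -F x *F (p ^F k))

sumF : ℕ → (ℕ → Frac) → Frac
sumF zero f = ↑ 𝟘
sumF (suc n) f = sumF n f +F f n

CongMod : Poly → Frac → Frac → Set
CongMod P f g =
  Σ Poly (λ N → Σ Poly (λ D →
    ((f -F g) ≈F (N ⁄ D)) × (P ∣P N) × CoprimeP D P))

Q A B : Frac
Q = ↑ varq
A = ↑ vara
B = ↑ varb

1F : Frac
1F = ↑ 𝟙

modulus : ℕ → Poly
modulus n = qint n ⊗ (𝟙 ⊝ vara ⊗ varq ^P n) ⊗ (vara ⊝ varq ^P n) ⊗ (varb ⊝ varq ^P n)

lhsTerm : ℕ → Frac
lhsTerm k =
  ↑ (qint (6 N.* k N.+ 1))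
  *F (poch Q (Q ^F 2) k *F poch (A *F Q) (Q ^F 2) k *F poch (Q /F A) (Q ^F 2) k
      *F poch (Q /F (B ^F 3)) (Q ^F 4) k)
  /F (poch (Q ^F 4) (Q ^F 4) k *F poch ((Q ^F 4) /F A) (Q ^F 4) k
      *F poch (A *F Q ^F 4) (Q ^F 4) k *F poch (B ^F 3 *F Q ^F 2) (Q ^F 2) k)
  *F Q ^F (k N.* k N.+ k) *F B ^F (3 N.* k)

LHS : ℕ → Frac
LHS n = sumF n lhsTerm

RHS : ℕ → Frac
RHS n =
  ((B -F Q ^F n) *F (A *F B -F 1F -F A ^F 2 +F A *F Q ^F n)) /F ((A -F B) *F (1F -F A *F B))
    *F (poch (Q ^F 3) (Q ^F 4) m *F poch (1F /F B ^F 3) (Q ^F 4) m)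
    /F (poch (1F /F Q) (Q ^F 4) m *F poch (B ^F 3 *F Q ^F 2) (Q ^F 4) m)
    *F (B ^F 3 /F Q) ^F m
  +F ((1F -F A *F Q ^F n) *F (A -F Q ^F n)) /F ((A -F B) *F (1F -F A *F B))
    *F (poch (Q ^F 3) (Q ^F 4) r *F poch (Q ^F 5) (Q ^F 4) r)
    /F (poch (A *F Q ^F 4) (Q ^F 4) r *F poch ((Q ^F 4) /F A) (Q ^F 4) r)
  where
  m r : ℕ
  m = (n N.+ 1) N./ 4
  r = (3 N.* n N.∸ 1) N./ 4

{-# OPTIONS --safe #-}
module Submission where

{- Write c = b³ and u = qⁿ.  After normalisation the left-hand side is a series S(c) whose terms are rational in c,
and S(c) (cq²;q²)ₙ₋₁ is a polynomial of degree at most n - 1 in c.  At the nodes c_j = q^(4j+1) the series terminates,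
and a Wilf–Zeilberger pair evaluates it to R_j = (q³,q⁵;q⁴)_j / (aq⁴,q⁴/a;q⁴)_j; the case c_r = u³ is the congruence
modulo b - u.  Everything else follows by Lagrange interpolation at c_0, …, c_(n-1):

* for a = u^(±1) the first term of the right-hand side, times (cq²;q²)ₙ₋₁, is also a polynomial of degree n - 1 in c
  with the same values at the nodes, which gives the congruence modulo (1 - au)(a - u);

* the weight of the node c_j is (q³;q²)_(2j+n-1) / ((q⁴;q⁴)_j (q⁴;q⁴)_(n-1-j)) up to units, and writing these products
  with q-binomial coefficients exhibits the factor [n], with no appeal to cyclotomic polynomials.

Identities of polynomials are checked at integer points (q, a, b) where no denominator vanishes, with values in ℚ.
Coprimality is also pointwise: a common divisor e of D and P takes the values ±1 wherever D and P are coprime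
integers, and since such points are Zariski dense, e² = 1. -}

open import Defs
open import Algebra.Bundles using (CommutativeRing)
open import Algebra.Structures using (IsCommutativeRing)
open import Data.Bool.Base using (Bool; true; false)
open import Data.Integer.Base as ℤ using (ℤ; +_; -[1+_])
import Data.Integer.Properties as ℤ
open import Data.Integer.Divisibility.Signed as ℤ using (divides)
open import Data.Integer.Solver using (module +-*-Solver)
open import Data.Nat using (ℕ; _%_)
open import Data.Nat.Base as ℕ using (zero; suc; z≤n; s≤s; z<s; s<s)
open import Data.Nat.DivMod using (m≡m%n+[m/n]*n; m*n/n≡m)
import Data.Nat.Properties as ℕ
open import Data.Nat.Tactic.RingSolver using (solve-∀)
open import Data.Product.Base using (Σ; _×_; _,_; proj₁; proj₂)
open import Data.Rational.Base as ℚ using (ℚ; 0ℚ; 1ℚ; 1/_; toℚᵘ; fromℚᵘ; ≢-nonZero)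
import Data.Rational.Properties as ℚ
open import Data.Rational.Unnormalised.Base as ℚᵘ using (mkℚᵘ; *≡*)
import Data.Rational.Unnormalised.Properties as ℚᵘ
open import Data.Sum.Base using (inj₁; inj₂)
open import Function.Base using (_∘_; _$_)
open import Relation.Binary.Definitions using (tri<; tri≈; tri>)
open import Relation.Binary.PropositionalEquality using (_≡_; _≢_; refl; sym; trans; cong; cong₂; subst; setoid; module ≡-Reasoning)
open import Relation.Nullary using (¬_; yes; no; contradiction)

-- What shapes the proof is the choice of denominators that may be inverted. The factors
-- `1 - q ^ (4 k)` in the denominators of the interpolation weights are in general not coprime to
-- [n]; as n is odd, only their cofactors `1 + q ^ k` and `1 + q ^ (2 k)` are. The factors
-- `1 - q ^ k` therefore have to cancel explicitly, and this must leave `1 - q ^ n` behind. After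
-- multiplication by (1 - q)(a - b)(1 - ab), the left-hand side and both terms on the right are each
-- written as `1 - q ^ n` times a function with admissible denominators. The three linear factors
-- are then divided out of the numerator that remains, so that [n] never has to be compared with
-- them. Coprimality in ℤ[q,a,b] also rules out common integer factors at the chosen points. At an
-- odd q both `1 + q ^ k` and `q ^ n - 1` are even, so the points that test coprimality have an even
-- q.

evalP-^ : ∀ p k q a b → evalP q a b (p ^P k) ≡ evalP q a b p ℤ.^ k
evalP-^ p zero    q a b = refl
evalP-^ p (suc k) q a b = cong (evalP q a b p ℤ.*_) (evalP-^ p k q a b)

-- The denominators that may be inverted modulo [n](1 - a qⁿ)(a - qⁿ)(b - qⁿ).
data Good (I : ℕ) : Poly → Set where
  one    : Good I 𝟙
  times  : ∀ {D D′} → Good I D → Good I D′ → Good I (D ⊗ D′)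
  q-good : Good I varq
  1+q    : ∀ {i} → i ℕ.< I → Good I (𝟙 ⊕ varq ^P suc i)
  1-aq   : ∀ {i} → i ℕ.< I → Good I (𝟙 ⊝ vara ⊗ varq ^P (4 ℕ.* suc i))
  a-q    : ∀ {i} → i ℕ.< I → Good I (vara ⊝ varq ^P (4 ℕ.* suc i))
  1-b³q  : ∀ {i} → i ℕ.< I → Good I (𝟙 ⊝ varb ^P 3 ⊗ varq ^P (2 ℕ.* suc i))
  a-b    : Good I (vara ⊝ varb)
  1-ab   : Good I (𝟙 ⊝ vara ⊗ varb)

-- Coprimality to the modulus at integer points

module Bézout where
  open +-*-Solver
  open import Data.Integer.Base using (_+_; _*_; _-_; -_; _^_; 1ℤ)
  open import Data.Integer.Divisibility.Signed using (_∣_)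
  open import Algebra.Properties.AbelianGroup ℤ.+-0-abelianGroup using (∙-cancelˡ)
  open ≡-Reasoning

  infix 4 _⊥_
  -- Bézout coefficients rather than a gcd: they pass through products and reductions by plain
  -- algebra, and one such equation is what forces a common divisor to be a unit in `good-coprime`.
  record _⊥_ (x y : ℤ) : Set where
    constructor bézout
    field
      s t      : ℤ
      equation : s * x + t * y ≡ 1ℤ

  ⊥-sym : ∀ {x y} → x ⊥ y → y ⊥ x
  ⊥-sym (bézout s t e) = bézout t s $ trans (ℤ.+-comm (t * _) (s * _)) e

  -- Coprimality to `x` depends only on the residue modulo `x`. Most claims below reduce `y` in this
  -- way to a unit, to a power of `q` or to a case already settled.
  ⊥-mod : ∀ {x y z} → x ∣ y - z → x ⊥ y → x ⊥ z
  ⊥-mod {x} {y} {z} (divides k h) (bézout s t e) = bézout (s + t * k) t (begin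
    (s + t * k) * x + t * z     ≡⟨ solve 5 (λ s t k x z → (s :+ t :* k) :* x :+ t :* z := s :* x :+ t :* (k :* x :+ z)) refl s t k x z ⟩
    s * x + t * (k * x + z)     ≡⟨ cong (λ w → s * x + t * (w + z)) h ⟨
    s * x + t * (y - z + z)     ≡⟨ solve 5 (λ s t x y z → s :* x :+ t :* (y :- z :+ z) := s :* x :+ t :* y) refl s t x y z ⟩
    s * x + t * y               ≡⟨ e ⟩
    1ℤ                          ∎)

  ⊥-1 : ∀ {x} → x ⊥ 1ℤ
  ⊥-1 {x} = bézout (+ 0) (+ 1) $ solve 1 (λ x → con (+ 0) :* x :+ con (+ 1) :* con (+ 1) := con (+ 1)) refl x

  ⊥-* : ∀ {x y z} → x ⊥ y → x ⊥ z → x ⊥ y * z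
  ⊥-* {x} {y} {z} (bézout s t e) (bézout s′ t′ e′) = bézout (s * s′ * x + s * t′ * z + t * y * s′) (t * t′) (begin
    (s * s′ * x + s * t′ * z + t * y * s′) * x + t * t′ * (y * z)
      ≡⟨ solve 7 (λ s t s′ t′ x y z → (s :* s′ :* x :+ s :* t′ :* z :+ t :* y :* s′) :* x :+ t :* t′ :* (y :* z)
           := (s :* x :+ t :* y) :* (s′ :* x :+ t′ :* z)) refl s t s′ t′ x y z ⟩
    (s * x + t * y) * (s′ * x + t′ * z)
      ≡⟨ cong₂ _*_ e e′ ⟩
    1ℤ ∎)

  ⊥-*ˡ : ∀ {x y z} → x ⊥ z → y ⊥ z → x * y ⊥ z
  ⊥-*ˡ h h′ = ⊥-sym (⊥-* (⊥-sym h) (⊥-sym h′))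

  ⊥-^ : ∀ {x y} → x ⊥ y → ∀ k → x ⊥ y ^ k
  ⊥-^ h zero    = ⊥-1
  ⊥-^ h (suc k) = ⊥-* h (⊥-^ h k)

  ⊥-neg : ∀ {x y} → x ⊥ y → x ⊥ - y
  ⊥-neg {x} {y} (bézout s t e) = bézout s (- t) $ trans (solve 4 (λ s t x y → s :* x :+ (:- t) :* (:- y) := s :* x :+ t :* y) refl s t x y) e

  ⊥-∣ : ∀ {x y z} → z ∣ y → x ⊥ y → x ⊥ z
  ⊥-∣ {x} {y} {z} (divides k refl) (bézout s t e) = bézout s (t * k) $ trans (cong (λ w → s * x + w) (ℤ.*-assoc t k z)) e

  ∣-resp : ∀ {x y z} → y ≡ z → x ∣ y → x ∣ z
  ∣-resp refl h = h

  1-multiple : ∀ {x y} → x ∣ y → x ⊥ 1ℤ - y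
  1-multiple {x} {y} h = ⊥-mod (∣-resp (solve 1 (λ y → y := con (+ 1) :- (con (+ 1) :- y)) refl y) h) ⊥-1

  multiple- : ∀ {x y z} → x ∣ y → x ⊥ z → x ⊥ y - z
  multiple- {x} {y} {z} h z⊥ = ⊥-mod (∣-resp (solve 2 (λ y z → :- y := (:- z) :- (y :- z)) refl y z) (ℤ.∣m⇒∣-m h)) (⊥-neg z⊥)

  -multiple : ∀ {x y z} → x ∣ y → x ⊥ z → x ⊥ z - y
  -multiple {x} {y} {z} h z⊥ = ⊥-mod (∣-resp (solve 2 (λ y z → y := z :- (z :- y)) refl y z) h) z⊥

  ∣-self : ∀ {x} → x ∣ x
  ∣-self = ℤ.∣-refl

  x-1∣x^k-1 : ∀ x k → x - 1ℤ ∣ x ^ k - 1ℤ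
  x-1∣x^k-1 x zero    = divides (+ 0) (solve 1 (λ x → con (+ 1) :- con (+ 1) := con (+ 0) :* (x :- con (+ 1))) refl x)
  x-1∣x^k-1 x (suc k) with x-1∣x^k-1 x k
  ... | divides d h = divides (x * d + 1ℤ) (begin
    x * x ^ k - 1ℤ                              ≡⟨ solve 2 (λ x y → x :* y :- con (+ 1) := x :* (y :- con (+ 1)) :+ (x :- con (+ 1))) refl x (x ^ k) ⟩
    x * (x ^ k - 1ℤ) + (x - 1ℤ)                 ≡⟨ cong (λ t → x * t + (x - 1ℤ)) h ⟩
    x * (d * (x - 1ℤ)) + (x - 1ℤ)               ≡⟨ solve 2 (λ x d → x :* (d :* (x :- con (+ 1))) :+ (x :- con (+ 1)) := (x :* d :+ con (+ 1)) :* (x :- con (+ 1))) refl x d ⟩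
    (x * d + 1ℤ) * (x - 1ℤ)                     ∎)

  1+x∣1+x^odd : ∀ x t → 1ℤ + x ∣ 1ℤ + x ^ suc (2 ℕ.* t)
  1+x∣1+x^odd x t with x-1∣x^k-1 (x ^ 2) t
  ... | divides d h = divides (x * d * (x - 1ℤ) + 1ℤ) (begin
    1ℤ + x * x ^ (2 ℕ.* t)                      ≡⟨ cong (λ w → 1ℤ + x * w) (ℤ.^-*-assoc x 2 t) ⟨
    1ℤ + x * (x ^ 2) ^ t                        ≡⟨ solve 2 (λ x y → con (+ 1) :+ x :* y := x :* (y :- con (+ 1)) :+ (con (+ 1) :+ x)) refl x ((x ^ 2) ^ t) ⟩
    x * ((x ^ 2) ^ t - 1ℤ) + (1ℤ + x)           ≡⟨ cong (λ w → x * w + (1ℤ + x)) h ⟩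
    x * (d * (x ^ 2 - 1ℤ)) + (1ℤ + x)           ≡⟨ solve 2 (λ x d → x :* (d :* (x :* (x :* con (+ 1)) :- con (+ 1))) :+ (con (+ 1) :+ x)
                                                     := (x :* d :* (x :- con (+ 1)) :+ con (+ 1)) :* (con (+ 1) :+ x)) refl x d ⟩
    (x * d * (x - 1ℤ) + 1ℤ) * (1ℤ + x)          ∎)

  q⊥q^-1 : ∀ q j → q ⊥ q ^ suc j - 1ℤ
  q⊥q^-1 q j = bézout (q ^ j) (- 1ℤ) $ solve 2 (λ q x → x :* q :+ (:- con (+ 1)) :* (q :* x :- con (+ 1)) := con (+ 1)) refl q (q ^ j)

  q⊥1+q^ : ∀ q j → q ⊥ 1ℤ + q ^ suc j
  q⊥1+q^ q j = bézout (- (q ^ j)) 1ℤ $ solve 2 (λ q x → (:- x) :* q :+ con (+ 1) :* (con (+ 1) :+ q :* x) := con (+ 1)) refl q (q ^ j)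

  -- A common divisor of `m` and `n` divides `(1 + X) - (X - 1) = 2`, while `m = 1 + 2 w` is odd;
  -- the coefficients spell this out.
  odd-⊥ : ∀ {m n X w} → m ≡ 1ℤ + (w + w) → m ∣ 1ℤ + X → n ∣ X - 1ℤ → m ⊥ n
  odd-⊥ {m} {n} {X} {w} odd (divides d e) (divides d′ e′) = bézout (1ℤ - w * d) (w * d′) (begin
    (1ℤ - w * d) * m + w * d′ * n
      ≡⟨ solve 5 (λ w d m d′ n → (con (+ 1) :- w :* d) :* m :+ w :* d′ :* n := m :- w :* (d :* m :- d′ :* n)) refl w d m d′ n ⟩
    m - w * (d * m - d′ * n)
      ≡⟨ cong₂ (λ x y → m - w * (x - y)) e e′ ⟨
    m - w * (1ℤ + X - (X - 1ℤ))
      ≡⟨ cong (λ x → x - w * (1ℤ + X - (X - 1ℤ))) odd ⟩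
    1ℤ + (w + w) - w * (1ℤ + X - (X - 1ℤ))
      ≡⟨ solve 2 (λ w X → con (+ 1) :+ (w :+ w) :- w :* (con (+ 1) :+ X :- (X :- con (+ 1))) := con (+ 1)) refl w X ⟩
    1ℤ ∎)

  -- Both sides divide q^(i j) ± 1, and 1 + qⁱ is odd.
  1+q^⊥q^odd-1 : ∀ {q h} → q ≡ h + h → ∀ i t → 1ℤ + q ^ suc i ⊥ q ^ suc (2 ℕ.* t) - 1ℤ
  1+q^⊥q^odd-1 {q} {h} even i t = odd-⊥ {X = (q ^ suc i) ^ j} {w = h * q ^ i}
    (cong (λ x → 1ℤ + x) (trans (cong (_* q ^ i) even) (ℤ.*-distribʳ-+ (q ^ i) h h)))
    (1+x∣1+x^odd (q ^ suc i) t)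
    (subst (λ x → q ^ j - 1ℤ ∣ x - 1ℤ) (begin
        (q ^ j) ^ suc i         ≡⟨ ℤ.^-*-assoc q j (suc i) ⟩
        q ^ (j ℕ.* suc i)       ≡⟨ cong (q ^_) (ℕ.*-comm j (suc i)) ⟩
        q ^ (suc i ℕ.* j)       ≡⟨ ℤ.^-*-assoc q (suc i) j ⟨
        (q ^ suc i) ^ j         ∎) (x-1∣x^k-1 (q ^ j) (suc i)))
    where
    j = suc (2 ℕ.* t)

  3n+2i-odd : ∀ t i → 3 ℕ.* suc (2 ℕ.* t) ℕ.+ 2 ℕ.* suc i ≡ suc (2 ℕ.* suc (t ℕ.+ (t ℕ.+ (t ℕ.+ suc i))))
  3n+2i-odd = solve-∀

  6n+4i-even : ∀ n i → 6 ℕ.* n ℕ.+ 4 ℕ.* i ≡ 2 ℕ.* (3 ℕ.* n ℕ.+ 2 ℕ.* i)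
  6n+4i-even = solve-∀

  -- Integer points at which every good polynomial is prime to the modulus; their existence makes good polynomials
  -- coprime to the modulus, since the points are Zariski dense.
  record Point (I n : ℕ) (q a b : ℤ) : Set where
    u = q ^ n
    field
      half : ℤ
      even : q ≡ half + half
      a⊥q  : a ⊥ q
      q^-1∣a   : ∀ j → j ℕ.< n ℕ.+ 4 ℕ.* I → q ^ suc j - 1ℤ ∣ a
      1+q^∣b   : ∀ i → i ℕ.< I → 1ℤ + q ^ suc i ∣ b
      1-aq∣b   : ∀ i → i ℕ.< I → 1ℤ - a * q ^ (4 ℕ.* suc i) ∣ b
      a-q∣b    : ∀ i → i ℕ.< I → a - q ^ (4 ℕ.* suc i) ∣ b
      1-au∣b   : 1ℤ - a * u ∣ b
      a-u∣b    : a - u ∣ b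
      q∣b+1    : q ∣ b + 1ℤ
      odd∣b+1  : ∀ t → suc (2 ℕ.* t) ℕ.≤ 3 ℕ.* n ℕ.+ 2 ℕ.* I → q ^ suc (2 ℕ.* t) - 1ℤ ∣ b + 1ℤ

  qint-value : ∀ n q a b → evalP q a b (qint n) * (q - 1ℤ) ≡ q ^ n - 1ℤ
  qint-value zero    q a b = solve 1 (λ q → con (+ 0) :* (q :- con (+ 1)) := con (+ 1) :- con (+ 1)) refl q
  qint-value (suc n) q a b = begin
    (evalP q a b (qint n) + evalP q a b (varq ^P n)) * (q - 1ℤ)
      ≡⟨ ℤ.*-distribʳ-+ (q - 1ℤ) (evalP q a b (qint n)) (evalP q a b (varq ^P n)) ⟩
    evalP q a b (qint n) * (q - 1ℤ) + evalP q a b (varq ^P n) * (q - 1ℤ)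
      ≡⟨ cong₂ (λ x y → x + y * (q - 1ℤ)) (qint-value n q a b) (evalP-^ varq n q a b) ⟩
    q ^ n - 1ℤ + q ^ n * (q - 1ℤ)
      ≡⟨ solve 2 (λ q x → x :- con (+ 1) :+ x :* (q :- con (+ 1)) := q :* x :- con (+ 1)) refl q (q ^ n) ⟩
    q ^ suc n - 1ℤ ∎

  module _ {I t : ℕ} {q a b : ℤ} (pt : Point I (suc (2 ℕ.* t)) q a b) where
    open Point pt
    private
      n = suc (2 ℕ.* t)

    1+q^∣a : ∀ {i} → i ℕ.< I → 1ℤ + q ^ suc i ∣ a
    1+q^∣a {i} i<I = ℤ.∣-trans (divides (q ^ suc i - 1ℤ) (trans (cong (_- 1ℤ) (ℤ.^-distribˡ-+-* q (suc i) (suc i)))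
      (solve 1 (λ x → x :* x :- con (+ 1) := (x :- con (+ 1)) :* (con (+ 1) :+ x)) refl (q ^ suc i))))
      (q^-1∣a (i ℕ.+ suc i) (ℕ.≤-trans (ℕ.+-mono-≤ i<I (ℕ.≤-trans i<I (ℕ.m≤m+n I _))) (ℕ.m≤n+m (4 ℕ.* I) n)))

    private
      a-multiple : ∀ {x} → x ∣ a → ∀ y → x ∣ a * y
      a-multiple h y = ℤ.∣m⇒∣m*n y h

      b-multiple : ∀ {x} → x ∣ b → ∀ y → x ∣ b ^ 3 * y
      b-multiple h y = ℤ.∣m⇒∣m*n y (ℤ.∣m⇒∣m*n (b ^ 2) h)

      ab-multiple : ∀ {x} → x ∣ b → x ∣ a * b
      ab-multiple h = ℤ.∣n⇒∣m*n a h

      a-q^⊥q : ∀ k → a - q ^ suc k ⊥ q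
      a-q^⊥q k = ⊥-sym (-multiple- (⊥-sym a⊥q))
        where
        -multiple- : q ⊥ a → q ⊥ a - q ^ suc k
        -multiple- = -multiple (ℤ.∣m⇒∣m*n (q ^ k) ∣-self)

      1-aq^⊥q : ∀ k → 1ℤ - a * q ^ suc k ⊥ q
      1-aq^⊥q k = ⊥-sym (1-multiple (ℤ.∣n⇒∣m*n a (ℤ.∣m⇒∣m*n (q ^ k) ∣-self)))

      1-aq^⊥q^-1 : ∀ k j → suc j ℕ.≤ n ℕ.+ 4 ℕ.* I → 1ℤ - a * q ^ k ⊥ q ^ suc j - 1ℤ
      1-aq^⊥q^-1 k j j≤ = ⊥-sym (1-multiple (a-multiple (q^-1∣a j j≤) (q ^ k)))

      a-q^⊥q^-1 : ∀ k j → suc j ℕ.≤ n ℕ.+ 4 ℕ.* I → a - q ^ k ⊥ q ^ suc j - 1ℤ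
      a-q^⊥q^-1 k j j≤ = ⊥-sym (multiple- (q^-1∣a j j≤) (⊥-^ (⊥-sym (q⊥q^-1 q j)) k))

      q^-q^ : ∀ x k j → x ⊥ q → x ⊥ q ^ suc j - 1ℤ → x ⊥ q ^ (k ℕ.+ suc j) - q ^ k
      q^-q^ x k j x⊥q x⊥ = subst (x ⊥_) (begin
        q ^ k * (q ^ suc j - 1ℤ)       ≡⟨ solve 2 (λ x y → x :* (y :- con (+ 1)) := x :* y :- x) refl (q ^ k) (q ^ suc j) ⟩
        q ^ k * q ^ suc j - q ^ k      ≡⟨ cong (_- q ^ k) (ℤ.^-distribˡ-+-* q k (suc j)) ⟨
        q ^ (k ℕ.+ suc j) - q ^ k      ∎) (⊥-* (⊥-^ x⊥q k) x⊥)

      split : ∀ {m k} → m ℕ.< k → k ≡ m ℕ.+ suc (k ℕ.∸ suc m)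
      split {m} {k} m<k = sym (trans (ℕ.+-suc m _) (ℕ.m+[n∸m]≡n m<k))

      -- Eliminating `a` between a denominator and a factor of the modulus can leave
      -- `q ^ n - q ^ (4 i)`. As the exponents differ, this is up to sign a power of `q` times some
      -- `q ^ j - 1` with `j ≥ 1`.
      q^-q^′ : ∀ x i → i ℕ.< I → 4 ℕ.* suc i ≢ n → x ⊥ q → (∀ j → suc j ℕ.≤ n ℕ.+ 4 ℕ.* I → x ⊥ q ^ suc j - 1ℤ) → x ⊥ q ^ n - q ^ (4 ℕ.* suc i)
      q^-q^′ x i i<I i≢ x⊥q h with ℕ.<-cmp (4 ℕ.* suc i) n
      ... | tri< lt _ _ = subst (λ k → x ⊥ q ^ k - q ^ (4 ℕ.* suc i)) (sym (split lt)) (q^-q^ x (4 ℕ.* suc i) _ x⊥q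
              (h _ (ℕ.≤-trans (ℕ.m≤n+m _ (4 ℕ.* suc i)) (ℕ.≤-trans (ℕ.≤-reflexive (sym (split lt))) (ℕ.m≤m+n n (4 ℕ.* I))))))
      ... | tri≈ _ eq _ = contradiction eq i≢
      ... | tri> _ _ gt = subst (x ⊥_) (solve 2 (λ x y → :- (x :- y) := y :- x) refl (q ^ (4 ℕ.* suc i)) (q ^ n))
              (⊥-neg (subst (λ k → x ⊥ q ^ k - q ^ n) (sym (split gt)) (q^-q^ x n _ x⊥q
              (h _ (ℕ.≤-trans (ℕ.m≤n+m _ n) (ℕ.≤-trans (ℕ.≤-reflexive (sym (split gt))) (ℕ.≤-trans (ℕ.*-monoʳ-≤ 4 i<I) (ℕ.m≤n+m (4 ℕ.* I) n))))))))

      n+4≤ : ∀ {i} → i ℕ.< I → n ℕ.+ 4 ℕ.* suc i ℕ.≤ n ℕ.+ 4 ℕ.* I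
      n+4≤ i<I = ℕ.+-monoʳ-≤ n (ℕ.*-monoʳ-≤ 4 i<I)

    -- Stated with `q ^ n - 1` in place of its divisor [n], because the closed form is easy to
    -- reduce modulo the other factors.
    Prime-to-factors : ℤ → Set
    Prime-to-factors d = ((d ⊥ q ^ n - 1ℤ) × (d ⊥ 1ℤ - a * u)) × ((d ⊥ a - u) × (d ⊥ b - u))

    prime-* : ∀ {d d′} → Prime-to-factors d → Prime-to-factors d′ → Prime-to-factors (d * d′)
    prime-* ((x , y) , (z , w)) ((x′ , y′) , (z′ , w′)) = (⊥-*ˡ x x′ , ⊥-*ˡ y y′) , (⊥-*ˡ z z′ , ⊥-*ˡ w w′)

    prime-1 : Prime-to-factors 1ℤ
    prime-1 = (⊥-sym ⊥-1 , ⊥-sym ⊥-1) , (⊥-sym ⊥-1 , ⊥-sym ⊥-1)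

    prime-q : Prime-to-factors q
    prime-q = (q⊥q^-1 q (2 ℕ.* t) , ⊥-sym (1-aq^⊥q (2 ℕ.* t))) , (⊥-sym (a-q^⊥q (2 ℕ.* t)) ,
      -multiple (ℤ.∣m⇒∣m*n (q ^ (2 ℕ.* t)) ∣-self) q⊥b)
      where
      q⊥b : q ⊥ b
      q⊥b = ⊥-mod (∣-resp (solve 1 (λ b → :- (b :+ con (+ 1)) := (:- con (+ 1)) :- b) refl b) (ℤ.∣m⇒∣-m q∣b+1)) (⊥-neg ⊥-1)

    prime-1+q^ : ∀ {i} → i ℕ.< I → Prime-to-factors (1ℤ + q ^ suc i)
    prime-1+q^ {i} i<I = (1+q^⊥q^odd-1 {h = half} even i t , 1-multiple (a-multiple (1+q^∣a i<I) u)) ,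
      (multiple- (1+q^∣a i<I) u⊥ , multiple- (1+q^∣b i i<I) u⊥)
      where
      u⊥ : 1ℤ + q ^ suc i ⊥ u
      u⊥ = ⊥-^ (⊥-sym (q⊥1+q^ q i)) n

    prime-1-aq : ∀ {i} → i ℕ.< I → 4 ℕ.* suc i ≢ n → Prime-to-factors (1ℤ - a * q ^ (4 ℕ.* suc i))
    prime-1-aq {i} i<I i≢ = (1-aq^⊥q^-1 k _ (ℕ.m≤m+n n (4 ℕ.* I)) , ⊥-sym second) , (⊥-sym third , multiple- (1-aq∣b i i<I) (⊥-^ (1-aq^⊥q (i ℕ.+ 3 ℕ.* suc i)) n))
      where
      k = 4 ℕ.* suc i
      x = 1ℤ - a * u
      y = 1ℤ - a * q ^ k
      -- u y = qᵏ x - (qᵏ - u)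
      second : x ⊥ y
      second = ⊥-∣ (divides u refl) (⊥-mod (divides (- q ^ k)
        (solve 3 (λ a u v → u :- v :- u :* (con (+ 1) :- a :* v) := (:- v) :* (con (+ 1) :- a :* u)) refl a u (q ^ k)))
        (q^-q^′ x i i<I i≢ (1-aq^⊥q (2 ℕ.* t)) (λ j → 1-aq^⊥q^-1 n j)))
      third : a - u ⊥ y
      third = ⊥-mod (divides (q ^ k) (begin
        - (q ^ (n ℕ.+ k) - 1ℤ) - y         ≡⟨ cong (λ w → - (w - 1ℤ) - y) (ℤ.^-distribˡ-+-* q n k) ⟩
        - (u * q ^ k - 1ℤ) - y             ≡⟨ solve 3 (λ a u v → (:- (u :* v :- con (+ 1))) :- (con (+ 1) :- a :* v) := v :* (a :- u)) refl a u (q ^ k) ⟩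
        q ^ k * (a - u)                    ∎)) (⊥-neg (a-q^⊥q^-1 n _ (n+4≤ i<I)))

    prime-a-q : ∀ {i} → i ℕ.< I → 4 ℕ.* suc i ≢ n → Prime-to-factors (a - q ^ (4 ℕ.* suc i))
    prime-a-q {i} i<I i≢ = (a-q^⊥q^-1 k _ (ℕ.m≤m+n n (4 ℕ.* I)) , ⊥-sym second) , (⊥-sym third , multiple- (a-q∣b i i<I) (⊥-^ (a-q^⊥q (i ℕ.+ 3 ℕ.* suc i)) n))
      where
      k = 4 ℕ.* suc i
      x = 1ℤ - a * u
      y = a - q ^ k
      -- u y = 1 - u qᵏ - x
      second : x ⊥ y
      second = ⊥-∣ (divides u refl) (⊥-mod (divides 1ℤ (begin
        - (q ^ (n ℕ.+ k) - 1ℤ) - u * y     ≡⟨ cong (λ w → - (w - 1ℤ) - u * y) (ℤ.^-distribˡ-+-* q n k) ⟩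
        - (u * q ^ k - 1ℤ) - u * y         ≡⟨ solve 3 (λ a u v → (:- (u :* v :- con (+ 1))) :- u :* (a :- v) := con (+ 1) :* (con (+ 1) :- a :* u)) refl a u (q ^ k) ⟩
        1ℤ * x                             ∎)) (⊥-neg (1-aq^⊥q^-1 n _ (n+4≤ i<I))))
      third : a - u ⊥ y
      third = ⊥-mod (divides (- 1ℤ) (solve 3 (λ a u v → u :- v :- (a :- v) := (:- con (+ 1)) :* (a :- u)) refl a u (q ^ k)))
        (q^-q^′ (a - u) i i<I i≢ (a-q^⊥q (2 ℕ.* t)) (λ j → a-q^⊥q^-1 n j))

    prime-1-b³q : ∀ {i} → i ℕ.< I → Prime-to-factors (1ℤ - b ^ 3 * q ^ (2 ℕ.* suc i))
    prime-1-b³q {i} i<I = (⊥-sym first , ⊥-sym (1-multiple (b-multiple 1-au∣b (q ^ k)))) , (⊥-sym (1-multiple (b-multiple a-u∣b (q ^ k))) , ⊥-sym fourth)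
      where
      k = 2 ℕ.* suc i
      y = 1ℤ - b ^ 3 * q ^ k
      first : q ^ n - 1ℤ ⊥ y
      -- Here `b ≡ -1` modulo `q ^ n - 1`, hence `b ^ 3 ≡ -1` and `y` becomes `1 + q ^ k`.
      first = ⊥-mod (∣-resp (solve 2 (λ b v → v :* (b :* b :- b :+ con (+ 1)) :* (b :+ con (+ 1)) := con (+ 1) :+ v :- (con (+ 1) :- b :* (b :* (b :* con (+ 1))) :* v)) refl b (q ^ k))
        (ℤ.∣n⇒∣m*n (q ^ k * (b * b - b + 1ℤ)) (odd∣b+1 t (ℕ.≤-trans (ℕ.m≤m+n n (2 ℕ.* n)) (ℕ.m≤m+n (3 ℕ.* n) (2 ℕ.* I))))))
        (⊥-sym (1+q^⊥q^odd-1 {h = half} even (i ℕ.+ 1 ℕ.* suc i) t))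
      s = suc (t ℕ.+ (t ℕ.+ (t ℕ.+ suc i)))
      exponent : 3 ℕ.* n ℕ.+ k ≡ suc (2 ℕ.* s)
      exponent = 3n+2i-odd t i
      -- Modulo `b - u`, `y` is `1 - q ^ (3 n + k)`, whose exponent is odd. Modulo
      -- `q ^ (3 n + k) - 1` in turn, `b ≡ -1` makes `b - u` equal to `-(1 + u)`.
      b-u⊥ : b - u ⊥ q ^ suc (2 ℕ.* s) - 1ℤ
      b-u⊥ = ⊥-sym (⊥-mod (∣-resp (solve 2 (λ b u → :- (b :+ con (+ 1)) := (:- (con (+ 1) :+ u)) :- (b :- u)) refl b u)
        (ℤ.∣m⇒∣-m (odd∣b+1 s (subst (ℕ._≤ 3 ℕ.* n ℕ.+ 2 ℕ.* I) exponent (ℕ.+-monoʳ-≤ (3 ℕ.* n) (ℕ.*-monoʳ-≤ 2 i<I))))))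
        (⊥-neg (⊥-sym (1+q^⊥q^odd-1 {h = half} even (2 ℕ.* t) s))))
      fourth : b - u ⊥ y
      fourth = ⊥-mod (divides (q ^ k * (b * b + b * u + u * u)) (begin
        - (q ^ suc (2 ℕ.* s) - 1ℤ) - y      ≡⟨ cong (λ e → - (q ^ e - 1ℤ) - y) exponent ⟨
        - (q ^ (3 ℕ.* n ℕ.+ k) - 1ℤ) - y    ≡⟨ cong (λ w → - (w - 1ℤ) - y) (trans (ℤ.^-distribˡ-+-* q (3 ℕ.* n) k) (cong (_* q ^ k)
                                                 (trans (cong (q ^_) (ℕ.*-comm 3 n)) (sym (ℤ.^-*-assoc q n 3))))) ⟩
        - (u ^ 3 * q ^ k - 1ℤ) - y          ≡⟨ solve 3 (λ b u v → (:- (u :* (u :* (u :* con (+ 1))) :* v :- con (+ 1))) :- (con (+ 1) :- b :* (b :* (b :* con (+ 1))) :* v)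
                                                 := v :* (b :* b :+ b :* u :+ u :* u) :* (b :- u)) refl b u (q ^ k) ⟩
        q ^ k * (b * b + b * u + u * u) * (b - u) ∎)) (⊥-neg b-u⊥)

    prime-a-b : Prime-to-factors (a - b)
    prime-a-b = (⊥-sym (multiple- (q^-1∣a (2 ℕ.* t) (ℕ.m≤m+n n (4 ℕ.* I))) first) , ⊥-sym (-multiple 1-au∣b second)) , (⊥-sym (-multiple a-u∣b third) , ⊥-sym fourth)
      where
      first : q ^ n - 1ℤ ⊥ b
      first = ⊥-mod (∣-resp (solve 1 (λ b → :- (b :+ con (+ 1)) := (:- con (+ 1)) :- b) refl b)
        (ℤ.∣m⇒∣-m (odd∣b+1 t (ℕ.≤-trans (ℕ.m≤m+n n (2 ℕ.* n)) (ℕ.m≤m+n (3 ℕ.* n) (2 ℕ.* I)))))) (⊥-neg ⊥-1)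
      second : 1ℤ - a * u ⊥ a
      second = ⊥-sym (1-multiple (ℤ.∣m⇒∣m*n u ∣-self))
      third : a - u ⊥ a
      third = ⊥-sym (multiple- ∣-self (⊥-^ a⊥q n))
      fourth : b - u ⊥ a - b
      fourth = ⊥-mod (divides 1ℤ (solve 3 (λ a b u → a :- u :- (a :- b) := con (+ 1) :* (b :- u)) refl a b u))
        (⊥-sym (multiple- a-u∣b (⊥-^ (a-q^⊥q (2 ℕ.* t)) n)))

    prime-1-ab : Prime-to-factors (1ℤ - a * b)
    prime-1-ab = (⊥-sym (1-multiple (a-multiple (q^-1∣a (2 ℕ.* t) (ℕ.m≤m+n n (4 ℕ.* I))) b)) , ⊥-sym (1-multiple (ab-multiple 1-au∣b))) ,
      (⊥-sym (1-multiple (ab-multiple a-u∣b)) , ⊥-sym fourth)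
      where
      fourth : b - u ⊥ 1ℤ - a * b
      fourth = ⊥-mod (divides a (solve 3 (λ a b u → con (+ 1) :- a :* u :- (con (+ 1) :- a :* b) := a :* (b :- u)) refl a b u))
        (⊥-sym (multiple- 1-au∣b (⊥-^ (1-aq^⊥q (2 ℕ.* t)) n)))

    good-prime : (∀ i → 4 ℕ.* suc i ≢ n) → ∀ {D} → Good I D → Prime-to-factors (evalP q a b D)
    good-prime i≢ one         = prime-1
    good-prime i≢ (times g h) = prime-* (good-prime i≢ g) (good-prime i≢ h)
    good-prime i≢ q-good      = prime-q
    good-prime i≢ (1+q {i} i<I)   = subst (λ x → Prime-to-factors (1ℤ + x)) (sym (evalP-^ varq (suc i) q a b)) (prime-1+q^ i<I)
    good-prime i≢ (1-aq {i} i<I)  = subst (λ x → Prime-to-factors (1ℤ - a * x)) (sym (evalP-^ varq (4 ℕ.* suc i) q a b)) (prime-1-aq i<I (i≢ i))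
    good-prime i≢ (a-q {i} i<I)   = subst (λ x → Prime-to-factors (a - x)) (sym (evalP-^ varq (4 ℕ.* suc i) q a b)) (prime-a-q i<I (i≢ i))
    good-prime i≢ (1-b³q {i} i<I) = subst (λ x → Prime-to-factors (1ℤ - b ^ 3 * x)) (sym (evalP-^ varq (2 ℕ.* suc i) q a b)) (prime-1-b³q i<I)
    good-prime i≢ a-b         = prime-a-b
    good-prime i≢ 1-ab        = prime-1-ab

    good⊥modulus : (∀ i → 4 ℕ.* suc i ≢ n) → ∀ {D} → Good I D → evalP q a b D ⊥ evalP q a b (modulus n)
    good⊥modulus i≢ {D} g with good-prime i≢ g
    ... | (h₁ , h₂) , (h₃ , h₄) = subst (λ x → evalP q a b D ⊥ N * (1ℤ - a * x) * (a - x) * (b - x)) (sym (evalP-^ varq n q a b))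
      (⊥-* {z = b - u} (⊥-* {z = a - u} (⊥-* {z = 1ℤ - a * u} (⊥-∣ {z = N} (divides (q - 1ℤ) (trans (sym (qint-value n q a b)) (ℤ.*-comm N (q - 1ℤ)))) h₁) h₂) h₃) h₄)
      where N = evalP q a b (qint n)

  ∏ℤ : ℕ → (ℕ → ℤ) → ℤ
  ∏ℤ zero    f = 1ℤ
  ∏ℤ (suc m) f = ∏ℤ m f * f m

  ∣-∏ : ∀ {m i} f → i ℕ.< m → f i ∣ ∏ℤ m f
  ∣-∏ {suc m} {i} f i<1+m with ℕ.m≤n⇒m<n∨m≡n (ℕ.s≤s⁻¹ i<1+m)
  ... | inj₁ i<m  = ℤ.∣m⇒∣m*n (f m) (∣-∏ f i<m)
  ... | inj₂ refl = ℤ.∣n⇒∣m*n (∏ℤ m f) ∣-self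

  ∏-⊥ : ∀ m {f x} → (∀ i → i ℕ.< m → f i ⊥ x) → ∏ℤ m f ⊥ x
  ∏-⊥ zero    h = ⊥-sym ⊥-1
  ∏-⊥ (suc m) h = ⊥-*ˡ (∏-⊥ m (λ i i<m → h i (ℕ.m<n⇒m<1+n i<m))) (h m ℕ.≤-refl)

  -- Zero is coprime to units only, and an even number is not a unit. This keeps the moduli and the
  -- increments below nonzero.
  ⊥even⇒≢0 : ∀ {x q h} → q ≡ h + h → x ⊥ q → x ≢ + 0
  ⊥even⇒≢0 {h = h} refl (bézout s t e) refl with ℕ.m*n≡1⇒m≡1 2 ℤ.∣ t * h ∣ (trans (sym (ℤ.abs-* (+ 2) (t * h))) (cong ℤ.∣_∣ (trans
    (solve 3 (λ s t h → con (+ 2) :* (t :* h) := s :* con (+ 0) :+ t :* (h :+ h)) refl s t h) e)))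
  ... | ()

  *-≢0 : ∀ {x y} → x ≢ + 0 → y ≢ + 0 → x * y ≢ + 0
  *-≢0 {x} x≢0 y≢0 h with ℤ.i*j≡0⇒i≡0∨j≡0 x h
  ... | inj₁ e = x≢0 e
  ... | inj₂ e = y≢0 e

  affine-injective : ∀ {x y j k} → y ≢ + 0 → x + y * + j ≡ x + y * + k → j ≡ k
  affine-injective {x} {y} {j} {k} y≢0 h = ℤ.+-injective (ℤ.*-cancelˡ-≡ y (+ j) (+ k) {{ℤ.≢-nonZero y≢0}} (∙-cancelˡ x (y * + j) (y * + k) h))

  -- An infinite family of solutions, because the points have to be Zariski dense.
  record Solutions (x y : ℤ) : Set where
    field
      b           : ℕ → ℤ
      b-injective : ∀ {k l} → b k ≡ b l → k ≡ l
      x∣b         : ∀ k → x ∣ b k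
      y∣b+1       : ∀ k → y ∣ b k + 1ℤ

  abstract
    chinese-remainder : ∀ {x y} → x ≢ + 0 → y ≢ + 0 → x ⊥ y → Solutions x y
    chinese-remainder {x} {y} x≢0 y≢0 (bézout σ τ e) = record
      { b           = λ k → - σ * x + x * y * + k
      ; b-injective = affine-injective { - σ * x} {x * y} (*-≢0 x≢0 y≢0)
      ; x∣b         = λ k → divides (- σ + y * + k) (solve 4 (λ s x y k → :- s :* x :+ x :* y :* k := (:- s :+ y :* k) :* x) refl σ x y (+ k))
      ; y∣b+1       = λ k → divides (τ + x * + k) (trans (cong (λ e → - σ * x + x * y * + k + e) (sym e))
          (solve 5 (λ s t x y k → :- s :* x :+ x :* y :* k :+ (s :* x :+ t :* y) := (t :+ x :* k) :* y) refl σ τ x y (+ k)))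
      }

  -- The choice of residues: `a = Π (1 + q j)` vanishes modulo every `q ^ k - 1` in range and is
  -- prime to `q`. `b` vanishes modulo the factors `1 + q ^ i`, `1 - a q ^ k` and `a - q ^ k`
  -- collected in `X`, and is -1 modulo `q` and modulo `q ^ k - 1` for odd `k`. In the latter case
  -- the residue 0 would spoil `a - b`, and the residue 1 would turn `1 - b³ q ^ k` into a multiple
  -- of `q - 1`.
  module Construction (I t bound : ℕ) (bound≤ : 3 ℕ.* suc (2 ℕ.* t) ℕ.+ 2 ℕ.* I ℕ.≤ bound)
    {q half : ℤ} (even : q ≡ half + half) (q≢0 : q ≢ + 0) where
    n : ℕ
    n = suc (2 ℕ.* t)

    Π V : ℤ
    Π = ∏ℤ (2 ℕ.* bound) (λ j → q ^ suc j - 1ℤ)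
    V = ∏ℤ bound (λ t → q ^ suc (2 ℕ.* t) - 1ℤ)

    q^-1⊥q : ∀ j → q ^ suc j - 1ℤ ⊥ q
    q^-1⊥q j = ⊥-sym (q⊥q^-1 q j)

    Π⊥q : Π ⊥ q
    Π⊥q = ∏-⊥ (2 ℕ.* bound) (λ j _ → q^-1⊥q j)

    V⊥q : V ⊥ q
    V⊥q = ∏-⊥ bound (λ t _ → q^-1⊥q (2 ℕ.* t))

    a : ℕ → ℤ
    a j = Π + Π * q * + j

    a-injective : ∀ {j k} → a j ≡ a k → j ≡ k
    a-injective = affine-injective {Π} {Π * q} (*-≢0 (⊥even⇒≢0 {h = half} even Π⊥q) q≢0)

    a≡ : ∀ j → Π * (1ℤ + q * + j) ≡ a j
    a≡ j = solve 3 (λ p q j → p :* (con (+ 1) :+ q :* j) := p :+ p :* q :* j) refl Π q (+ j)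

    a⊥q : ∀ j → a j ⊥ q
    a⊥q j = subst (_⊥ q) (a≡ j) (⊥-*ˡ Π⊥q (⊥-sym (⊥-mod (divides (- + j)
      (solve 2 (λ q j → con (+ 1) :- (con (+ 1) :+ q :* j) := (:- j) :* q) refl q (+ j))) ⊥-1)))

    q^-1∣a : ∀ j k → k ℕ.< 2 ℕ.* bound → q ^ suc k - 1ℤ ∣ a j
    q^-1∣a j k k< = subst (q ^ suc k - 1ℤ ∣_) (a≡ j) (ℤ.∣m⇒∣m*n (1ℤ + q * + j) (∣-∏ (λ j → q ^ suc j - 1ℤ) k<))

    module _ (j : ℕ) where
      private
        α = a j

      1-αq^ α-q^ : ℕ → ℤ
      1-αq^ k = 1ℤ - α * q ^ k
      α-q^ k = α - q ^ k

      X Y : ℤ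
      X = 1-αq^ n * α-q^ n * (∏ℤ I (λ i → 1ℤ + q ^ suc i) * ∏ℤ I (λ i → 1-αq^ (4 ℕ.* suc i)) * ∏ℤ I (λ i → α-q^ (4 ℕ.* suc i)))
      Y = q * V

      ⊥Y : ∀ {x} → x ⊥ q → (∀ t → t ℕ.< bound → x ⊥ q ^ suc (2 ℕ.* t) - 1ℤ) → x ⊥ Y
      ⊥Y x⊥q h = ⊥-* x⊥q (⊥-sym (∏-⊥ bound (λ t t< → ⊥-sym (h t t<))))

      odd∣α : ∀ t → t ℕ.< bound → q ^ suc (2 ℕ.* t) - 1ℤ ∣ α
      odd∣α t t< = q^-1∣a j (2 ℕ.* t) (ℕ.*-monoʳ-< 2 t<)

      1-αq^⊥q : ∀ k → 1-αq^ (suc k) ⊥ q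
      1-αq^⊥q k = ⊥-sym (1-multiple (ℤ.∣n⇒∣m*n α (ℤ.∣m⇒∣m*n (q ^ k) ∣-self)))

      α-q^⊥q : ∀ k → α-q^ (suc k) ⊥ q
      α-q^⊥q k = ⊥-sym (-multiple (ℤ.∣m⇒∣m*n (q ^ k) ∣-self) (⊥-sym (a⊥q j)))

      1-αq^⊥Y : ∀ k → 1-αq^ (suc k) ⊥ Y
      1-αq^⊥Y k = ⊥Y (1-αq^⊥q k) (λ t t< → ⊥-sym (1-multiple (ℤ.∣m⇒∣m*n (q ^ suc k) (odd∣α t t<))))

      α-q^⊥Y : ∀ k → α-q^ (suc k) ⊥ Y
      α-q^⊥Y k = ⊥Y (α-q^⊥q k) (λ t t< → ⊥-sym (multiple- (odd∣α t t<) (⊥-^ (q^-1⊥q (2 ℕ.* t)) (suc k))))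

      X⊥Y : X ⊥ Y
      X⊥Y = ⊥-*ˡ (⊥-*ˡ (1-αq^⊥Y (2 ℕ.* t)) (α-q^⊥Y (2 ℕ.* t))) (⊥-*ˡ (⊥-*ˡ
        (∏-⊥ I (λ i _ → ⊥Y (⊥-sym (q⊥1+q^ q i)) (λ t _ → 1+q^⊥q^odd-1 {h = half} even i t)))
        (∏-⊥ I (λ i _ → 1-αq^⊥Y (i ℕ.+ 3 ℕ.* suc i)))) (∏-⊥ I (λ i _ → α-q^⊥Y (i ℕ.+ 3 ℕ.* suc i))))

      open Solutions (chinese-remainder (⊥even⇒≢0 {h = half} even (⊥-∣ (divides V (ℤ.*-comm q V)) X⊥Y))
        (*-≢0 q≢0 (⊥even⇒≢0 {h = half} even V⊥q)) X⊥Y) public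

      point : ∀ k → Point I n q α (b k)
      point k = record
        { half    = half
        ; even    = even
        ; a⊥q     = a⊥q j
        ; q^-1∣a  = λ i i< → q^-1∣a j i (ℕ.≤-trans i< range)
        ; 1+q^∣b  = λ i i<I → via (ℤ.∣n⇒∣m*n (1-αq^ n * α-q^ n) (ℤ.∣m⇒∣m*n A₃ (ℤ.∣m⇒∣m*n A₂ (∣-∏ (λ i → 1ℤ + q ^ suc i) i<I))))
        ; 1-aq∣b  = λ i i<I → via (ℤ.∣n⇒∣m*n (1-αq^ n * α-q^ n) (ℤ.∣m⇒∣m*n A₃ (ℤ.∣n⇒∣m*n A₁ (∣-∏ (λ i → 1-αq^ (4 ℕ.* suc i)) i<I))))
        ; a-q∣b   = λ i i<I → via (ℤ.∣n⇒∣m*n (1-αq^ n * α-q^ n) (ℤ.∣n⇒∣m*n (A₁ * A₂) (∣-∏ (λ i → α-q^ (4 ℕ.* suc i)) i<I)))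
        ; 1-au∣b  = via (ℤ.∣m⇒∣m*n (A₁ * A₂ * A₃) (ℤ.∣m⇒∣m*n (α-q^ n) ∣-self))
        ; a-u∣b   = via (ℤ.∣m⇒∣m*n (A₁ * A₂ * A₃) (ℤ.∣n⇒∣m*n (1-αq^ n) ∣-self))
        ; q∣b+1   = ℤ.∣-trans (ℤ.∣m⇒∣m*n V ∣-self) (y∣b+1 k)
        ; odd∣b+1 = λ t t≤ → ℤ.∣-trans (ℤ.∣n⇒∣m*n q (∣-∏ (λ t → q ^ suc (2 ℕ.* t) - 1ℤ) (ℕ.≤-trans (ℕ.≤-trans (s≤s (ℕ.m≤n*m t 2)) t≤) bound≤))) (y∣b+1 k)
        }
        where
        A₁ = ∏ℤ I (λ i → 1ℤ + q ^ suc i)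
        A₂ = ∏ℤ I (λ i → 1-αq^ (4 ℕ.* suc i))
        A₃ = ∏ℤ I (λ i → α-q^ (4 ℕ.* suc i))
        via : ∀ {x} → x ∣ X → x ∣ b k
        via h = ℤ.∣-trans h (x∣b k)
        range : n ℕ.+ 4 ℕ.* I ℕ.≤ 2 ℕ.* bound
        range = ℕ.≤-trans (ℕ.≤-trans (ℕ.+-mono-≤ (ℕ.m≤n*m n 6) ℕ.≤-refl) (ℕ.≤-reflexive (6n+4i-even n I))) (ℕ.*-monoʳ-≤ 2 bound≤)

  record DensePoints (I n : ℕ) : Set where
    field
      q : ℕ → ℤ
      a : ℕ → ℕ → ℤ
      b : ℕ → ℕ → ℕ → ℤ
      q-injective : ∀ {i j} → q i ≡ q j → i ≡ j
      a-injective : ∀ i {j k} → a i j ≡ a i k → j ≡ k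
      b-injective : ∀ i j {k l} → b i j k ≡ b i j l → k ≡ l
      point       : ∀ i j k → Point I n (q i) (a i j) (b i j k)

  abstract
    dense-points : ∀ I t → DensePoints I (suc (2 ℕ.* t))
    dense-points I t = record
      { q = q
      ; a = λ i → C.a i
      ; b = λ i j → C.b i j
      ; q-injective = λ e → ℕ.*-cancelˡ-≡ _ _ 2 (ℕ.suc-injective (ℕ.suc-injective (ℤ.+-injective e)))
      ; a-injective = λ i → C.a-injective i
      ; b-injective = λ i j → C.b-injective i j
      ; point       = λ i j k → C.point i j k
      }
      where
      q : ℕ → ℤ
      q i = + (2 ℕ.+ 2 ℕ.* i)
      module C (i : ℕ) = Construction I t (3 ℕ.* suc (2 ℕ.* t) ℕ.+ 2 ℕ.* I) ℕ.≤-refl {q i} {+ suc i}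
        (cong (λ k → + suc k) (trans (cong suc (cong (i ℕ.+_) (ℕ.+-identityʳ i))) (sym (ℕ.+-suc i i)))) (λ ())

-- The field of rational numbers

fromℤ : ℤ → ℚ
fromℤ z = fromℚᵘ (mkℚᵘ z 0)

module fromℤ where
  toℚᵘ-fromℤ : ∀ z → toℚᵘ (fromℤ z) ℚᵘ.≃ mkℚᵘ z 0
  toℚᵘ-fromℤ z = ℚ.toℚᵘ-fromℚᵘ (mkℚᵘ z 0)

  open ℚᵘ.≃-Reasoning

  homo-+ : ∀ x y → fromℤ (x ℤ.+ y) ≡ fromℤ x ℚ.+ fromℤ y
  homo-+ x y = ℚ.toℚᵘ-injective (begin
    toℚᵘ (fromℤ (x ℤ.+ y))                ≈⟨ toℚᵘ-fromℤ _ ⟩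
    mkℚᵘ (x ℤ.+ y) 0                      ≈⟨ *≡* (cong (ℤ._* + 1) (sym (cong₂ ℤ._+_ (ℤ.*-identityʳ x) (ℤ.*-identityʳ y)))) ⟩
    mkℚᵘ x 0 ℚᵘ.+ mkℚᵘ y 0                ≈⟨ ℚᵘ.+-cong (toℚᵘ-fromℤ x) (toℚᵘ-fromℤ y) ⟨
    toℚᵘ (fromℤ x) ℚᵘ.+ toℚᵘ (fromℤ y)    ≈⟨ ℚ.toℚᵘ-homo-+ (fromℤ x) (fromℤ y) ⟨
    toℚᵘ (fromℤ x ℚ.+ fromℤ y)            ∎)

  homo-* : ∀ x y → fromℤ (x ℤ.* y) ≡ fromℤ x ℚ.* fromℤ y
  homo-* x y = ℚ.toℚᵘ-injective (begin
    toℚᵘ (fromℤ (x ℤ.* y))                ≈⟨ toℚᵘ-fromℤ _ ⟩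
    mkℚᵘ x 0 ℚᵘ.* mkℚᵘ y 0                ≈⟨ ℚᵘ.*-cong (toℚᵘ-fromℤ x) (toℚᵘ-fromℤ y) ⟨
    toℚᵘ (fromℤ x) ℚᵘ.* toℚᵘ (fromℤ y)    ≈⟨ ℚ.toℚᵘ-homo-* (fromℤ x) (fromℤ y) ⟨
    toℚᵘ (fromℤ x ℚ.* fromℤ y)            ∎)

  homo‿- : ∀ x → fromℤ (ℤ.- x) ≡ ℚ.- fromℤ x
  homo‿- x = ℚ.toℚᵘ-injective (begin
    toℚᵘ (fromℤ (ℤ.- x))                  ≈⟨ toℚᵘ-fromℤ _ ⟩
    ℚᵘ.- mkℚᵘ x 0                         ≈⟨ ℚᵘ.-‿cong (toℚᵘ-fromℤ x) ⟨
    ℚᵘ.- toℚᵘ (fromℤ x)                   ≈⟨ ℚ.toℚᵘ-homo‿- (fromℤ x) ⟨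
    toℚᵘ (ℚ.- fromℤ x)                    ∎)

  injective : ∀ {x y} → fromℤ x ≡ fromℤ y → x ≡ y
  injective {x} {y} eq with ℚ.fromℚᵘ-injective {mkℚᵘ x 0} {mkℚᵘ y 0} eq
  ... | *≡* h = trans (sym (ℤ.*-identityʳ x)) (trans h (ℤ.*-identityʳ y))

-- 1/0 = 0.
inverse : ℚ → ℚ
inverse x with x ℚ.≟ 0ℚ
... | yes _   = 0ℚ
... | no  x≢0 = (1/ x) {{≢-nonZero x≢0}}

*-inverse : ∀ {x} → x ≢ 0ℚ → x ℚ.* inverse x ≡ 1ℚ
*-inverse {x} x≢0 with x ℚ.≟ 0ℚ
... | yes x≡0 = contradiction x≡0 x≢0
... | no  x≢0 = ℚ.*-inverseʳ x {{≢-nonZero x≢0}}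

infix  8 -_
infixl 7 _*_ _/_
infixl 6 _+_ _-_

-- K is ℚ, abstract so that type checking never unfolds rational arithmetic.
abstract
  K : Set
  K = ℚ

  _+_ _*_ : K → K → K
  _+_ = ℚ._+_
  _*_ = ℚ._*_

  -_ inv : K → K
  -_ = ℚ.-_
  inv = inverse

  0# 1# : K
  0# = 0ℚ
  1# = 1ℚ

  ι : ℤ → K
  ι = fromℤ

  isCommutativeRing : IsCommutativeRing _≡_ _+_ _*_ (λ x → - x) 0# 1#
  isCommutativeRing = ℚ.+-*-isCommutativeRing

  *-inv : ∀ {x} → x ≢ 0# → x * inv x ≡ 1#
  *-inv = *-inverse

  ι-+ : ∀ x y → ι (x ℤ.+ y) ≡ ι x + ι y
  ι-+ = fromℤ.homo-+

  ι-* : ∀ x y → ι (x ℤ.* y) ≡ ι x * ι y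
  ι-* = fromℤ.homo-*

  ι-neg : ∀ x → ι (ℤ.- x) ≡ - ι x
  ι-neg = fromℤ.homo‿-

  ι-0 : ι (+ 0) ≡ 0#
  ι-0 = refl

  ι-1 : ι (+ 1) ≡ 1#
  ι-1 = refl

  ι-injective : ∀ {x y} → ι x ≡ ι y → x ≡ y
  ι-injective = fromℤ.injective

_-_ _/_ : K → K → K
x - y = x + - y
x / y = x * inv y

K-ring : CommutativeRing _ _
K-ring = record { isCommutativeRing = isCommutativeRing }

module K = CommutativeRing K-ring

-- A ring solver over K with integer coefficients

module Solver where
  open import Algebra.Properties.Ring K.ring using (-‿distribˡ-*)
  open import Algebra.Properties.AbelianGroup K.+-abelianGroup using (⁻¹-∙-comm)
  open import Data.Maybe.Base using (nothing)
  open import Tactic.RingSolver.Core.AlmostCommutativeRing using (AlmostCommutativeRing)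
  open import Tactic.RingSolver.Core.Polynomial.Parameters
  import Tactic.RingSolver.Core.Expression as E
  open E using (Expr) public

  acr : AlmostCommutativeRing _ _
  acr = record
    { 0≟_ = λ _ → nothing
    ; isAlmostCommutativeRing = record
        { isCommutativeSemiring = K.isCommutativeSemiring
        ; -‿cong       = cong (λ t → - t)
        ; -‿*-distribˡ = λ x y → sym (-‿distribˡ-* x y)
        ; -‿+-comm     = ⁻¹-∙-comm
        }
    }

  -- Agrees with ι, but sends the literals 0 and 1 to 0# and 1# definitionally.
  ⟦_⟧ : ℤ → K
  ⟦ + 0 ⟧      = 0#
  ⟦ + 1 ⟧      = 1#
  ⟦ z ⟧        = ι z

  ⟦⟧≡ι : ∀ z → ⟦ z ⟧ ≡ ι z
  ⟦⟧≡ι (+ 0)           = sym ι-0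
  ⟦⟧≡ι (+ 1)           = sym ι-1
  ⟦⟧≡ι (+ suc (suc n)) = refl
  ⟦⟧≡ι -[1+ n ]        = refl

  isZero : ℤ → Bool
  isZero (+ 0) = true
  isZero _     = false

  -- The coefficients are integers so that normalisation can recognise zero by computation, which
  -- the abstract K does not allow.
  homo : Homomorphism _ _ _ _
  homo = record
    { from     = record { rawRing = ℤ.+-*-rawRing ; isZero = isZero }
    ; to       = acr
    ; morphism = record
        { ⟦_⟧    = ⟦_⟧
        ; +-homo = λ x y → trans (⟦⟧≡ι (x ℤ.+ y)) (trans (ι-+ x y) (sym (cong₂ _+_ (⟦⟧≡ι x) (⟦⟧≡ι y))))
        ; *-homo = λ x y → trans (⟦⟧≡ι (x ℤ.* y)) (trans (ι-* x y) (sym (cong₂ _*_ (⟦⟧≡ι x) (⟦⟧≡ι y))))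
        ; -‿homo = λ x → trans (⟦⟧≡ι (ℤ.- x)) (trans (ι-neg x) (cong (λ t → - t) (sym (⟦⟧≡ι x))))
        ; 0-homo = refl
        ; 1-homo = refl
        }
    ; Zero-C⟶Zero-R = λ { (+ 0) _ → refl }
    }

  open E.Eval K.rawRing ⟦_⟧ renaming (⟦_⟧ to eval)
  open import Tactic.RingSolver.Core.Polynomial.Base (Homomorphism.from homo)
    using (κ; _⊞_; _⊠_; ⊟_; _⊡_) renaming (Poly to Normal; ι to var)
  open import Tactic.RingSolver.Core.Polynomial.Semantics homo using () renaming (⟦_⟧ to evalₙ)
  open import Tactic.RingSolver.Core.Polynomial.Homomorphism homo
  open import Algebra.Properties.Semiring.Exp.TCOptimised K.semiring using (^-congˡ)

  norm : ∀ {n} → Expr ℤ n → Normal n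
  norm (E.Κ x)   = κ x
  norm (E.Ι x)   = var x
  norm (x E.⊕ y) = norm x ⊞ norm y
  norm (x E.⊗ y) = norm x ⊠ norm y
  norm (E.⊝ x)   = ⊟ norm x
  norm (x E.⊛ i) = norm x ⊡ i

  correct : ∀ {n} (e : Expr ℤ n) ρ → evalₙ (norm e) ρ ≡ eval e ρ
  correct (E.Κ x)   ρ = κ-hom x ρ
  correct (E.Ι x)   ρ = ι-hom x ρ
  correct (x E.⊕ y) ρ = trans (⊞-hom (norm x) (norm y) ρ) (cong₂ _+_ (correct x ρ) (correct y ρ))
  correct (x E.⊗ y) ρ = trans (⊠-hom (norm x) (norm y) ρ) (cong₂ _*_ (correct x ρ) (correct y ρ))
  correct (E.⊝ x)   ρ = trans (⊟-hom (norm x) ρ) (cong (λ t → - t) (correct x ρ))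
  correct (x E.⊛ i) ρ = trans (⊡-hom (norm x) i ρ) (^-congˡ i (correct x ρ))

  open import Relation.Binary.Reflection (setoid K) E.Ι eval (evalₙ ∘ norm) correct
    using (solve) public

  infixl 6 _:+_ _:-_
  infixl 7 _:*_
  infixr 8 _:^_
  infix  8 :-_
  infix  4 _:=_

  _:+_ _:*_ _:-_ : ∀ {n} → Expr ℤ n → Expr ℤ n → Expr ℤ n
  _:+_ = E._⊕_
  _:*_ = E._⊗_
  x :- y = x E.⊕ (E.⊝ y)

  :-_ : ∀ {n} → Expr ℤ n → Expr ℤ n
  :-_ = E.⊝_

  :0 :1 : ∀ {n} → Expr ℤ n
  :0 = E.Κ (+ 0)
  :1 = E.Κ (+ 1)

  _:^_ : ∀ {n} → Expr ℤ n → ℕ → Expr ℤ n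
  x :^ zero  = :1
  x :^ suc k = x :* x :^ k

  _:=_ : ∀ {n} → Expr ℤ n → Expr ℤ n → Expr ℤ n × Expr ℤ n
  _:=_ = _,_

open Solver using (solve; _:+_; _:*_; _:-_; :-_; :0; :1; _:^_; _:=_) public

-- Powers, finite products and finite sums in K

infixr 8 _^_
_^_ : K → ℕ → K
x ^ zero  = 1#
x ^ suc n = x * x ^ n

open ≡-Reasoning

x-y≡0⇒x≡y : ∀ {x y} → x - y ≡ 0# → x ≡ y
x-y≡0⇒x≡y {x} {y} h = begin
  x            ≡⟨ solve 2 (λ x y → x := (x :- y) :+ y) refl x y ⟩
  x - y + y    ≡⟨ cong (_+ y) h ⟩
  0# + y       ≡⟨ K.+-identityˡ y ⟩
  y            ∎

x≡y⇒x-y≡0 : ∀ {x y} → x ≡ y → x - y ≡ 0#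
x≡y⇒x-y≡0 {x} refl = K.-‿inverseʳ x

*-cancel-0 : ∀ {x y} → x ≢ 0# → x * y ≡ 0# → y ≡ 0#
*-cancel-0 {x} {y} x≢0 h = begin
  y                   ≡⟨ K.*-identityˡ y ⟨
  1# * y              ≡⟨ cong (_* y) (*-inv x≢0) ⟨
  x * inv x * y       ≡⟨ solve 3 (λ x i y → x :* i :* y := i :* (x :* y)) refl x (inv x) y ⟩
  inv x * (x * y)     ≡⟨ cong (inv x *_) h ⟩
  inv x * 0#          ≡⟨ K.zeroʳ (inv x) ⟩
  0#                  ∎

*-cancel : ∀ {x y z} → x ≢ 0# → x * y ≡ x * z → y ≡ z
*-cancel {x} {y} {z} x≢0 h = x-y≡0⇒x≡y (*-cancel-0 x≢0 (begin
  x * (y - z)      ≡⟨ solve 3 (λ x y z → x :* (y :- z) := x :* y :- x :* z) refl x y z ⟩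
  x * y - x * z    ≡⟨ x≡y⇒x-y≡0 h ⟩
  0#               ∎))

*-nonzero : ∀ {x y} → x ≢ 0# → y ≢ 0# → x * y ≢ 0#
*-nonzero x≢0 y≢0 h = y≢0 (*-cancel-0 x≢0 h)

1≢0 : 1# ≢ 0#
1≢0 h with () ← ι-injective (trans ι-1 (trans h (sym ι-0)))

/-* : ∀ {x y} → y ≢ 0# → x / y * y ≡ x
/-* {x} {y} y≢0 = begin
  x * inv y * y      ≡⟨ solve 3 (λ x i y → x :* i :* y := x :* (y :* i)) refl x (inv y) y ⟩
  x * (y * inv y)    ≡⟨ cong (x *_) (*-inv y≢0) ⟩
  x * 1#             ≡⟨ K.*-identityʳ x ⟩
  x                  ∎

≡-/ : ∀ {x y z} → y ≢ 0# → x * y ≡ z → x ≡ z / y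
≡-/ {x} {y} {z} y≢0 h = *-cancel y≢0 (trans (K.*-comm y x) (trans h (trans (sym (/-* y≢0)) (K.*-comm _ y))))

^-+ : ∀ x m n → x ^ (m ℕ.+ n) ≡ x ^ m * x ^ n
^-+ x zero    n = sym (K.*-identityˡ _)
^-+ x (suc m) n = trans (cong (x *_) (^-+ x m n)) (sym (K.*-assoc x (x ^ m) (x ^ n)))

^-* : ∀ x m n → x ^ (m ℕ.* n) ≡ (x ^ n) ^ m
^-* x zero    n = refl
^-* x (suc m) n = trans (^-+ x n (m ℕ.* n)) (cong (x ^ n *_) (^-* x m n))

^-nonzero : ∀ {x} → x ≢ 0# → ∀ n → x ^ n ≢ 0#
^-nonzero x≢0 zero    = 1≢0
^-nonzero x≢0 (suc n) = *-nonzero x≢0 (^-nonzero x≢0 n)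

∏ ∑ : ℕ → (ℕ → K) → K
∏ zero    f = 1#
∏ (suc n) f = ∏ n f * f n
∑ zero    f = 0#
∑ (suc n) f = ∑ n f + f n

∏-cong : ∀ n {f g} → (∀ i → f i ≡ g i) → ∏ n f ≡ ∏ n g
∏-cong zero    h = refl
∏-cong (suc n) h = cong₂ _*_ (∏-cong n h) (h n)

∑-cong : ∀ n {f g} → (∀ i → i ℕ.< n → f i ≡ g i) → ∑ n f ≡ ∑ n g
∑-cong zero    h = refl
∑-cong (suc n) h = cong₂ _+_ (∑-cong n (λ i i<n → h i (ℕ.m<n⇒m<1+n i<n))) (h n ℕ.≤-refl)

∏-distrib : ∀ n {f g} → ∏ n (λ i → f i * g i) ≡ ∏ n f * ∏ n g
∏-distrib zero    = sym (K.*-identityˡ 1#)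
∏-distrib (suc n) {f} {g} = trans (cong (_* (f n * g n)) (∏-distrib n))
  (solve 4 (λ a b c d → a :* b :* (c :* d) := a :* c :* (b :* d)) refl (∏ n f) (∏ n g) (f n) (g n))

∏-nonzero : ∀ n {f} → (∀ i → f i ≢ 0#) → ∏ n f ≢ 0#
∏-nonzero zero    h = 1≢0
∏-nonzero (suc n) h = *-nonzero (∏-nonzero n h) (h n)

∏-zero : ∀ {n i f} → i ℕ.< n → f i ≡ 0# → ∏ n f ≡ 0#
∏-zero {suc n} {i} {f} i<1+n h with ℕ.m≤n⇒m<n∨m≡n (ℕ.s≤s⁻¹ i<1+n)
... | inj₁ i<n  = trans (cong (_* f n) (∏-zero i<n h)) (K.zeroˡ (f n))
... | inj₂ refl = trans (cong (∏ n f *_) h) (K.zeroʳ _)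

∏-split : ∀ m n f → ∏ (m ℕ.+ n) f ≡ ∏ m f * ∏ n (λ i → f (m ℕ.+ i))
∏-split m zero    f = trans (cong (λ k → ∏ k f) (ℕ.+-identityʳ m)) (sym (K.*-identityʳ _))
∏-split m (suc n) f = trans (cong (λ k → ∏ k f) (ℕ.+-suc m n))
  (trans (cong (_* f (m ℕ.+ n)) (∏-split m n f)) (K.*-assoc _ _ _))

∏-head : ∀ n f → ∏ (suc n) f ≡ f 0 * ∏ n (f ∘ suc)
∏-head n f = trans (∏-split 1 n f) (cong (_* ∏ n (f ∘ suc)) (K.*-identityˡ (f 0)))

∏-scale : ∀ n x {f} → ∏ n (λ i → x * f i) ≡ x ^ n * ∏ n f
∏-scale zero    x     = sym (K.*-identityˡ 1#)
∏-scale (suc n) x {f} = trans (cong (_* (x * f n)) (∏-scale n x))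
  (solve 4 (λ x p s t → p :* s :* (x :* t) := x :* p :* (s :* t)) refl x (x ^ n) (∏ n f) (f n))

∑-distribˡ : ∀ n x {f} → x * ∑ n f ≡ ∑ n (λ i → x * f i)
∑-distribˡ zero    x = K.zeroʳ x
∑-distribˡ (suc n) x {f} = trans (K.distribˡ x _ _) (cong (_+ x * f n) (∑-distribˡ n x))

∑-0 : ∀ n {f} → (∀ i → i ℕ.< n → f i ≡ 0#) → ∑ n f ≡ 0#
∑-0 zero    h = refl
∑-0 (suc n) h = trans (cong₂ _+_ (∑-0 n (λ i i<n → h i (ℕ.m<n⇒m<1+n i<n))) (h n ℕ.≤-refl)) (K.+-identityˡ 0#)

∑-single : ∀ n {f} j → j ℕ.< n → (∀ i → i ℕ.< n → i ≢ j → f i ≡ 0#) → ∑ n f ≡ f j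
∑-single (suc n) {f} j j<1+n h with ℕ.m≤n⇒m<n∨m≡n (ℕ.s≤s⁻¹ j<1+n)
... | inj₁ j<n  = trans (cong₂ _+_ (∑-single n j j<n (λ i i<n → h i (ℕ.m<n⇒m<1+n i<n))) (h n ℕ.≤-refl (ℕ.<⇒≢ j<n ∘ sym)))
                        (K.+-identityʳ (f j))
... | inj₂ refl = trans (cong (_+ f n) (∑-0 n (λ i i<n → h i (ℕ.m<n⇒m<1+n i<n) (ℕ.<⇒≢ i<n)))) (K.+-identityˡ (f n))

-- An exponent such as 4 i + 4 is written `q ^ 4 * (q ^ i) ^ 4`, here and below, so that the ring
-- solver can treat `q ^ i` as an atom.
record Generic (q a : K) : Set where
  field
    q≢0      : q ≢ 0#
    1-q^≢0   : ∀ i → 1# - q ^ suc i ≢ 0#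
    1-aq≢0   : ∀ i → 1# - a * (q ^ 4 * (q ^ i) ^ 4) ≢ 0#
    a-q≢0    : ∀ i → a - q ^ 4 * (q ^ i) ^ 4 ≢ 0#

-- The terminating series

module Series (q a : K) where
  -- `g (q ^ k)` is (1 - q)[6k+1]. Both `ν` and `μ` contain the factor a that clears q/a and q⁴/a;
  -- `ν` also contains q^(2k+2), the step of q^(k²+k).
  ν μ g : K → K
  ν z = (1# - q * z ^ 2) * (1# - a * (q * z ^ 2)) * (a - q * z ^ 2) * (q ^ 2 * z ^ 2)
  μ z = (1# - q ^ 4 * z ^ 4) * (a - q ^ 4 * z ^ 4) * (1# - a * (q ^ 4 * z ^ 4))
  g z = 1# - q * z ^ 6

  -- With z = qⁱ and c = b³, the ratio of the terms i + 1 and i of the series is N c z g(q z) / (M c z g z).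
  N M : K → K → K
  N c z = ν z * (c - q * z ^ 4)
  M c z = μ z * (1# - c * (q ^ 2 * z ^ 2))

  P S : K → ℕ → K
  P c k = ∏ k (λ i → N c (q ^ i) / M c (q ^ i))
  S c n = ∑ n (λ k → g (q ^ k) * P c k)

  Λ L : K → K
  Λ W = (1# - q ^ 3 * W) * (1# - q ^ 5 * W) * a
  L W = (1# - a * (q ^ 4 * W)) * (a - q ^ 4 * W)

  R : ℕ → K
  R r = ∏ r (λ i → Λ ((q ^ i) ^ 4) / L ((q ^ i) ^ 4))

module Terminating {q a : K} (gen : Generic q a) where
  open Generic gen
  open Series q a

  1-[]≢0 : ∀ {x} k → x ≡ q ^ suc k → 1# - x ≢ 0#
  1-[]≢0 k refl = 1-q^≢0 k

  μ≢0 : ∀ i → μ (q ^ i) ≢ 0#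
  μ≢0 i = *-nonzero (*-nonzero (1-[]≢0 (3 ℕ.+ 4 ℕ.* i) 
      (trans (cong (q ^ 4 *_) (sym (^-* q 4 i))) (sym (^-+ q 4 (4 ℕ.* i))))) (a-q≢0 i)) (1-aq≢0 i)

  node : ∀ r i j → q * (q ^ r) ^ 4 * (q ^ j * (q ^ i) ^ 2) ≡ q ^ suc (4 ℕ.* r ℕ.+ (j ℕ.+ 2 ℕ.* i))
  node r i j = begin
    q * (q ^ r) ^ 4 * (q ^ j * (q ^ i) ^ 2)
      ≡⟨ cong₂ (λ x y → q * x * (q ^ j * y)) (^-* q 4 r) (^-* q 2 i) ⟨
    q * q ^ (4 ℕ.* r) * (q ^ j * q ^ (2 ℕ.* i))
      ≡⟨ trans (K.*-assoc q _ _) (cong (λ y → q * (q ^ (4 ℕ.* r) * y)) (sym (^-+ q j _))) ⟩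
    q * (q ^ (4 ℕ.* r) * q ^ (j ℕ.+ 2 ℕ.* i))
      ≡⟨ cong (q *_) (^-+ q (4 ℕ.* r) _) ⟨
    q ^ suc (4 ℕ.* r ℕ.+ (j ℕ.+ 2 ℕ.* i)) ∎

  1-node≢0 : ∀ r i j → 1# - q * (q ^ r) ^ 4 * (q ^ j * (q ^ i) ^ 2) ≢ 0#
  1-node≢0 r i j = 1-[]≢0 (4 ℕ.* r ℕ.+ (j ℕ.+ 2 ℕ.* i)) (node r i j)

  M≢0 : ∀ r i → M (q * (q ^ r) ^ 4) (q ^ i) ≢ 0#
  M≢0 r i = *-nonzero (μ≢0 i) (1-node≢0 r i 2)

  P-suc : ∀ r i → let c = q * (q ^ r) ^ 4 in P c (suc i) * M c (q ^ i) ≡ P c i * N c (q ^ i)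
  P-suc r i = trans (K.*-assoc _ _ _) (cong (P (q * (q ^ r) ^ 4) i *_) (/-* (M≢0 r i)))

  L≢0 : ∀ i → L ((q ^ i) ^ 4) ≢ 0#
  L≢0 i = *-nonzero (1-aq≢0 i) (a-q≢0 i)

  -- The step from r to r + 1 is a Wilf–Zeilberger pair; the certificate is cleared of denominators, so that it
  -- is expressed by the terms for r + 1 alone.
  module Step (r : ℕ) where
    w = q ^ r
    W = w ^ 4
    c = q * W
    c′ = q * (q ^ suc r) ^ 4

    -- Passing from `c` to `c′ = q⁴ c` shifts the numerators `c - q ^ (4 i + 1)` by one index and
    -- the denominators `1 - c q ^ (2 i + 2)` by two. In the quotient of the two products only
    -- factors at the ends survive.
    link : ∀ k → let z = q ^ k in
      P c′ (suc k) * (μ z * (1# - c * (q ^ 2 * z ^ 2)) * (1# - c * (q ^ 4 * z ^ 2)) * (1# - c * (q ^ 6 * z ^ 2)))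
      ≡ P c k * (ν z * (c′ - q) * z ^ 4 * (1# - c * (q ^ 2 * 1# ^ 2)) * (1# - c * (q ^ 4 * 1# ^ 2)))
    link zero = begin
      P c′ 1 * (μ 1# * x * y * (1# - c * (q ^ 6 * 1# ^ 2)))
        ≡⟨ cong (λ t → P c′ 1 * (μ 1# * x * y * (1# - t)))
             (solve 2 (λ q w → q :* w :^ 4 :* (q :^ 6 :* :1 :^ 2) := q :* (q :* w) :^ 4 :* (q :^ 2 :* :1 :^ 2)) refl q w) ⟩
      P c′ 1 * (μ 1# * x * y * (1# - c′ * (q ^ 2 * 1# ^ 2)))
        ≡⟨ solve 5 (λ p m x y u → p :* (m :* x :* y :* u) := p :* (m :* u) :* (x :* y)) refl _ (μ 1#) x y _ ⟩
      P c′ 1 * M c′ 1# * (x * y)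
        ≡⟨ cong (_* (x * y)) (P-suc (suc r) 0) ⟩
      1# * (ν 1# * (c′ - q * 1# ^ 4)) * (x * y)
        ≡⟨ solve 5 (λ n c q x y → :1 :* (n :* (c :- q :* :1 :^ 4)) :* (x :* y) := :1 :* (n :* (c :- q) :* :1 :^ 4 :* x :* y)) refl (ν 1#) c′ q x y ⟩
      1# * (ν 1# * (c′ - q) * 1# ^ 4 * x * y) ∎
      where
      x = 1# - c * (q ^ 2 * 1# ^ 2)
      y = 1# - c * (q ^ 4 * 1# ^ 2)
    link (suc k) = *-cancel (M≢0 r k) (begin
      M c z * (p₂ * (μ z⁺ * ℓ⁺ 2 * ℓ⁺ 4 * ℓ⁺ 6))
        ≡⟨ cong (λ t → M c z * (p₂ * t)) (cong₂ _*_ (cong₂ _*_ (cong (μ z⁺ *_) (ℓ-suc 2)) (ℓ-suc 4)) (ℓ-suc 6)) ⟩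
      M c z * (p₂ * (μ z⁺ * ℓ 4 * ℓ 6 * ℓ 8))
        ≡⟨ solve 6 (λ m p u x y z → m :* (p :* (u :* x :* y :* z)) := m :* (x :* y) :* (p :* (u :* z))) refl (M c z) p₂ (μ z⁺) (ℓ 4) (ℓ 6) (ℓ 8) ⟩
      M c z * (ℓ 4 * ℓ 6) * (p₂ * (μ z⁺ * ℓ 8))
        ≡⟨ cong (λ t → M c z * (ℓ 4 * ℓ 6) * (p₂ * (μ z⁺ * t))) ℓ-8 ⟩
      M c z * (ℓ 4 * ℓ 6) * (p₂ * M c′ z⁺)
        ≡⟨ cong (M c z * (ℓ 4 * ℓ 6) *_) (P-suc (suc r) (suc k)) ⟩
      M c z * (ℓ 4 * ℓ 6) * (p₁ * N c′ z⁺)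
        ≡⟨ cong (λ t → M c z * (ℓ 4 * ℓ 6) * (p₁ * (ν z⁺ * t))) c′-shift ⟩
      M c z * (ℓ 4 * ℓ 6) * (p₁ * (ν z⁺ * (q ^ 4 * d)))
        ≡⟨ solve 7 (λ m a₂ x y p n d → m :* a₂ :* (x :* y) :* (p :* (n :* d)) := p :* (m :* a₂ :* x :* y) :* (n :* d))
             refl (μ z) (ℓ 2) (ℓ 4) (ℓ 6) p₁ (ν z⁺) (q ^ 4 * d) ⟩
      p₁ * (μ z * ℓ 2 * ℓ 4 * ℓ 6) * (ν z⁺ * (q ^ 4 * d))
        ≡⟨ cong (_* (ν z⁺ * (q ^ 4 * d))) (link k) ⟩
      P c k * (ν z * e * z ^ 4 * X * Y) * (ν z⁺ * (q ^ 4 * d))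
        ≡⟨ solve 9 (λ p n e z x y n⁺ q d → p :* (n :* e :* z :^ 4 :* x :* y) :* (n⁺ :* (q :^ 4 :* d)) := p :* (n :* d) :* (n⁺ :* e :* (q :* z) :^ 4 :* x :* y))
             refl (P c k) (ν z) e z X Y (ν z⁺) q d ⟩
      P c k * (ν z * d) * (ν z⁺ * e * z⁺ ^ 4 * X * Y)
        ≡⟨ cong (_* (ν z⁺ * e * z⁺ ^ 4 * X * Y)) (P-suc r k) ⟨
      P c (suc k) * M c z * (ν z⁺ * e * z⁺ ^ 4 * X * Y)
        ≡⟨ solve 3 (λ p m x → p :* m :* x := m :* (p :* x)) refl (P c (suc k)) (M c z) _ ⟩
      M c z * (P c (suc k) * (ν z⁺ * e * z⁺ ^ 4 * X * Y)) ∎)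
      where
      z = q ^ k
      z⁺ = q * z
      ℓ ℓ⁺ : ℕ → K
      ℓ j = 1# - c * (q ^ j * z ^ 2)
      ℓ⁺ j = 1# - c * (q ^ j * z⁺ ^ 2)
      p₂ = P c′ (2 ℕ.+ k)
      p₁ = P c′ (1 ℕ.+ k)
      d = c - q * z ^ 4
      e = c′ - q
      X = 1# - c * (q ^ 2 * 1# ^ 2)
      Y = 1# - c * (q ^ 4 * 1# ^ 2)
      ℓ-suc : ∀ j → ℓ⁺ j ≡ ℓ (2 ℕ.+ j)
      ℓ-suc j = solve 4 (λ c q x z → :1 :- c :* (x :* (q :* z) :^ 2) := :1 :- c :* (q :* (q :* x) :* z :^ 2)) refl c q (q ^ j) z
      ℓ-8 : ℓ 8 ≡ 1# - c′ * (q ^ 2 * z⁺ ^ 2)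
      ℓ-8 = solve 3 (λ q w z → :1 :- q :* w :^ 4 :* (q :^ 8 :* z :^ 2) := :1 :- q :* (q :* w) :^ 4 :* (q :^ 2 :* (q :* z) :^ 2)) refl q w z
      c′-shift : c′ - q * z⁺ ^ 4 ≡ q ^ 4 * d
      c′-shift = solve 3 (λ q w z → q :* (q :* w) :^ 4 :- q :* (q :* z) :^ 4 := q :^ 4 :* (q :* w :^ 4 :- q :* z :^ 4)) refl q w z

    -- `Λ W` equals `a (1 - c q²)(1 - c q⁴)`, which contains precisely the two factors that `link`
    -- leaves at the lower end. So the terms for `c` become multiples of those for `c′`.
    Λ-P : ∀ k → let z = q ^ k in
      Λ W * (P c (suc k) * ((c′ - q) * z ^ 4))
      ≡ a * (c - q * z ^ 4) * (1# - c * (q ^ 4 * z ^ 2)) * (1# - c * (q ^ 6 * z ^ 2)) * P c′ (suc k)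
    Λ-P k = *-cancel (M≢0 r k) (begin
      M c z * (Λ W * (P c (suc k) * (e * z ^ 4)))
        ≡⟨ solve 4 (λ m l p x → m :* (l :* (p :* x)) := p :* m :* (l :* x)) refl (M c z) (Λ W) (P c (suc k)) (e * z ^ 4) ⟩
      P c (suc k) * M c z * (Λ W * (e * z ^ 4))
        ≡⟨ cong (_* (Λ W * (e * z ^ 4))) (P-suc r k) ⟩
      P c k * (ν z * d) * (Λ W * (e * z ^ 4))
        ≡⟨ solve 8 (λ p n d q W a e z →
             p :* (n :* d) :* ((:1 :- q :^ 3 :* W) :* (:1 :- q :^ 5 :* W) :* a :* (e :* z :^ 4))
             := p :* (n :* e :* z :^ 4 :* (:1 :- q :* W :* (q :^ 2 :* :1 :^ 2)) :* (:1 :- q :* W :* (q :^ 4 :* :1 :^ 2))) :* (a :* d))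
             refl (P c k) (ν z) d q W a e z ⟩
      P c k * (ν z * e * z ^ 4 * X * Y) * (a * d)
        ≡⟨ cong (_* (a * d)) (link k) ⟨
      P c′ (suc k) * (μ z * ℓ 2 * ℓ 4 * ℓ 6) * (a * d)
        ≡⟨ solve 7 (λ p m x y z a d → p :* (m :* x :* y :* z) :* (a :* d) := m :* x :* (a :* d :* y :* z :* p))
             refl (P c′ (suc k)) (μ z) (ℓ 2) (ℓ 4) (ℓ 6) a d ⟩
      M c z * (a * d * ℓ 4 * ℓ 6 * P c′ (suc k)) ∎)
      where
      z = q ^ k
      ℓ : ℕ → K
      ℓ j = 1# - c * (q ^ j * z ^ 2)
      d = c - q * z ^ 4
      e = c′ - q
      X = 1# - c * (q ^ 2 * 1# ^ 2)
      Y = 1# - c * (q ^ 4 * 1# ^ 2)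

    -- The Wilf-Zeilberger equation summed up to `k`: the right-hand side is the companion term,
    -- with the denominator `(c′ - q) z ^ 4` moved to the left. Its factor `P c′ (suc k)` makes it
    -- vanish once the series for `c′` has terminated.
    telescoped : ∀ k → let z = q ^ k in
      (c′ - q) * z ^ 4 * (L W * S c′ (suc k) - Λ W * S c (suc k))
      ≡ c * (μ z * (1# - c * (q ^ 6 * z ^ 2)) * P c′ (suc k))
    telescoped zero = begin
      (c′ - q) * 1# ^ 4 * (L W * (0# + g 1# * 1#) - Λ W * (0# + g 1# * 1#))
        ≡⟨ solve 3 (λ q w a → let W = w :^ 4 in
             (q :* (q :* w) :^ 4 :- q) :* :1 :^ 4 :* (
               (:1 :- a :* (q :^ 4 :* W)) :* (a :- q :^ 4 :* W) :* (:0 :+ (:1 :- q :* :1 :^ 6) :* :1)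
               :- (:1 :- q :^ 3 :* W) :* (:1 :- q :^ 5 :* W) :* a :* (:0 :+ (:1 :- q :* :1 :^ 6) :* :1))
             := q :* W :* (:1 :* ((:1 :- q :* :1 :^ 2) :* (:1 :- a :* (q :* :1 :^ 2)) :* (a :- q :* :1 :^ 2) :* (q :^ 2 :* :1 :^ 2)
                  :* (q :* (q :* w) :^ 4 :- q :* :1 :^ 4))))
             refl q w a ⟩
      c * (1# * N c′ 1#)
        ≡⟨ cong (c *_) (P-suc (suc r) 0) ⟨
      c * (P c′ 1 * (μ 1# * (1# - c′ * (q ^ 2 * 1# ^ 2))))
        ≡⟨ cong (c *_) (K.*-comm (P c′ 1) _) ⟩
      c * (μ 1# * (1# - c′ * (q ^ 2 * 1# ^ 2)) * P c′ 1)
        ≡⟨ cong (λ t → c * (μ 1# * (1# - t) * P c′ 1))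
             (solve 2 (λ q w → q :* (q :* w) :^ 4 :* (q :^ 2 :* :1 :^ 2) := q :* w :^ 4 :* (q :^ 6 :* :1 :^ 2)) refl q w) ⟩
      c * (μ 1# * (1# - c * (q ^ 6 * 1# ^ 2)) * P c′ 1) ∎
    telescoped (suc k) = begin
      e * z⁺ ^ 4 * (L W * (s′ + g z⁺ * p₁) - Λ W * (s + g z⁺ * P c (suc k)))
        ≡⟨ solve 10 (λ e q z l s′ g p λ′ s p₀ →
             e :* (q :* z) :^ 4 :* (l :* (s′ :+ g :* p) :- λ′ :* (s :+ g :* p₀))
             := q :^ 4 :* (e :* z :^ 4 :* (l :* s′ :- λ′ :* s)) :+ e :* (q :* z) :^ 4 :* l :* g :* p :- q :^ 4 :* g :* (λ′ :* (p₀ :* (e :* z :^ 4))))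
             refl e q z (L W) s′ (g z⁺) p₁ (Λ W) s (P c (suc k)) ⟩
      q ^ 4 * (e * z ^ 4 * (L W * s′ - Λ W * s)) + e * z⁺ ^ 4 * L W * g z⁺ * p₁ - q ^ 4 * g z⁺ * (Λ W * (P c (suc k) * (e * z ^ 4)))
        ≡⟨ cong₂ (λ x y → q ^ 4 * x + e * z⁺ ^ 4 * L W * g z⁺ * p₁ - q ^ 4 * g z⁺ * y) (telescoped k) (Λ-P k) ⟩
      q ^ 4 * (c * (μ z * ℓ 6 * p₁)) + e * z⁺ ^ 4 * L W * g z⁺ * p₁ - q ^ 4 * g z⁺ * (a * d * ℓ 4 * ℓ 6 * p₁)
        -- After the common factor `p₁` is taken out, the Wilf-Zeilberger equation is this
        -- polynomial identity.
        ≡⟨ solve 5 (λ q a z w p → let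
               W = w :^ 4; c = q :* W; z⁺ = q :* z
               c′ = q :* (q :* w) :^ 4
               g = :1 :- q :* z⁺ :^ 6
               d = c :- q :* z :^ 4
               ℓ = λ j → :1 :- c :* (q :^ j :* z :^ 2)
               e = c′ :- q
               μ = (:1 :- q :^ 4 :* z :^ 4) :* (a :- q :^ 4 :* z :^ 4) :* (:1 :- a :* (q :^ 4 :* z :^ 4))
               ν⁺ = (:1 :- q :* z⁺ :^ 2) :* (:1 :- a :* (q :* z⁺ :^ 2)) :* (a :- q :* z⁺ :^ 2) :* (q :^ 2 :* z⁺ :^ 2)
               L = (:1 :- a :* (q :^ 4 :* W)) :* (a :- q :^ 4 :* W)
             in q :^ 4 :* (c :* (μ :* ℓ 6 :* p)) :+ e :* z⁺ :^ 4 :* L :* g :* p :- q :^ 4 :* g :* (a :* d :* ℓ 4 :* ℓ 6 :* p)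
                := c :* (p :* (ν⁺ :* (c′ :- q :* z⁺ :^ 4)))) refl q a z w p₁ ⟩
      c * (p₁ * N c′ z⁺)
        ≡⟨ cong (c *_) (P-suc (suc r) (suc k)) ⟨
      c * (p₂ * (μ z⁺ * (1# - c′ * (q ^ 2 * z⁺ ^ 2))))
        ≡⟨ cong (c *_) (K.*-comm p₂ _) ⟩
      c * (μ z⁺ * (1# - c′ * (q ^ 2 * z⁺ ^ 2)) * p₂)
        ≡⟨ cong (λ t → c * (μ z⁺ * (1# - t) * p₂))
             (solve 3 (λ q w z → q :* (q :* w) :^ 4 :* (q :^ 2 :* (q :* z) :^ 2) := q :* w :^ 4 :* (q :^ 6 :* (q :* z) :^ 2)) refl q w z) ⟩
      c * (μ z⁺ * (1# - c * (q ^ 6 * z⁺ ^ 2)) * p₂) ∎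
      where
      z = q ^ k
      z⁺ = q * z
      ℓ : ℕ → K
      ℓ j = 1# - c * (q ^ j * z ^ 2)
      p₂ = P c′ (2 ℕ.+ k)
      p₁ = P c′ (1 ℕ.+ k)
      s = S c (suc k)
      s′ = S c′ (suc k)
      d = c - q * z ^ 4
      e = c′ - q

    contiguous : ∀ k → suc r ℕ.< k → L W * S c′ k ≡ Λ W * S c k
    contiguous (suc k) r<k = x-y≡0⇒x≡y (*-cancel-0 (*-nonzero c′-q≢0 (^-nonzero (^-nonzero q≢0 k) 4)) (begin
      (c′ - q) * (q ^ k) ^ 4 * (L W * S c′ (suc k) - Λ W * S c (suc k))
        ≡⟨ telescoped k ⟩
      c * (μ (q ^ k) * (1# - c * (q ^ 6 * (q ^ k) ^ 2)) * P c′ (suc k))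
        ≡⟨ cong (λ t → c * (μ (q ^ k) * (1# - c * (q ^ 6 * (q ^ k) ^ 2)) * t)) P≡0 ⟩
      c * (μ (q ^ k) * (1# - c * (q ^ 6 * (q ^ k) ^ 2)) * 0#)
        ≡⟨ solve 2 (λ x y → x :* (y :* :0) := :0) refl c _ ⟩
      0# ∎))
      where
      -- `c′` is the node of index `r + 1`, so the numerator of that index is `c′ - c′`; the
      -- hypothesis `suc r < k` puts it inside the product.
      P≡0 : P c′ (suc k) ≡ 0#
      P≡0 = ∏-zero {i = suc r} r<k (solve 3 (λ x c i → x :* (c :- c) :* i := :0) refl (ν (q ^ suc r)) c′ (inv (M c′ (q ^ suc r))))
      c′-q≢0 : c′ - q ≢ 0#
      c′-q≢0 h = *-nonzero q≢0 (1-[]≢0 (r ℕ.+ 3 ℕ.* suc r) (sym (^-* q 4 (suc r)))) (begin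
        q * (1# - (q ^ suc r) ^ 4)      ≡⟨ solve 2 (λ q x → q :* (:1 :- x) := :- (q :* x :- q)) refl q ((q ^ suc r) ^ 4) ⟩
        - (c′ - q)                      ≡⟨ cong (λ t → - t) h ⟩
        - 0#                            ≡⟨ solve 0 (:- :0 := :0) refl ⟩
        0#                              ∎)

  evaluation : ∀ r n → r ℕ.< n → S (q * (q ^ r) ^ 4) n ≡ (1# - q) * R r
  evaluation zero n 0<n = begin
    S c n                  ≡⟨ ∑-single n 0 0<n vanish ⟩
    g 1# * 1#              ≡⟨ solve 1 (λ q → (:1 :- q :* :1 :^ 6) :* :1 := (:1 :- q) :* :1) refl q ⟩
    (1# - q) * 1#          ∎
    where
    c = q * 1# ^ 4
    vanish : ∀ i → i ℕ.< n → i ≢ 0 → g (q ^ i) * P c i ≡ 0#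
    vanish zero    _ i≢0 = contradiction refl i≢0
    vanish (suc i) _ _   = trans (cong (g (q ^ suc i) *_)
      (∏-zero {n = suc i} z<s (solve 3 (λ x c i → x :* (c :- c) :* i := :0) refl (ν 1#) c (inv (M c 1#))))) (K.zeroʳ _)
  evaluation (suc r) n r<n = *-cancel (L≢0 r) (begin
    L W * S c′ n                          ≡⟨ contiguous n r<n ⟩
    Λ W * S c n                           ≡⟨ cong (Λ W *_) (evaluation r n (ℕ.<-trans (ℕ.n<1+n r) r<n)) ⟩
    Λ W * ((1# - q) * R r)                ≡⟨ cong (_* ((1# - q) * R r)) (/-* (L≢0 r)) ⟨
    Λ W / L W * L W * ((1# - q) * R r)    ≡⟨ solve 4 (λ x l q r → x :* l :* ((:1 :- q) :* r) := l :* ((:1 :- q) :* (r :* x))) refl (Λ W / L W) (L W) q (R r) ⟩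
    L W * ((1# - q) * R (suc r))          ∎)
    where open Step r

-- Interpolation

-- Polynomial functions of degree at most d, in Horner form.
Deg : ℕ → (K → K) → Set
Deg zero    f = ∀ x → f x ≡ f 0#
Deg (suc d) f = Σ (K → K) λ g → Deg d g × (∀ x → f x ≡ f 0# + x * g x)

Deg-resp : ∀ d {f g} → (∀ x → f x ≡ g x) → Deg d f → Deg d g
Deg-resp zero    f≗g h           = λ x → trans (sym (f≗g x)) (trans (h x) (f≗g 0#))
Deg-resp (suc d) f≗g (h , D , e) = h , D , λ x → trans (sym (f≗g x)) (trans (e x) (cong (_+ x * h x) (f≗g 0#)))

Deg-const : ∀ d x → Deg d (λ _ → x)
Deg-const zero    x = λ _ → refl
Deg-const (suc d) x = (λ _ → 0#) , Deg-const d 0# , λ y → solve 2 (λ x y → x := x :+ y :* :0) refl x y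

Deg-suc : ∀ d {f} → Deg d f → Deg (suc d) f
Deg-suc zero    {f} h           = (λ _ → 0#) , (λ _ → refl) , λ x → trans (h x) (solve 2 (λ f x → f := f :+ x :* :0) refl (f 0#) x)
Deg-suc (suc d)     (g , D , e) = g , Deg-suc d D , e

Deg-mono : ∀ {m n f} → m ℕ.≤ n → Deg m f → Deg n f
Deg-mono {m} {n} {f} m≤n D = subst (λ k → Deg k f) (ℕ.m∸n+n≡m m≤n) (go (n ℕ.∸ m))
  where
  go : ∀ k → Deg (k ℕ.+ m) f
  go zero    = D
  go (suc k) = Deg-suc (k ℕ.+ m) (go k)

Deg-+ : ∀ d {f g} → Deg d f → Deg d g → Deg d (λ x → f x + g x)
Deg-+ zero    hf hg = λ x → cong₂ _+_ (hf x) (hg x)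
Deg-+ (suc d) {f} {g} (f′ , Df , ef) (g′ , Dg , eg) = (λ x → f′ x + g′ x) , Deg-+ d Df Dg , λ x →
  trans (cong₂ _+_ (ef x) (eg x))
    (solve 5 (λ a b x c d → a :+ x :* c :+ (b :+ x :* d) := a :+ b :+ x :* (c :+ d)) refl (f 0#) (g 0#) x (f′ x) (g′ x))

Deg-scale : ∀ d {f} y → Deg d f → Deg d (λ x → y * f x)
Deg-scale zero        y h           = λ x → cong (y *_) (h x)
Deg-scale (suc d) {f} y (g , D , e) = (λ x → y * g x) , Deg-scale d y D , λ x →
  trans (cong (y *_) (e x)) (solve 4 (λ y f x g → y :* (f :+ x :* g) := y :* f :+ x :* (y :* g)) refl y (f 0#) x (g x))

Deg-neg : ∀ d {f} → Deg d f → Deg d (λ x → - f x)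
Deg-neg d {f} D = Deg-resp d (λ x → solve 1 (λ f → (:- :1) :* f := :- f) refl (f x)) (Deg-scale d (- 1#) D)

Deg-shift : ∀ d {f} → Deg d f → Deg (suc d) (λ x → x * f x)
Deg-shift d {f} D = f , D , λ x → solve 3 (λ f₀ x f → x :* f := :0 :* f₀ :+ x :* f) refl (f 0#) x (f x)

Deg-id : Deg 1 (λ x → x)
Deg-id = Deg-resp 1 K.*-identityʳ (Deg-shift 0 (Deg-const 0 1#))

Deg-* : ∀ m n {f g} → Deg m f → Deg n g → Deg (m ℕ.+ n) (λ x → f x * g x)
Deg-* zero    n {f} {g} hf          Dg = Deg-resp n (λ x → cong (_* g x) (sym (hf x))) (Deg-scale n (f 0#) Dg)
Deg-* (suc m) n {f} {g} (h , D , e) Dg = Deg-resp (suc m ℕ.+ n)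
  (λ x → trans (solve 4 (λ f x h g → f :* g :+ x :* (h :* g) := (f :+ x :* h) :* g) refl (f 0#) x (h x) (g x)) (cong (_* g x) (sym (e x))))
  (Deg-+ (suc m ℕ.+ n) (Deg-mono (ℕ.m≤n+m n (suc m)) (Deg-scale n (f 0#) Dg)) (Deg-shift (m ℕ.+ n) (Deg-* m n D Dg)))

Deg-linear : ∀ y z → Deg 1 (λ x → y - x * z)
Deg-linear y z = Deg-+ 1 (Deg-const 1 y) (Deg-neg 1 (Deg-resp 1 (λ x → K.*-comm z x) (Deg-scale 1 z Deg-id)))

Deg-∏ : ∀ n {f : ℕ → K → K} → (∀ i → Deg 1 (f i)) → Deg n (λ x → ∏ n (λ i → f i x))
Deg-∏ zero    D = Deg-const 0 1#
Deg-∏ (suc n) D = Deg-resp (suc n) (λ x → K.*-comm _ _) (Deg-* 1 n (D n) (Deg-∏ n D))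

Deg-∑ : ∀ d n {f : ℕ → K → K} → (∀ i → i ℕ.< n → Deg d (f i)) → Deg d (λ x → ∑ n (λ i → f i x))
Deg-∑ d zero    D = Deg-const d 0#
Deg-∑ d (suc n) D = Deg-+ d (Deg-∑ d n (λ i i<n → D i (ℕ.m<n⇒m<1+n i<n))) (D n ℕ.≤-refl)

-- Exact division by `x - r`, which turns the counting of roots into an induction on the degree.
difference-quotient : ∀ d {f} → Deg (suc d) f → ∀ r → Σ (K → K) λ h → Deg d h × (∀ x → f x - f r ≡ (x - r) * h x)
difference-quotient zero {f} (g , D , e) r = g , D , λ x → begin
  f x - f r                                   ≡⟨ cong₂ _-_ (e x) (e r) ⟩
  f 0# + x * g x - (f 0# + r * g r)           ≡⟨ cong (λ t → f 0# + x * g x - (f 0# + r * t)) (trans (D r) (sym (D x))) ⟩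
  f 0# + x * g x - (f 0# + r * g x)           ≡⟨ solve 4 (λ f x g r → f :+ x :* g :- (f :+ r :* g) := (x :- r) :* g) refl (f 0#) x (g x) r ⟩
  (x - r) * g x                               ∎
difference-quotient (suc d) {f} (g , D , e) r with difference-quotient d D r
... | h , Dh , eh = (λ x → g x + r * h x) , Deg-+ (suc d) D (Deg-suc d (Deg-scale d r Dh)) , λ x → begin
  f x - f r                                   ≡⟨ cong₂ _-_ (e x) (e r) ⟩
  f 0# + x * g x - (f 0# + r * g r)           ≡⟨ solve 5 (λ f x gx r gr → f :+ x :* gx :- (f :+ r :* gr) := (x :- r) :* gx :+ r :* (gx :- gr)) refl (f 0#) x (g x) r (g r) ⟩
  (x - r) * g x + r * (g x - g r)             ≡⟨ cong (λ t → (x - r) * g x + r * t) (eh x) ⟩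
  (x - r) * g x + r * ((x - r) * h x)         ≡⟨ solve 4 (λ x r g h → (x :- r) :* g :+ r :* ((x :- r) :* h) := (x :- r) :* (g :+ r :* h)) refl x r (g x) (h x) ⟩
  (x - r) * (g x + r * h x)                   ∎

Distinct : (ℕ → K) → Set
Distinct c = ∀ {i j} → i ℕ.< j → c j - c i ≢ 0#

zero-polynomial : ∀ d {f} → Deg d f → ∀ {c} → Distinct c → (∀ i → i ℕ.≤ d → f (c i) ≡ 0#) → ∀ x → f x ≡ 0#
zero-polynomial zero    D {c} c≢ h x = trans (D x) (trans (sym (D (c 0))) (h 0 z≤n))
zero-polynomial (suc d) {f} D {c} c≢ h x with difference-quotient d D (c 0)
... | k , Dk , e = begin
  f x                ≡⟨ solve 2 (λ f g → f := f :- g :+ g) refl (f x) (f (c 0)) ⟩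
  f x - f (c 0) + f (c 0)    ≡⟨ cong₂ _+_ (e x) (h 0 z≤n) ⟩
  (x - c 0) * k x + 0#       ≡⟨ cong (λ t → (x - c 0) * t + 0#) (zero-polynomial d Dk (c≢ ∘ s<s) roots x) ⟩
  (x - c 0) * 0# + 0#        ≡⟨ solve 1 (λ x → x :* :0 :+ :0 := :0) refl (x - c 0) ⟩
  0#                         ∎
  where
  roots : ∀ i → i ℕ.≤ d → k (c (suc i)) ≡ 0#
  roots i i≤d = *-cancel-0 (c≢ {0} {suc i} z<s) (begin
    (c (suc i) - c 0) * k (c (suc i))    ≡⟨ e (c (suc i)) ⟨
    f (c (suc i)) - f (c 0)              ≡⟨ cong₂ _-_ (h (suc i) (s≤s i≤d)) (h 0 z≤n) ⟩
    0# - 0#                              ≡⟨ K.-‿inverseʳ 0# ⟩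
    0#                                   ∎)

-- The indices run over 0, …, n.
∏-except : ℕ → ℕ → (ℕ → K) → K
∏-except n j f = ∏ j f * ∏ (n ℕ.∸ j) (λ i → f (suc j ℕ.+ i))

∏-except-zero : ∀ {n i j} f → i ℕ.≤ n → i ≢ j → f i ≡ 0# → ∏-except n j f ≡ 0#
∏-except-zero {n} {i} {j} f i≤n i≢j h with ℕ.<-cmp i j
... | tri< i<j _ _ = trans (cong (_* ∏ (n ℕ.∸ j) (λ k → f (suc j ℕ.+ k))) (∏-zero i<j h)) (K.zeroˡ _)
... | tri≈ _ i≡j _ = contradiction i≡j i≢j
... | tri> _ _ j<i = trans (cong (∏ j f *_) (∏-zero {i = i ℕ.∸ suc j} lt (trans (cong f (ℕ.m+[n∸m]≡n j<i)) h))) (K.zeroʳ _)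
  where
  lt : i ℕ.∸ suc j ℕ.< n ℕ.∸ j
  lt = subst (ℕ._≤ n ℕ.∸ j) (ℕ.+-∸-assoc 1 j<i) (ℕ.∸-monoˡ-≤ j i≤n)

∏-except-nonzero : ∀ n j {c} → Distinct c → ∏-except n j (λ i → c j - c i) ≢ 0#
∏-except-nonzero n j {c} c≢ = *-nonzero (go j ℕ.≤-refl)
  (∏-nonzero (n ℕ.∸ j) (λ i h → c≢ (s≤s (ℕ.m≤m+n j i)) (begin
    c (suc j ℕ.+ i) - c j       ≡⟨ solve 2 (λ x y → x :- y := :- (y :- x)) refl (c (suc j ℕ.+ i)) (c j) ⟩
    - (c j - c (suc j ℕ.+ i))   ≡⟨ cong (λ t → - t) h ⟩
    - 0#                        ≡⟨ solve 0 (:- :0 := :0) refl ⟩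
    0#                          ∎)))
  where
  go : ∀ k → k ℕ.≤ j → ∏ k (λ i → c j - c i) ≢ 0#
  go zero    _   = 1≢0
  go (suc k) k<j = *-nonzero (go k (ℕ.<⇒≤ k<j)) (c≢ k<j)

Deg-∏-except : ∀ n j (c : ℕ → K) → j ℕ.≤ n → Deg n (λ x → ∏-except n j (λ i → x - c i))
Deg-∏-except n j c j≤n = subst (λ m → Deg m (λ x → ∏-except n j (λ i → x - c i))) (ℕ.m+[n∸m]≡n j≤n)
  (Deg-* j (n ℕ.∸ j) (Deg-∏ j (λ i → linear (c i))) (Deg-∏ (n ℕ.∸ j) (λ i → linear (c (suc j ℕ.+ i)))))
  where
  linear : ∀ y → Deg 1 (λ x → x - y)
  linear y = Deg-+ 1 Deg-id (Deg-const 1 (- y))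

lagrange : ∀ n {f c} → Deg n f → Distinct c → ∀ x →
  f x ≡ ∑ (suc n) (λ j → f (c j) / ∏-except n j (λ i → c j - c i) * ∏-except n j (λ i → x - c i))
lagrange n {f} {c} D c≢ x = x-y≡0⇒x≡y (zero-polynomial n
  (Deg-+ n D (Deg-neg n (Deg-∑ n (suc n) (λ j j<n → Deg-scale n (weight j) (Deg-∏-except n j c (ℕ.s≤s⁻¹ j<n))))))
  c≢ (λ i i≤n → x≡y⇒x-y≡0 (sym (interpolates i i≤n))) x)
  where
  weight : ℕ → K
  weight j = f (c j) / ∏-except n j (λ i → c j - c i)
  interpolates : ∀ i → i ℕ.≤ n → ∑ (suc n) (λ j → weight j * ∏-except n j (λ k → c i - c k)) ≡ f (c i)
  interpolates i i≤n = trans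
    (∑-single (suc n) i (s≤s i≤n) (λ j _ j≢i → trans
      (cong (weight j *_) (∏-except-zero (λ k → c i - c k) i≤n (j≢i ∘ sym) (K.-‿inverseʳ (c i)))) (K.zeroʳ (weight j))))
    (/-* (∏-except-nonzero n i c≢))

*-nonzeroˡ : ∀ {x y} → x * y ≢ 0# → x ≢ 0#
*-nonzeroˡ {x} {y} xy≢0 refl = xy≢0 (K.zeroˡ y)

*-nonzeroʳ : ∀ {x y} → x * y ≢ 0# → y ≢ 0#
*-nonzeroʳ {x} {y} xy≢0 refl = xy≢0 (K.zeroʳ x)

∏-shift : ∀ n f → f 0 * ∏ n (f ∘ suc) ≡ ∏ n f * f n
∏-shift n f = sym (∏-head n f)

-- The series as a polynomial in c

module Interpolated {q a : K} (gen : Generic q a) where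
  open Generic gen
  open Series q a
  open Terminating gen

  c_ : ℕ → K
  c_ j = q * (q ^ j) ^ 4

  c-distinct : Distinct c_
  c-distinct {i} {j} i<j h = 1-[]≢0 (k ℕ.+ 3 ℕ.* suc k) (sym (^-* q 4 (suc k)))
    (*-cancel-0 (*-nonzero q≢0 (^-nonzero (^-nonzero q≢0 i) 4)) (begin
      q * (q ^ i) ^ 4 * (1# - (q ^ suc k) ^ 4)     ≡⟨ solve 3 (λ q x y → q :* x :^ 4 :* (:1 :- y :^ 4) := :- (q :* (x :* y) :^ 4 :- q :* x :^ 4)) refl q (q ^ i) (q ^ suc k) ⟩
      - (q * (q ^ i * q ^ suc k) ^ 4 - c_ i)       ≡⟨ cong (λ t → - (q * t ^ 4 - c_ i)) (trans (sym (^-+ q i (suc k))) (cong (q ^_) (trans (ℕ.+-suc i k) (ℕ.m+[n∸m]≡n i<j)))) ⟩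
      - (c_ j - c_ i)                              ≡⟨ cong (λ t → - t) h ⟩
      - 0#                                         ≡⟨ solve 0 (:- :0 := :0) refl ⟩
      0#                                           ∎))
    where k = j ℕ.∸ suc i

  -- (cq²;q²)ₙ. It clears the c-dependent denominators of `S c (suc n)`, whose last term is `P c n`
  -- with `n` factors.
  E : ℕ → K → K
  E n c = ∏ n (λ i → 1# - c * (q ^ 2 * (q ^ i) ^ 2))

  -- The numerator of `S c (suc n)` over `E n c`, given by a recursion that never divides by
  -- anything involving `c`, so that it is a polynomial function at every `c`.
  T : ℕ → K → K
  T zero    c = g 1#
  T (suc n) c = T n c * (1# - c * (q ^ 2 * (q ^ n) ^ 2))
              + g (q ^ suc n) * ∏ (suc n) (λ i → ν (q ^ i) / μ (q ^ i)) * ∏ (suc n) (λ i → c - q * (q ^ i) ^ 4)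

  Deg-T : ∀ n → Deg n (T n)
  Deg-T zero    = Deg-const 0 (g 1#)
  Deg-T (suc n) = Deg-+ (suc n)
    (Deg-resp (suc n) (λ x → K.*-comm _ _) (Deg-* 1 n (Deg-linear 1# (q ^ 2 * (q ^ n) ^ 2)) (Deg-T n)))
    (Deg-scale (suc n) (g (q ^ suc n) * ∏ (suc n) (λ i → ν (q ^ i) / μ (q ^ i)))
      (Deg-∏ (suc n) (λ i → Deg-+ 1 Deg-id (Deg-const 1 (- (q * (q ^ i) ^ 4))))))

  module _ {c : K} (c≢ : ∀ i → 1# - c * (q ^ 2 * (q ^ i) ^ 2) ≢ 0#) where
    P*E : ∀ n → P c n * E n c ≡ ∏ n (λ i → ν (q ^ i) / μ (q ^ i)) * ∏ n (λ i → c - q * (q ^ i) ^ 4)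
    P*E n = begin
      P c n * E n c
        ≡⟨ ∏-distrib n ⟨
      ∏ n (λ i → N c (q ^ i) / M c (q ^ i) * (1# - c * (q ^ 2 * (q ^ i) ^ 2)))
        ≡⟨ ∏-cong n (λ i → factor i) ⟩
      ∏ n (λ i → ν (q ^ i) / μ (q ^ i) * (c - q * (q ^ i) ^ 4))
        ≡⟨ ∏-distrib n ⟩
      ∏ n (λ i → ν (q ^ i) / μ (q ^ i)) * ∏ n (λ i → c - q * (q ^ i) ^ 4) ∎
      where
      factor : ∀ i → let z = q ^ i in N c z / M c z * (1# - c * (q ^ 2 * z ^ 2)) ≡ ν z / μ z * (c - q * z ^ 4)
      factor i = *-cancel (μ≢0 i) (begin
        μ z * (N c z / M c z * (1# - c * (q ^ 2 * z ^ 2)))    ≡⟨ solve 3 (λ m x y → m :* (x :* y) := x :* (m :* y)) refl (μ z) (N c z / M c z) (1# - c * (q ^ 2 * z ^ 2)) ⟩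
        N c z / M c z * M c z                                ≡⟨ /-* (*-nonzero (μ≢0 i) (c≢ i)) ⟩
        ν z * (c - q * z ^ 4)                                ≡⟨ cong (_* (c - q * z ^ 4)) (/-* (μ≢0 i)) ⟨
        ν z / μ z * μ z * (c - q * z ^ 4)                    ≡⟨ solve 3 (λ m x y → x :* m :* y := m :* (x :* y)) refl (μ z) (ν z / μ z) (c - q * z ^ 4) ⟩
        μ z * (ν z / μ z * (c - q * z ^ 4))                  ∎)
        where z = q ^ i

    S*E : ∀ n → S c (suc n) * E n c ≡ T n c
    S*E zero    = solve 1 (λ x → (:0 :+ x :* :1) :* :1 := x) refl (g 1#)
    S*E (suc n) = begin
      (S c (suc n) + g z * P c (suc n)) * (E n c * e)
        ≡⟨ solve 5 (λ s g p E e → (s :+ g :* p) :* (E :* e) := s :* E :* e :+ g :* (p :* (E :* e))) refl (S c (suc n)) (g z) (P c (suc n)) (E n c) e ⟩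
      S c (suc n) * E n c * e + g z * (P c (suc n) * E (suc n) c)
        ≡⟨ cong₂ (λ x y → x * e + g z * y) (S*E n) (P*E (suc n)) ⟩
      T n c * e + g z * (∏ (suc n) (λ i → ν (q ^ i) / μ (q ^ i)) * ∏ (suc n) (λ i → c - q * (q ^ i) ^ 4))
        ≡⟨ cong (λ x → T n c * e + x) (K.*-assoc _ _ _) ⟨
      T (suc n) c ∎
      where
      z = q ^ suc n
      e = 1# - c * (q ^ 2 * (q ^ n) ^ 2)

  T-node : ∀ n j → j ℕ.≤ n → T n (c_ j) ≡ (1# - q) * R j * E n (c_ j)
  T-node n j j≤n = trans (sym (S*E (λ i → 1-node≢0 j i 2) n)) (cong (_* E n (c_ j)) (evaluation j (suc n) (s≤s j≤n)))

  expansion : ∀ n {c} → (∀ i → 1# - c * (q ^ 2 * (q ^ i) ^ 2) ≢ 0#) →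
    S c (suc n) * E n c ≡ ∑ (suc n) (λ j → (1# - q) * R j * E n (c_ j) / ∏-except n j (λ i → c_ j - c_ i) * ∏-except n j (λ i → c - c_ i))
  expansion n {c} c≢ = begin
    S c (suc n) * E n c    ≡⟨ S*E c≢ n ⟩
    T n c                  ≡⟨ lagrange n (Deg-T n) c-distinct c ⟩
    ∑ (suc n) (λ j → T n (c_ j) / ∏-except n j (λ i → c_ j - c_ i) * ∏-except n j (λ i → c - c_ i))
      ≡⟨ ∑-cong (suc n) (λ j j<n → cong (λ t → t / ∏-except n j (λ i → c_ j - c_ i) * ∏-except n j (λ i → c - c_ i)) (T-node n j (ℕ.s≤s⁻¹ j<n))) ⟩
    ∑ (suc n) (λ j → (1# - q) * R j * E n (c_ j) / ∏-except n j (λ i → c_ j - c_ i) * ∏-except n j (λ i → c - c_ i)) ∎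

  -- The case a = u^{±1}, u = qⁿ with n = 3 + 4 m.
  module Second (m : ℕ) where
    y u : K
    y = q ^ m
    u = q ^ 3 * y ^ 4

    -- c^(m+1) (1/c;q⁴)ₘ₊₁ and (cq²;q⁴)ₘ₊₁: the c-dependent part of the first term of the right-hand
    -- side, where m + 1 = (n + 1)/4.
    𝒩 𝒟 : K → K
    𝒩 c = ∏ (suc m) (λ i → c - (q ^ i) ^ 4)
    𝒟 c = ∏ (suc m) (λ i → 1# - c * (q ^ 2 * (q ^ i) ^ 4))

    private
      𝒞 : K → K
      𝒞 c = ∏ m (λ i → 1# - c * (q ^ 2 * (q ^ (suc m ℕ.+ i)) ^ 4)) * ∏ (suc (2 ℕ.* m)) (λ i → 1# - c * (q ^ 4 * (q ^ i) ^ 4))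

    -- Splitting (cq²;q²) by the parity of the index shows that `𝒟` divides `E`.
    E-even : ∀ k c → E (k ℕ.+ k) c ≡ ∏ k (λ i → 1# - c * (q ^ 2 * (q ^ i) ^ 4)) * ∏ k (λ i → 1# - c * (q ^ 4 * (q ^ i) ^ 4))
    E-even zero    c = sym (K.*-identityˡ 1#)
    E-even (suc k) c = begin
      E (suc k ℕ.+ suc k) c
        ≡⟨ cong (λ n → E (suc n) c) (ℕ.+-suc k k) ⟩
      E (k ℕ.+ k) c * (1# - c * (q ^ 2 * (q ^ (k ℕ.+ k)) ^ 2)) * (1# - c * (q ^ 2 * (q * q ^ (k ℕ.+ k)) ^ 2))
        ≡⟨ cong₂ (λ x z → x * (1# - c * (q ^ 2 * z ^ 2)) * (1# - c * (q ^ 2 * (q * z) ^ 2))) (E-even k c) (^-+ q k k) ⟩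
      X * Y * (1# - c * (q ^ 2 * (z * z) ^ 2)) * (1# - c * (q ^ 2 * (q * (z * z)) ^ 2))
        ≡⟨ solve 5 (λ X Y c q z → X :* Y :* (:1 :- c :* (q :^ 2 :* (z :* z) :^ 2)) :* (:1 :- c :* (q :^ 2 :* (q :* (z :* z)) :^ 2))
             := X :* (:1 :- c :* (q :^ 2 :* z :^ 4)) :* (Y :* (:1 :- c :* (q :^ 4 :* z :^ 4)))) refl X Y c q z ⟩
      X * (1# - c * (q ^ 2 * z ^ 4)) * (Y * (1# - c * (q ^ 4 * z ^ 4))) ∎
      where
      z = q ^ k
      X = ∏ k (λ i → 1# - c * (q ^ 2 * (q ^ i) ^ 4))
      Y = ∏ k (λ i → 1# - c * (q ^ 4 * (q ^ i) ^ 4))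

    private
      -- This `n` is the degree 4 m + 2, one less than the exponent in `u`.
      n = suc (2 ℕ.* m) ℕ.+ suc (2 ℕ.* m)

      E≡B*C : ∀ c → E n c ≡ 𝒟 c * 𝒞 c
      E≡B*C c = trans (E-even (suc (2 ℕ.* m)) c) (trans (cong (_* Y)
        (trans (cong (λ k → ∏ (suc k) f) (cong (m ℕ.+_) (ℕ.+-identityʳ m))) (∏-split (suc m) m f))) (K.*-assoc _ _ _))
        where
        f : ℕ → K
        f i = 1# - c * (q ^ 2 * (q ^ i) ^ 4)
        Y = ∏ (suc (2 ℕ.* m)) (λ i → 1# - c * (q ^ 4 * (q ^ i) ^ 4))

      degree : n ≡ suc m ℕ.+ (m ℕ.+ suc (2 ℕ.* m))
      degree = cong suc (trans (cong (ℕ._+ suc (2 ℕ.* m)) (cong (m ℕ.+_) (ℕ.+-identityʳ m))) (ℕ.+-assoc m m (suc (2 ℕ.* m))))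

    -- At c = q both products run over the same factors `1 - q ^ (4 i + 3)`, shifted by one index;
    -- they differ by powers of q and by the end factors `1 - u` and `q - 1`. The identity also
    -- evaluates (q³;q⁴)ₘ₊₁ / (1/q;q⁴)ₘ₊₁ in `T₁/B₁`.
    at-first-node : (1# - q) * 1# * y * 𝒟 (c_ 0) ≡ (u - 1#) * 𝒩 (c_ 0)
    at-first-node = begin
      (1# - q) * 1# * y * (∏ m (λ i → 1# - q * 1# ^ 4 * (q ^ 2 * (q ^ i) ^ 4)) * (1# - q * 1# ^ 4 * (q ^ 2 * y ^ 4)))
        ≡⟨ cong (λ t → (1# - q) * 1# * y * (t * (1# - q * 1# ^ 4 * (q ^ 2 * y ^ 4))))
             (∏-cong m (λ i → solve 2 (λ q z → :1 :- q :* :1 :^ 4 :* (q :^ 2 :* z) := :1 :- q :^ 3 :* z) refl q ((q ^ i) ^ 4))) ⟩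
      (1# - q) * 1# * y * (X * (1# - q * 1# ^ 4 * (q ^ 2 * y ^ 4)))
        ≡⟨ solve 3 (λ q y X → (:1 :- q) :* :1 :* y :* (X :* (:1 :- q :* :1 :^ 4 :* (q :^ 2 :* y :^ 4)))
             := (q :^ 3 :* y :^ 4 :- :1) :* ((q :* :1 :^ 4 :- :1 :^ 4) :* (y :* X))) refl q y X ⟩
      (u - 1#) * ((q * 1# ^ 4 - 1# ^ 4) * (y * X))
        ≡⟨ cong (λ t → (u - 1#) * ((q * 1# ^ 4 - 1# ^ 4) * t)) (∏-scale m q) ⟨
      (u - 1#) * ((q * 1# ^ 4 - 1# ^ 4) * ∏ m (λ i → q * (1# - q ^ 3 * (q ^ i) ^ 4)))
        ≡⟨ cong (λ t → (u - 1#) * ((q * 1# ^ 4 - 1# ^ 4) * t))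
             (∏-cong m (λ i → solve 2 (λ q z → q :* (:1 :- q :^ 3 :* z :^ 4) := q :* :1 :^ 4 :- (q :* z) :^ 4) refl q (q ^ i))) ⟩
      (u - 1#) * ((q * 1# ^ 4 - 1# ^ 4) * ∏ m (λ i → q * 1# ^ 4 - (q ^ suc i) ^ 4))
        ≡⟨ cong ((u - 1#) *_) (∏-head m (λ i → q * 1# ^ 4 - (q ^ i) ^ 4)) ⟨
      (u - 1#) * 𝒩 (c_ 0) ∎
      where X = ∏ m (λ i → 1# - q ^ 3 * (q ^ i) ^ 4)

    module _ (root : (a - u) * (1# - a * u) ≡ 0#) where
      private
        -- `L W / a` is invariant under exchanging a and 1/a, so both roots of `root` are treated at
        -- once.
        L*u : ∀ W → L W * u ≡ a * ((1# - u * (q ^ 4 * W)) * (u - q ^ 4 * W))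
        L*u W = x-y≡0⇒x≡y (begin
          L W * u - a * ((1# - u * (q ^ 4 * W)) * (u - q ^ 4 * W))
            ≡⟨ solve 3 (λ a u X → (:1 :- a :* X) :* (a :- X) :* u :- a :* ((:1 :- u :* X) :* (u :- X)) := X :* ((a :- u) :* (:1 :- a :* u))) refl a u (q ^ 4 * W) ⟩
          q ^ 4 * W * ((a - u) * (1# - a * u))
            ≡⟨ cong (q ^ 4 * W *_) root ⟩
          q ^ 4 * W * 0#
            ≡⟨ K.zeroʳ _ ⟩
          0# ∎)

        u≢0 : u ≢ 0#
        u≢0 = *-nonzero (^-nonzero q≢0 3) (^-nonzero (^-nonzero q≢0 m) 4)

        -- Both sides satisfy the same first-order recurrence in `j`: moving to the next node shifts
        -- the products `𝒟` and `𝒩` by one index, which changes only their end factors, and `root`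
        -- matches these with the new factor of `R`.
        at-node : ∀ j → (1# - q) * R j * y * 𝒟 (c_ j) ≡ (u - 1#) * 𝒩 (c_ j)
        at-node zero = at-first-node
        at-node (suc j) = *-cancel (*-nonzero (1-node≢0 j 0 2) (*-nonzeroʳ nonzero)) (begin
          e * (d₁ * d₂) * ((1# - q) * R (suc j) * y * 𝒟 c′)
            ≡⟨ solve 7 (λ e d₁ d₂ q r y b → e :* (d₁ :* d₂) :* ((:1 :- q) :* r :* y :* b) := (:1 :- q) :* (r :* (d₁ :* d₂)) :* y :* (e :* b)) refl e d₁ d₂ q (R (suc j)) y (𝒟 c′) ⟩
          (1# - q) * (R (suc j) * (d₁ * d₂)) * y * (e * 𝒟 c′)
            ≡⟨ cong₂ (λ s t → (1# - q) * s * y * t) R-suc B-suc ⟩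
          (1# - q) * (R j * (e * (1# - q ^ 5 * W) * u)) * y * (𝒟 c * d₁)
            ≡⟨ solve 8 (λ q r e f u y b d → (:1 :- q) :* (r :* (e :* f :* u)) :* y :* (b :* d) := (:1 :- q) :* r :* y :* b :* (e :* f :* u :* d)) refl q (R j) e (1# - q ^ 5 * W) u y (𝒟 c) d₁ ⟩
          (1# - q) * R j * y * 𝒟 c * (e * (1# - q ^ 5 * W) * u * d₁)
            ≡⟨ cong (_* (e * (1# - q ^ 5 * W) * u * d₁)) (at-node j) ⟩
          (u - 1#) * 𝒩 c * (e * (1# - q ^ 5 * W) * u * d₁)
            ≡⟨ solve 6 (λ 𝒩 e d q z y → let u = q :^ 3 :* y :^ 4; W = z :^ 4 in
                 (u :- :1) :* 𝒩 :* (e :* (:1 :- q :^ 5 :* W) :* u :* d) := (:- (q :^ 3)) :* e :* d :* (u :- :1) :* (𝒩 :* (y :^ 4 :* (q :* (q :* z) :^ 4 :- :1)))) refl (𝒩 c) e d₁ q z y ⟩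
          - (q ^ 3) * e * d₁ * (u - 1#) * (𝒩 c * (y ^ 4 * (c′ - 1#)))
            ≡⟨ cong (- (q ^ 3) * e * d₁ * (u - 1#) *_) A-suc ⟨
          - (q ^ 3) * e * d₁ * (u - 1#) * ((c - y ^ 4) * 𝒩 c′)
            ≡⟨ solve 6 (λ e d 𝒩 q z y → let u = q :^ 3 :* y :^ 4 in
                  (:- (q :^ 3)) :* e :* d :* (u :- :1) :* ((q :* z :^ 4 :- y :^ 4) :* 𝒩) := e :* (d :* (u :- q :^ 4 :* z :^ 4)) :* ((u :- :1) :* 𝒩)) refl e d₁ (𝒩 c′) q z y ⟩
          e * (d₁ * d₂) * ((u - 1#) * 𝒩 c′) ∎)
          where
          z = q ^ j
          W = z ^ 4
          c = c_ j
          c′ = c_ (suc j)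
          e = 1# - c * (q ^ 2 * 1# ^ 2)
          d₁ = 1# - u * (q ^ 4 * W)
          d₂ = u - q ^ 4 * W
          nonzero : a * (d₁ * d₂) ≢ 0#
          nonzero h = *-nonzero (L≢0 j) u≢0 (trans (L*u W) h)
          R-suc : R (suc j) * (d₁ * d₂) ≡ R j * (e * (1# - q ^ 5 * W) * u)
          R-suc = *-cancel (*-nonzeroˡ nonzero) (begin
            a * (R j * (Λ W / L W) * (d₁ * d₂))       ≡⟨ solve 4 (λ a r f d → a :* (r :* f :* d) := r :* f :* (a :* d)) refl a (R j) (Λ W / L W) (d₁ * d₂) ⟩
            R j * (Λ W / L W) * (a * (d₁ * d₂))       ≡⟨ cong (R j * (Λ W / L W) *_) (L*u W) ⟨
            R j * (Λ W / L W) * (L W * u)             ≡⟨ solve 4 (λ r f l u → r :* f :* (l :* u) := r :* (f :* l :* u)) refl (R j) (Λ W / L W) (L W) u ⟩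
            R j * (Λ W / L W * L W * u)               ≡⟨ cong (λ t → R j * (t * u)) (/-* (L≢0 j)) ⟩
            R j * (Λ W * u)                           ≡⟨ solve 5 (λ r q W a u → r :* ((:1 :- q :^ 3 :* W) :* (:1 :- q :^ 5 :* W) :* a :* u)
                                                           := a :* (r :* ((:1 :- q :* W :* (q :^ 2 :* :1 :^ 2)) :* (:1 :- q :^ 5 :* W) :* u))) refl (R j) q W a u ⟩
            a * (R j * (e * (1# - q ^ 5 * W) * u))    ∎)
          B-suc : e * 𝒟 c′ ≡ 𝒟 c * d₁
          B-suc = begin
            e * 𝒟 c′
              ≡⟨ cong₂ _*_ (cong (λ t → 1# - c * (q ^ 2 * t)) (solve 0 (:1 :^ 2 := :1 :^ 4) refl))
                   (∏-cong (suc m) (λ i → solve 3 (λ q z x → :1 :- q :* (q :* z) :^ 4 :* (q :^ 2 :* x :^ 4) := :1 :- q :* z :^ 4 :* (q :^ 2 :* (q :* x) :^ 4)) refl q z (q ^ i))) ⟩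
            f 0 * ∏ (suc m) (f ∘ suc)
              ≡⟨ ∏-shift (suc m) f ⟩
            𝒟 c * f (suc m)
              ≡⟨ cong (𝒟 c *_) (solve 3 (λ q z y → :1 :- q :* z :^ 4 :* (q :^ 2 :* (q :* y) :^ 4) := :1 :- q :^ 3 :* y :^ 4 :* (q :^ 4 :* z :^ 4)) refl q z y) ⟩
            𝒟 c * d₁ ∎
            where
            f : ℕ → K
            f i = 1# - c * (q ^ 2 * (q ^ i) ^ 4)
          A-suc : (c - y ^ 4) * 𝒩 c′ ≡ 𝒩 c * (y ^ 4 * (c′ - 1#))
          A-suc = begin
            (c - y ^ 4) * 𝒩 c′
              ≡⟨ cong ((c - y ^ 4) *_) (∏-head m (λ i → c′ - (q ^ i) ^ 4)) ⟩
            (c - y ^ 4) * ((c′ - 1# ^ 4) * ∏ m (λ i → c′ - (q ^ suc i) ^ 4))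
              ≡⟨ cong (λ t → (c - y ^ 4) * ((c′ - 1# ^ 4) * t)) (trans
                   (∏-cong m (λ i → solve 3 (λ q z x → q :* (q :* z) :^ 4 :- (q :* x) :^ 4 := q :^ 4 :* (q :* z :^ 4 :- x :^ 4)) refl q z (q ^ i)))
                   (∏-scale m (q ^ 4))) ⟩
            (c - y ^ 4) * ((c′ - 1# ^ 4) * ((q ^ 4) ^ m * ∏ m (λ i → c - (q ^ i) ^ 4)))
              ≡⟨ cong (λ t → (c - y ^ 4) * ((c′ - 1# ^ 4) * (t * ∏ m (λ i → c - (q ^ i) ^ 4))))
                   (trans (sym (^-* q m 4)) (trans (cong (q ^_) (ℕ.*-comm m 4)) (^-* q 4 m))) ⟩
            (c - y ^ 4) * ((c′ - 1# ^ 4) * (y ^ 4 * ∏ m (λ i → c - (q ^ i) ^ 4)))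
              ≡⟨ solve 4 (λ c c′ y p → (c :- y :^ 4) :* ((c′ :- :1 :^ 4) :* (y :^ 4 :* p)) := p :* (c :- y :^ 4) :* (y :^ 4 :* (c′ :- :1))) refl c c′ y (∏ m (λ i → c - (q ^ i) ^ 4)) ⟩
            𝒩 c * (y ^ 4 * (c′ - 1#)) ∎

        linear : ∀ z → Deg 1 (λ c → 1# - c * z)
        linear = Deg-linear 1#

        polynomials-agree : ∀ c → y * T n c ≡ (u - 1#) * (𝒩 c * 𝒞 c)
        polynomials-agree c = x-y≡0⇒x≡y (zero-polynomial n
          (Deg-+ n (Deg-scale n y (Deg-T n)) (Deg-neg n (Deg-scale n (u - 1#) (subst (λ k → Deg k (λ c → 𝒩 c * 𝒞 c)) (sym degree)
            (Deg-* (suc m) (m ℕ.+ suc (2 ℕ.* m)) (Deg-∏ (suc m) (λ i → Deg-+ 1 Deg-id (Deg-const 1 (- (q ^ i) ^ 4))))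
              (Deg-* m (suc (2 ℕ.* m)) (Deg-∏ m (λ i → linear _)) (Deg-∏ (suc (2 ℕ.* m)) (λ i → linear _))))))))
          c-distinct (λ j j≤n → x≡y⇒x-y≡0 (begin
            y * T n (c_ j)
              ≡⟨ cong (y *_) (trans (T-node n j j≤n) (cong ((1# - q) * R j *_) (E≡B*C (c_ j)))) ⟩
            y * ((1# - q) * R j * (𝒟 (c_ j) * 𝒞 (c_ j)))
              ≡⟨ solve 4 (λ y r b c → y :* (r :* (b :* c)) := r :* y :* b :* c) refl y ((1# - q) * R j) (𝒟 (c_ j)) (𝒞 (c_ j)) ⟩
            (1# - q) * R j * y * 𝒟 (c_ j) * 𝒞 (c_ j)
              ≡⟨ cong (_* 𝒞 (c_ j)) (at-node j) ⟩
            (u - 1#) * 𝒩 (c_ j) * 𝒞 (c_ j)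
              ≡⟨ K.*-assoc _ _ _ ⟩
            (u - 1#) * (𝒩 (c_ j) * 𝒞 (c_ j)) ∎)) c)

      evaluation₂ : ∀ {c} → (∀ i → 1# - c * (q ^ 2 * (q ^ i) ^ 2) ≢ 0#) → y * 𝒟 c * S c (suc n) ≡ (u - 1#) * 𝒩 c
      evaluation₂ {c} c≢ = *-cancel (*-nonzeroʳ (λ h → ∏-nonzero n c≢ (trans (E≡B*C c) h))) (begin
        𝒞 c * (y * 𝒟 c * S c (suc n))    ≡⟨ solve 4 (λ c y b s → c :* (y :* b :* s) := y :* (s :* (b :* c))) refl (𝒞 c) y (𝒟 c) (S c (suc n)) ⟩
        y * (S c (suc n) * (𝒟 c * 𝒞 c))  ≡⟨ cong (λ t → y * (S c (suc n) * t)) (E≡B*C c) ⟨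
        y * (S c (suc n) * E n c)        ≡⟨ cong (y *_) (S*E c≢ n) ⟩
        y * T n c                        ≡⟨ polynomials-agree c ⟩
        (u - 1#) * (𝒩 c * 𝒞 c)           ≡⟨ solve 3 (λ u a c → u :* (a :* c) := c :* (u :* a)) refl (u - 1#) (𝒩 c) (𝒞 c) ⟩
        𝒞 c * ((u - 1#) * 𝒩 c)           ∎)

-- Rational functions with admissible denominators

⟦_⟧ : Poly → K → K → K → K
⟦ con c ⟧ q a b = ι c
⟦ varq ⟧  q a b = q
⟦ vara ⟧  q a b = a
⟦ varb ⟧  q a b = b
⟦ p ⊕ r ⟧ q a b = ⟦ p ⟧ q a b + ⟦ r ⟧ q a b
⟦ p ⊗ r ⟧ q a b = ⟦ p ⟧ q a b * ⟦ r ⟧ q a b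
⟦ ⊖ p ⟧   q a b = - ⟦ p ⟧ q a b

⟦⟧-ι : ∀ p q a b → ⟦ p ⟧ (ι q) (ι a) (ι b) ≡ ι (evalP q a b p)
⟦⟧-ι (con c) q a b = refl
⟦⟧-ι varq    q a b = refl
⟦⟧-ι vara    q a b = refl
⟦⟧-ι varb    q a b = refl
⟦⟧-ι (p ⊕ r) q a b = trans (cong₂ _+_ (⟦⟧-ι p q a b) (⟦⟧-ι r q a b)) (sym (ι-+ _ _))
⟦⟧-ι (p ⊗ r) q a b = trans (cong₂ _*_ (⟦⟧-ι p q a b) (⟦⟧-ι r q a b)) (sym (ι-* _ _))
⟦⟧-ι (⊖ p)   q a b = trans (cong (λ t → - t) (⟦⟧-ι p q a b)) (sym (ι-neg _))

⟦⟧-^ : ∀ p k q a b → ⟦ p ^P k ⟧ q a b ≡ ⟦ p ⟧ q a b ^ k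
⟦⟧-^ p zero    q a b = ι-1
⟦⟧-^ p (suc k) q a b = cong (⟦ p ⟧ q a b *_) (⟦⟧-^ p k q a b)

Good-mono : ∀ {I J D} → I ℕ.≤ J → Good I D → Good J D
Good-mono I≤J one         = one
Good-mono I≤J (times g h) = times (Good-mono I≤J g) (Good-mono I≤J h)
Good-mono I≤J q-good      = q-good
Good-mono I≤J (1+q i<I)   = 1+q (ℕ.≤-trans i<I I≤J)
Good-mono I≤J (1-aq i<I)  = 1-aq (ℕ.≤-trans i<I I≤J)
Good-mono I≤J (a-q i<I)   = a-q (ℕ.≤-trans i<I I≤J)
Good-mono I≤J (1-b³q i<I) = 1-b³q (ℕ.≤-trans i<I I≤J)
Good-mono I≤J a-b         = a-b
Good-mono I≤J 1-ab        = 1-ab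

Denominator : Poly → Set
Denominator D = Σ ℕ λ I → Good I D

denominator-* : ∀ {D D′} → Denominator D → Denominator D′ → Denominator (D ⊗ D′)
denominator-* (I , g) (J , h) = I ℕ.⊔ J , times (Good-mono (ℕ.m≤m⊔n I J) g) (Good-mono (ℕ.m≤n⊔m I J) h)

-- Points with a = b stay admissible: `three-factors` evaluates at `a = q ^ n` for all sampled
-- values of b.
record Ω (q a b : K) : Set where
  field
    generic  : Generic q a
    1-b³q≢0  : ∀ i → 1# - b ^ 3 * (q ^ 2 * (q ^ i) ^ 2) ≢ 0#
  open Generic generic public

Function : Set
Function = K → K → K → K

-- Membership in the localization of ℤ[q,a,b] at the admissible denominators, stated for functions.
-- The equation is required on `Ω` only, where the inverses taken below are genuine.
record Local (f : Function) : Set where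
  constructor local
  field
    {numer denom} : Poly
    good          : Denominator denom
    value         : ∀ {q a b} → Ω q a b → ⟦ denom ⟧ q a b * f q a b ≡ ⟦ numer ⟧ q a b

local-resp : ∀ {f g} → (∀ {q a b} → Ω q a b → f q a b ≡ g q a b) → Local f → Local g
local-resp f≗g (local {numer = N} {denom = D} d v) = local {numer = N} d (λ ω → trans (cong (⟦ D ⟧ _ _ _ *_) (sym (f≗g ω))) (v ω))

local-poly : ∀ p → Local ⟦ p ⟧
local-poly p = local {numer = p} {denom = 𝟙} (0 , one) (λ {q} {a} {b} _ → trans (cong (_* ⟦ p ⟧ q a b) ι-1) (K.*-identityˡ _))

local-0 : Local (λ _ _ _ → 0#)
local-0 = local-resp (λ _ → ι-0) (local-poly 𝟘)

local-1 : Local (λ _ _ _ → 1#)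
local-1 = local-resp (λ _ → ι-1) (local-poly 𝟙)

local-q : Local (λ q _ _ → q)
local-q = local-poly varq

local-a : Local (λ _ a _ → a)
local-a = local-poly vara

local-b : Local (λ _ _ b → b)
local-b = local-poly varb

local-* : ∀ {f g} → Local f → Local g → Local (λ q a b → f q a b * g q a b)
local-* {f} {g} (local {numer = N} {denom = D} d v) (local {numer = N′} {denom = D′} d′ v′) = local {numer = N ⊗ N′} (denominator-* d d′) λ {q} {a} {b} ω → trans
  (solve 4 (λ x y f g → x :* y :* (f :* g) := x :* f :* (y :* g)) refl (⟦ D ⟧ q a b) (⟦ D′ ⟧ q a b) (f q a b) (g q a b))
  (cong₂ _*_ (v ω) (v′ ω))

local-+ : ∀ {f g} → Local f → Local g → Local (λ q a b → f q a b + g q a b)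
local-+ {f} {g} (local {numer = N} {denom = D} d v) (local {numer = N′} {denom = D′} d′ v′) = local {numer = N ⊗ D′ ⊕ N′ ⊗ D} (denominator-* d d′) λ {q} {a} {b} ω → trans
  (solve 4 (λ x y f g → x :* y :* (f :+ g) := x :* f :* y :+ y :* g :* x) refl (⟦ D ⟧ q a b) (⟦ D′ ⟧ q a b) (f q a b) (g q a b))
  (cong₂ _+_ (cong (_* ⟦ D′ ⟧ q a b) (v ω)) (cong (_* ⟦ D ⟧ q a b) (v′ ω)))

local-neg : ∀ {f} → Local f → Local (λ q a b → - f q a b)
local-neg {f} (local {numer = N} {denom = D} d v) = local {numer = ⊖ N} d λ {q} {a} {b} ω → trans
  (solve 2 (λ x f → x :* (:- f) := :- (x :* f)) refl (⟦ D ⟧ q a b) (f q a b)) (cong (λ t → - t) (v ω))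

local-- : ∀ {f g} → Local f → Local g → Local (λ q a b → f q a b - g q a b)
local-- l m = local-+ l (local-neg m)

local-^ : ∀ {f} → Local f → ∀ k → Local (λ q a b → f q a b ^ k)
local-^ l zero    = local-1
local-^ l (suc k) = local-* l (local-^ l k)

local-∏ : ∀ n {f : ℕ → Function} → (∀ i → Local (f i)) → Local (λ q a b → ∏ n (λ i → f i q a b))
local-∏ zero    l = local-1
local-∏ (suc n) l = local-* (local-∏ n l) (l n)

local-∑ : ∀ n {f : ℕ → Function} → (∀ i → i ℕ.< n → Local (f i)) → Local (λ q a b → ∑ n (λ i → f i q a b))
local-∑ zero    l = local-0
local-∑ (suc n) l = local-+ (local-∑ n (λ i i<n → l i (ℕ.m<n⇒m<1+n i<n))) (l n ℕ.≤-refl)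

-- A function that may be inverted: on `Ω` it is the nonzero value of an admissible polynomial.
record Unit (f : Function) : Set where
  constructor unit
  field
    {poly}  : Poly
    good    : Denominator poly
    nonzero : ∀ {q a b} → Ω q a b → f q a b ≢ 0#
    value   : ∀ {q a b} → Ω q a b → ⟦ poly ⟧ q a b ≡ f q a b

local-inv : ∀ {f} → Unit f → Local (λ q a b → inv (f q a b))
local-inv {f} (unit d f≢0 v) = local {numer = 𝟙} d λ ω → trans (cong (_* inv (f _ _ _)) (v ω)) (trans (*-inv (f≢0 ω)) (sym ι-1))

unit-1 : Unit (λ _ _ _ → 1#)
unit-1 = unit {poly = 𝟙} (0 , one) (λ _ → 1≢0) (λ _ → ι-1)

unit-* : ∀ {f g} → Unit f → Unit g → Unit (λ q a b → f q a b * g q a b)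
unit-* (unit {poly = D} d n v) (unit {poly = D′} d′ n′ v′) = unit {poly = D ⊗ D′} (denominator-* d d′) (λ ω → *-nonzero (n ω) (n′ ω)) (λ ω → cong₂ _*_ (v ω) (v′ ω))

unit-^ : ∀ {f} → Unit f → ∀ k → Unit (λ q a b → f q a b ^ k)
unit-^ u zero    = unit-1
unit-^ u (suc k) = unit-* u (unit-^ u k)

unit-∏ : ∀ n {f : ℕ → Function} → (∀ i → Unit (f i)) → Unit (λ q a b → ∏ n (λ i → f i q a b))
unit-∏ zero    u = unit-1
unit-∏ (suc n) u = unit-* (unit-∏ n u) (u n)

unit-q : Unit (λ q _ _ → q)
unit-q = unit {poly = varq} (0 , q-good) (λ ω → Ω.q≢0 ω) (λ _ → refl)

⟦varq^⟧ : ∀ k m q a b → ⟦ varq ^P (k ℕ.* suc m) ⟧ q a b ≡ q ^ k * (q ^ m) ^ k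
⟦varq^⟧ k m q a b = begin
  ⟦ varq ^P (k ℕ.* suc m) ⟧ q a b    ≡⟨ ⟦⟧-^ varq (k ℕ.* suc m) q a b ⟩
  q ^ (k ℕ.* suc m)                  ≡⟨ cong (q ^_) (ℕ.*-suc k m) ⟩
  q ^ (k ℕ.+ k ℕ.* m)                ≡⟨ ^-+ q k (k ℕ.* m) ⟩
  q ^ k * q ^ (k ℕ.* m)              ≡⟨ cong (q ^ k *_) (^-* q k m) ⟩
  q ^ k * (q ^ m) ^ k                ∎

1+q^≢0 : ∀ {q a} → Generic q a → ∀ i → 1# + q ^ suc i ≢ 0#
1+q^≢0 {q} gen i h = Generic.1-q^≢0 gen (i ℕ.+ suc i) (begin
  1# - q ^ (suc i ℕ.+ suc i)            ≡⟨ cong (λ t → 1# - t) (^-+ q (suc i) (suc i)) ⟩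
  1# - q ^ suc i * q ^ suc i            ≡⟨ solve 1 (λ x → :1 :- x :* x := (:1 :- x) :* (:1 :+ x)) refl (q ^ suc i) ⟩
  (1# - q ^ suc i) * (1# + q ^ suc i)   ≡⟨ cong ((1# - q ^ suc i) *_) h ⟩
  (1# - q ^ suc i) * 0#                 ≡⟨ K.zeroʳ _ ⟩
  0#                                    ∎)

unit-1+q : ∀ i → Unit (λ q _ _ → 1# + q ^ suc i)
unit-1+q i = unit (suc i , 1+q ℕ.≤-refl) (λ ω → 1+q^≢0 (Ω.generic ω) i)
  (λ {q} {a} {b} _ → cong₂ _+_ ι-1 (⟦⟧-^ varq (suc i) q a b))

unit-1-aq : ∀ i → Unit (λ q a _ → 1# - a * (q ^ 4 * (q ^ i) ^ 4))
unit-1-aq i = unit (suc i , 1-aq {i = i} ℕ.≤-refl) (λ ω → Ω.1-aq≢0 ω i)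
  (λ {q} {a} {b} _ → cong₂ _-_ ι-1 (cong (a *_) (⟦varq^⟧ 4 i q a b)))

unit-a-q : ∀ i → Unit (λ q a _ → a - q ^ 4 * (q ^ i) ^ 4)
unit-a-q i = unit (suc i , a-q {i = i} ℕ.≤-refl) (λ ω → Ω.a-q≢0 ω i)
  (λ {q} {a} {b} _ → cong (λ t → a - t) (⟦varq^⟧ 4 i q a b))

unit-1-b³q : ∀ i → Unit (λ q _ b → 1# - b ^ 3 * (q ^ 2 * (q ^ i) ^ 2))
unit-1-b³q i = unit (suc i , 1-b³q {i = i} ℕ.≤-refl) (λ ω → Ω.1-b³q≢0 ω i)
  (λ {q} {a} {b} _ → cong₂ _-_ ι-1 (cong₂ _*_ (⟦⟧-^ varb 3 q a b) (⟦varq^⟧ 2 i q a b)))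

-- Divisibility by [n]

module Binomial (q : K) where
  -- (q;q)ₘ and (q;q²)ₘ
  φ ψ : ℕ → K
  φ m = ∏ m (λ i → 1# - q ^ suc i)
  ψ m = ∏ m (λ i → 1# - q * (q ^ i) ^ 2)

  -- The Gaussian binomial coefficient of m + k over k. The q-Pascal rule serves as definition
  -- because it makes the coefficient a polynomial in q.
  binomial : ℕ → ℕ → K
  binomial zero    k       = 1#
  binomial (suc m) zero    = 1#
  binomial (suc m) (suc k) = binomial m (suc k) + q ^ suc m * binomial (suc m) k

  φ-+ : ∀ m k → φ (m ℕ.+ k) ≡ binomial m k * (φ m * φ k)
  φ-+ zero    k    = solve 1 (λ x → x := :1 :* (:1 :* x)) refl (φ k)
  φ-+ (suc m) zero = trans (cong φ (ℕ.+-identityʳ (suc m))) (solve 1 (λ x → x := :1 :* (x :* :1)) refl (φ (suc m)))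
  φ-+ (suc m) (suc k) = begin
    φ (m ℕ.+ suc k) * (1# - q ^ suc (m ℕ.+ suc k))
      ≡⟨ cong (λ t → φ (m ℕ.+ suc k) * (1# - t)) (^-+ q (suc m) (suc k)) ⟩
    φ (m ℕ.+ suc k) * (1# - x * y)
      ≡⟨ solve 3 (λ f x y → f :* (:1 :- x :* y) := f :* (:1 :- x) :+ x :* (f :* (:1 :- y))) refl (φ (m ℕ.+ suc k)) x y ⟩
    φ (m ℕ.+ suc k) * (1# - x) + x * (φ (m ℕ.+ suc k) * (1# - y))
      ≡⟨ cong₂ (λ s t → s * (1# - x) + x * (t * (1# - y))) (φ-+ m (suc k)) (trans (cong φ (ℕ.+-suc m k)) (φ-+ (suc m) k)) ⟩
    binomial m (suc k) * (φ m * φ (suc k)) * (1# - x) + x * (binomial (suc m) k * (φ (suc m) * φ k) * (1# - y))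
      ≡⟨ solve 6 (λ b c f g x y → b :* (f :* (g :* (:1 :- y))) :* (:1 :- x) :+ x :* (c :* (f :* (:1 :- x) :* g) :* (:1 :- y))
           := (b :+ x :* c) :* (f :* (:1 :- x) :* (g :* (:1 :- y)))) refl (binomial m (suc k)) (binomial (suc m) k) (φ m) (φ k) x y ⟩
    binomial (suc m) (suc k) * (φ (suc m) * φ (suc k)) ∎
    where
    x = q ^ suc m
    y = q ^ suc k

  -- The even half of (q;q)₂ₘ is (q²;q²)ₘ, which factors as (q;q)ₘ times the product of the
  -- `1 + q ^ i`.
  ψ-φ : ∀ m → ψ m * ∏ m (λ i → 1# + q ^ suc i) * φ m ≡ φ (m ℕ.+ m)
  ψ-φ zero    = solve 0 (:1 :* :1 :* :1 := :1) refl
  ψ-φ (suc m) = begin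
    ψ m * (1# - q * x ^ 2) * (p * (1# + q * x)) * (φ m * (1# - q * x))
      ≡⟨ solve 5 (λ s p f q x → s :* (:1 :- q :* x :^ 2) :* (p :* (:1 :+ q :* x)) :* (f :* (:1 :- q :* x))
           := s :* p :* f :* (:1 :- q :* (x :* x)) :* (:1 :- q :* (q :* (x :* x)))) refl (ψ m) p (φ m) q x ⟩
    ψ m * p * φ m * (1# - q * (x * x)) * (1# - q * (q * (x * x)))
      ≡⟨ cong₂ (λ s t → s * (1# - q * t) * (1# - q * (q * t))) (ψ-φ m) (sym (^-+ q m m)) ⟩
    φ (2 ℕ.+ (m ℕ.+ m))
      ≡⟨ cong (φ ∘ suc) (ℕ.+-suc m m) ⟨
    φ (suc m ℕ.+ suc m) ∎
    where
    x = q ^ m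
    p = ∏ m (λ i → 1# + q ^ suc i)

  module _ (1-q^≢0 : ∀ i → 1# - q ^ suc i ≢ 0#) where
    φ≢0 : ∀ m → φ m ≢ 0#
    φ≢0 m = ∏-nonzero m 1-q^≢0

    -- Up to the units `1 + q ^ i`, (q;q²)ₘ is thus a polynomial multiple of (q;q)ₘ; this brings
    -- factors `1 - q ^ i` with even i, and all others, into the numerator.
    ψ-binomial : ∀ m → ψ m * ∏ m (λ i → 1# + q ^ suc i) ≡ binomial m m * φ m
    ψ-binomial m = *-cancel (φ≢0 m) (begin
      φ m * (ψ m * ∏ m (λ i → 1# + q ^ suc i))    ≡⟨ K.*-comm _ _ ⟩
      ψ m * ∏ m (λ i → 1# + q ^ suc i) * φ m      ≡⟨ ψ-φ m ⟩
      φ (m ℕ.+ m)                                 ≡⟨ φ-+ m m ⟩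
      binomial m m * (φ m * φ m)                  ≡⟨ solve 2 (λ b f → b :* (f :* f) := f :* (b :* f)) refl (binomial m m) (φ m) ⟩
      φ m * (binomial m m * φ m)                  ∎)

local-binomial : ∀ m k → Local (λ q _ _ → Binomial.binomial q m k)
local-binomial zero    k       = local-1
local-binomial (suc m) zero    = local-1
local-binomial (suc m) (suc k) = local-+ (local-binomial m (suc k)) (local-* (local-^ local-q (suc m)) (local-binomial (suc m) k))

local-φ : ∀ m → Local (λ q _ _ → Binomial.φ q m)
local-φ m = local-∏ m (λ i → local-- local-1 (local-^ local-q (suc i)))

-- c_j - c_i is, up to a unit, 1 - q^(j-i).
module Nodes {q a : K} (gen : Generic q a) where
  open Generic gen
  open Binomial q
  open Interpolated gen using (c_)

  -- The units in `1 - q ^ (4 k) = (1 - q ^ k)(1 + q ^ k)(1 + q ^ (2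
  -- k))`, times a node. `κ₁` pairs the node `c_ i` with the gap `i +
  -- 1` rather than with its own gap `j - i`, which is correct for the whole product.
  κ₁ : ℕ → K
  κ₁ i = q * (q ^ i) ^ 4 * (1# + q ^ suc i) * (1# + q ^ (2 ℕ.* suc i))

  κ₂ : ℕ → ℕ → K
  κ₂ j i = q * (q ^ j) ^ 4 * (1# + q ^ suc i) * (1# + q ^ (2 ℕ.* suc i))

  κ₂≢0 : ∀ j i → κ₂ j i ≢ 0#
  κ₂≢0 j i = *-nonzero (*-nonzero (*-nonzero q≢0 (^-nonzero (^-nonzero q≢0 j) 4)) (1+q^≢0 gen i)) (1+q^≢0 gen (i ℕ.+ 1 ℕ.* suc i))

  -- Multiplication by q⁴ shifts all nodes by one index, so at each step of the induction only the
  -- difference with `c_ 0` is new.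
  below : ∀ j → φ j ≡ ∏ j (λ i → - inv (κ₁ i)) * ∏ j (λ i → c_ j - c_ i)
  below zero    = sym (K.*-identityˡ 1#)
  below (suc j) = *-cancel (κ₂≢0 j j) (begin
    κ₁ j * (φ j * (1# - q * x))
      ≡⟨ cong (λ t → κ₁ j * (t * (1# - q * x))) (below j) ⟩
    κ₁ j * (α * δ * (1# - q * x))
      ≡⟨ cong (λ t → q * x ^ 4 * (1# + q * x) * (1# + t) * (α * δ * (1# - q * x))) (^-* q 2 (suc j)) ⟩
    q * x ^ 4 * (1# + q * x) * (1# + (q * x) ^ 2) * (α * δ * (1# - q * x))
      ≡⟨ solve 4 (λ q x α δ → q :* x :^ 4 :* (:1 :+ q :* x) :* (:1 :+ (q :* x) :^ 2) :* (α :* δ :* (:1 :- q :* x))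
           := :- (α :* ((q :* (q :* x) :^ 4 :- q :* :1 :^ 4) :* (x :^ 4 :* δ)))) refl q x α δ ⟩
    - (α * ((c_ (suc j) - c_ 0) * (x ^ 4 * δ)))
      ≡⟨ cong (λ t → - (α * ((c_ (suc j) - c_ 0) * (t * δ)))) (trans (sym (^-* q 4 j)) (trans (cong (q ^_) (ℕ.*-comm 4 j)) (^-* q j 4))) ⟩
    - (α * ((c_ (suc j) - c_ 0) * ((q ^ 4) ^ j * δ)))
      ≡⟨ cong (λ t → - (α * ((c_ (suc j) - c_ 0) * t))) (∏-scale j (q ^ 4)) ⟨
    - (α * ((c_ (suc j) - c_ 0) * ∏ j (λ i → q ^ 4 * (c_ j - c_ i))))
      ≡⟨ cong (λ t → - (α * ((c_ (suc j) - c_ 0) * t)))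
           (∏-cong j (λ i → solve 3 (λ q x y → q :^ 4 :* (q :* x :^ 4 :- q :* y :^ 4) := q :* (q :* x) :^ 4 :- q :* (q :* y) :^ 4) refl q x (q ^ i))) ⟩
    - (α * ((c_ (suc j) - c_ 0) * ∏ j (λ i → c_ (suc j) - c_ (suc i))))
      ≡⟨ cong (λ t → - (α * t)) (∏-head j (λ i → c_ (suc j) - c_ i)) ⟨
    - (α * δ⁺)
      ≡⟨ solve 2 (λ α δ⁺ → :- (α :* δ⁺) := (:- :1) :* (α :* δ⁺)) refl α δ⁺ ⟩
    - 1# * (α * δ⁺)
      ≡⟨ cong (λ t → - t * (α * δ⁺)) (*-inv (κ₂≢0 j j)) ⟨
    - (κ₁ j * inv (κ₁ j)) * (α * δ⁺)
      ≡⟨ solve 4 (λ k i α δ⁺ → (:- (k :* i)) :* (α :* δ⁺) := k :* (α :* (:- i) :* δ⁺)) refl (κ₁ j) (inv (κ₁ j)) α δ⁺ ⟩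
    κ₁ j * (α * - inv (κ₁ j) * δ⁺) ∎)
    where
    x = q ^ j
    α = ∏ j (λ i → - inv (κ₁ i))
    δ = ∏ j (λ i → c_ j - c_ i)
    δ⁺ = ∏ (suc j) (λ i → c_ (suc j) - c_ i)

  above : ∀ j m → φ m ≡ ∏ m (λ i → inv (κ₂ j i)) * ∏ m (λ i → c_ j - c_ (suc j ℕ.+ i))
  above j m = trans (∏-cong m (λ i → *-cancel (κ₂≢0 j i) (begin
    κ₂ j i * (1# - q ^ suc i)
      ≡⟨ cong (λ t → q * y ^ 4 * (1# + q ^ suc i) * (1# + t) * (1# - q ^ suc i)) (^-* q 2 (suc i)) ⟩
    q * y ^ 4 * (1# + q * q ^ i) * (1# + (q * q ^ i) ^ 2) * (1# - q * q ^ i)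
      ≡⟨ solve 3 (λ q x y → q :* y :^ 4 :* (:1 :+ q :* x) :* (:1 :+ (q :* x) :^ 2) :* (:1 :- q :* x)
           := :1 :* (q :* y :^ 4 :- q :* (q :* (y :* x)) :^ 4)) refl q (q ^ i) y ⟩
    1# * (c_ j - q * (q * (y * q ^ i)) ^ 4)
      ≡⟨ cong₂ (λ s t → s * (c_ j - q * (q * t) ^ 4)) (sym (*-inv (κ₂≢0 j i))) (sym (^-+ q j i)) ⟩
    κ₂ j i * inv (κ₂ j i) * (c_ j - c_ (suc j ℕ.+ i))
      ≡⟨ K.*-assoc _ _ _ ⟩
    κ₂ j i * (inv (κ₂ j i) * (c_ j - c_ (suc j ℕ.+ i))) ∎))) (∏-distrib m)
    where y = q ^ j

  open Series q a using (R; L; Λ)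
  open Interpolated gen using (E)

  -- The products (q³;q⁴)ⱼ and (q⁵;q⁴)ⱼ interleave to (q³;q²)₂ⱼ, and `1 - q` supplies the missing
  -- first factor.
  R-split : ∀ j → (1# - q) * R j ≡ ψ (suc (j ℕ.+ j)) * ∏ j (λ i → a / L ((q ^ i) ^ 4))
  R-split zero    = solve 1 (λ q → (:1 :- q) :* :1 := :1 :* (:1 :- q :* :1 :^ 2) :* :1) refl q
  R-split (suc j) = begin
    (1# - q) * (R j * (Λ W * i))
      ≡⟨ solve 4 (λ q r l i → (:1 :- q) :* (r :* (l :* i)) := (:1 :- q) :* r :* l :* i) refl q (R j) (Λ W) i ⟩
    (1# - q) * R j * Λ W * i
      ≡⟨ cong (λ t → t * Λ W * i) (R-split j) ⟩
    ψ (suc (j ℕ.+ j)) * p * Λ W * i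
      ≡⟨ solve 6 (λ s p q y a i → s :* p :* ((:1 :- q :^ 3 :* y :^ 4) :* (:1 :- q :^ 5 :* y :^ 4) :* a) :* i
           := s :* (:1 :- q :* (q :* (y :* y)) :^ 2) :* (:1 :- q :* (q :* (q :* (y :* y))) :^ 2) :* (p :* (a :* i)))
           refl (ψ (suc (j ℕ.+ j))) p q (q ^ j) a i ⟩
    ψ (suc (j ℕ.+ j)) * (1# - q * (q * (q ^ j * q ^ j)) ^ 2) * (1# - q * (q * (q * (q ^ j * q ^ j))) ^ 2) * (p * (a * i))
      ≡⟨ cong (λ t → ψ (suc (j ℕ.+ j)) * (1# - q * (q * t) ^ 2) * (1# - q * (q * (q * t)) ^ 2) * (p * (a * i))) (^-+ q j j) ⟨
    ψ (3 ℕ.+ (j ℕ.+ j)) * (p * (a * i))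
      ≡⟨ cong (λ t → ψ (2 ℕ.+ t) * (p * (a * i))) (ℕ.+-suc j j) ⟨
    ψ (suc (suc j ℕ.+ suc j)) * (p * (a * i)) ∎
    where
    W = (q ^ j) ^ 4
    i = inv (L W)
    p = ∏ j (λ i → a / L ((q ^ i) ^ 4))

  -- At the node, (cq²;q²)ₙ begins exactly where (q;q²) of length 2 j + 1 ends.
  ψ*E : ∀ j n → ψ (suc (j ℕ.+ j)) * E n (c_ j) ≡ ψ (suc (j ℕ.+ j) ℕ.+ n)
  ψ*E j n = sym (trans (∏-split (suc (j ℕ.+ j)) n (λ i → 1# - q * (q ^ i) ^ 2)) (cong (ψ (suc (j ℕ.+ j)) *_) (∏-cong n (λ i → begin
    1# - q * (q * q ^ (j ℕ.+ j ℕ.+ i)) ^ 2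
      ≡⟨ cong (λ t → 1# - q * (q * t) ^ 2) (trans (^-+ q (j ℕ.+ j) i) (cong (_* q ^ i) (^-+ q j j))) ⟩
    1# - q * (q * (q ^ j * q ^ j * q ^ i)) ^ 2
      ≡⟨ solve 3 (λ q x y → :1 :- q :* (q :* (x :* x :* y)) :^ 2 := :1 :- q :* x :^ 4 :* (q :^ 2 :* y :^ 2)) refl q (q ^ j) (q ^ i) ⟩
    1# - c_ j * (q ^ 2 * (q ^ i) ^ 2) ∎))))

  -- The origin of [n]: (q;q)_N is a multiple of (q;q)ₙ₊₁, that is, of (q;q)ₙ times `1 - q ^ suc n`.
  -- The Lagrange denominator needs only (q;q)ⱼ (q;q)ₘ, which already divides (q;q)ₙ, so
  -- `1 - q ^ suc n` survives.
  ψ-divisible : ∀ j m → let n = j ℕ.+ m; N = suc n ℕ.+ (j ℕ.+ j) in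
    ψ N * ∏ N (λ i → 1# + q ^ suc i)
    ≡ (1# - q ^ suc n) * (binomial N N * binomial (suc n) (j ℕ.+ j) * φ (j ℕ.+ j) * binomial j m) * (φ j * φ m)
  ψ-divisible j m = begin
    ψ N * ∏ N (λ i → 1# + q ^ suc i)
      ≡⟨ ψ-binomial 1-q^≢0 N ⟩
    binomial N N * φ N
      ≡⟨ cong (binomial N N *_) (φ-+ (suc n) (j ℕ.+ j)) ⟩
    binomial N N * (binomial (suc n) (j ℕ.+ j) * (φ n * (1# - q ^ suc n) * φ (j ℕ.+ j)))
      ≡⟨ cong (λ t → binomial N N * (binomial (suc n) (j ℕ.+ j) * (t * (1# - q ^ suc n) * φ (j ℕ.+ j)))) (φ-+ j m) ⟩
    binomial N N * (binomial (suc n) (j ℕ.+ j) * (binomial j m * (φ j * φ m) * (1# - q ^ suc n) * φ (j ℕ.+ j)))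
      ≡⟨ solve 6 (λ a b c f u g → a :* (b :* (c :* f :* u :* g)) := u :* (a :* b :* g :* c) :* f) refl
           (binomial N N) (binomial (suc n) (j ℕ.+ j)) (binomial j m) (φ j * φ m) (1# - q ^ suc n) (φ (j ℕ.+ j)) ⟩
    (1# - q ^ suc n) * (binomial N N * binomial (suc n) (j ℕ.+ j) * φ (j ℕ.+ j) * binomial j m) * (φ j * φ m) ∎
    where
    n = j ℕ.+ m
    N = suc n ℕ.+ (j ℕ.+ j)

-- The interpolation weight at c_j, divided by 1 - qⁿ⁺¹ (here n = j + m).
weight : ℕ → ℕ → Function
weight j m q a _ =
  binomial N N * binomial (suc n) (j ℕ.+ j) * φ (j ℕ.+ j) * binomial j m
  * inv (∏ N (λ i → 1# + q ^ suc i)) * ∏ j (λ i → a / L ((q ^ i) ^ 4))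
  * (∏ j (λ i → - inv (q * (q ^ i) ^ 4 * (1# + q ^ suc i) * (1# + q ^ (2 ℕ.* suc i))))
    * ∏ m (λ i → inv (q * (q ^ j) ^ 4 * (1# + q ^ suc i) * (1# + q ^ (2 ℕ.* suc i)))))
  where
  open Binomial q
  open Series q a using (R; L)
  n = j ℕ.+ m
  N = suc n ℕ.+ (j ℕ.+ j)

local-weight : ∀ j m → Local (weight j m)
local-weight j m = local-* (local-* (local-* (local-* (local-* (local-* (local-binomial N N) (local-binomial (suc n) (j ℕ.+ j))) (local-φ (j ℕ.+ j))) (local-binomial j m))
  (local-inv (unit-∏ N unit-1+q)))
  (local-∏ j (λ i → local-* local-a (local-inv (unit-* (unit-1-aq i) (unit-a-q i))))))
  (local-* (local-∏ j (λ i → local-neg (local-inv (unit-κ i i)))) (local-∏ m (λ i → local-inv (unit-κ j i))))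
  where
  n = j ℕ.+ m
  N = suc n ℕ.+ (j ℕ.+ j)
  unit-κ : ∀ k i → Unit (λ q _ _ → q * (q ^ k) ^ 4 * (1# + q ^ suc i) * (1# + q ^ (2 ℕ.* suc i)))
  unit-κ k i = unit-* (unit-* (unit-* unit-q (unit-^ (unit-^ unit-q k) 4)) (unit-1+q i)) (unit-1+q (i ℕ.+ 1 ℕ.* suc i))

weight-correct : ∀ {q a b} (gen : Generic q a) j m → let open Series q a; open Interpolated gen; n = j ℕ.+ m in
  (1# - q) * R j * E n (c_ j) / ∏-except n j (λ i → c_ j - c_ i) ≡ (1# - q ^ suc n) * weight j m q a b
weight-correct {q} {a} {b} gen j m = sym (≡-/ (∏-except-nonzero n j c-distinct) (*-cancel U≢0 (begin
  U * (u * (G * inv U * α * (X * Y)) * ∏-except n j (λ i → c_ j - c_ i))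
    ≡⟨ cong (λ t → U * (u * (G * inv U * α * (X * Y)) * (∏ j (λ i → c_ j - c_ i) * ∏ t (λ i → c_ j - c_ (suc j ℕ.+ i))))) (ℕ.m+n∸m≡n j m) ⟩
  U * (u * (G * inv U * α * (X * Y)) * (X′ * Y′))
    ≡⟨ solve 9 (λ U I u G α X Y X′ Y′ → U :* (u :* (G :* I :* α :* (X :* Y)) :* (X′ :* Y′)) := (U :* I) :* (u :* G :* (X :* X′ :* (Y :* Y′)) :* α))
         refl U (inv U) u G α X Y X′ Y′ ⟩
  U * inv U * (u * G * (X * X′ * (Y * Y′)) * α)
    ≡⟨ cong₂ (λ s t → s * (u * G * t * α)) (*-inv U≢0) (sym (cong₂ _*_ (below j) (above j m))) ⟩
  1# * (u * G * (φ j * φ m) * α)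
    ≡⟨ cong (λ t → 1# * (t * α)) (ψ-divisible j m) ⟨
  1# * (ψ N * U * α)
    ≡⟨ cong (λ t → 1# * (ψ t * U * α)) (cong suc (ℕ.+-comm n (j ℕ.+ j))) ⟩
  1# * (ψ (suc (j ℕ.+ j) ℕ.+ n) * U * α)
    ≡⟨ cong (λ t → 1# * (t * U * α)) (ψ*E j n) ⟨
  1# * (ψ (suc (j ℕ.+ j)) * E n (c_ j) * U * α)
    ≡⟨ solve 4 (λ s e u a → :1 :* (s :* e :* u :* a) := u :* (s :* a :* e)) refl (ψ (suc (j ℕ.+ j))) (E n (c_ j)) U α ⟩
  U * (ψ (suc (j ℕ.+ j)) * α * E n (c_ j))
    ≡⟨ cong (λ t → U * (t * E n (c_ j))) (R-split j) ⟨
  U * ((1# - q) * R j * E n (c_ j)) ∎)))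
  where
  open Binomial q
  open Series q a using (R; L)
  open Interpolated gen
  open Nodes gen
  n = j ℕ.+ m
  N = suc n ℕ.+ (j ℕ.+ j)
  u = 1# - q ^ suc n
  U = ∏ N (λ i → 1# + q ^ suc i)
  U≢0 : U ≢ 0#
  U≢0 = ∏-nonzero N (1+q^≢0 gen)
  G = binomial N N * binomial (suc n) (j ℕ.+ j) * φ (j ℕ.+ j) * binomial j m
  α = ∏ j (λ i → a / L ((q ^ i) ^ 4))
  X = ∏ j (λ i → - inv (κ₁ i))
  Y = ∏ m (λ i → inv (κ₂ j i))
  X′ = ∏ j (λ i → c_ j - c_ i)
  Y′ = ∏ m (λ i → c_ j - c_ (suc j ℕ.+ i))

-- Zeros and linear factors of polynomials

-- A crude bound that adds degrees even for sums; any finite bound will do, as there are infinitely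
-- many sample points.
degree : Poly → ℕ
degree (con c) = 0
degree varq    = 1
degree vara    = 1
degree varb    = 1
degree (p ⊕ r) = degree p ℕ.+ degree r
degree (p ⊗ r) = degree p ℕ.+ degree r
degree (⊖ p)   = degree p

Deg-⟦⟧ : ∀ p {α β γ} → Deg 1 α → Deg 1 β → Deg 1 γ → Deg (degree p) (λ x → ⟦ p ⟧ (α x) (β x) (γ x))
Deg-⟦⟧ (con c) A B C = Deg-const 0 (ι c)
Deg-⟦⟧ varq    A B C = A
Deg-⟦⟧ vara    A B C = B
Deg-⟦⟧ varb    A B C = C
Deg-⟦⟧ (p ⊕ r) A B C = Deg-+ (degree p ℕ.+ degree r)
  (Deg-mono (ℕ.m≤m+n (degree p) (degree r)) (Deg-⟦⟧ p A B C)) (Deg-mono (ℕ.m≤n+m (degree r) (degree p)) (Deg-⟦⟧ r A B C))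
Deg-⟦⟧ (p ⊗ r) A B C = Deg-* (degree p) (degree r) (Deg-⟦⟧ p A B C) (Deg-⟦⟧ r A B C)
Deg-⟦⟧ (⊖ p)   A B C = Deg-neg (degree p) (Deg-⟦⟧ p A B C)

-- The values of a may depend on q, and those of b on both, as the points that test coprimality
-- require.
zero-on-dense : ∀ p {Q : ℕ → K} {A : ℕ → ℕ → K} {B : ℕ → ℕ → ℕ → K} →
  Distinct Q → (∀ i → Distinct (A i)) → (∀ i j → Distinct (B i j)) →
  (∀ i j k → ⟦ p ⟧ (Q i) (A i j) (B i j k) ≡ 0#) → ∀ q a b → ⟦ p ⟧ q a b ≡ 0#
zero-on-dense p {Q} {A} {B} dQ dA dB h q a b =
  zero-polynomial (degree p) (Deg-⟦⟧ p Deg-id (const a) (const b)) dQ (λ i _ →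
  zero-polynomial (degree p) (Deg-⟦⟧ p (const (Q i)) Deg-id (const b)) (dA i) (λ j _ →
  zero-polynomial (degree p) (Deg-⟦⟧ p (const (Q i)) (const (A i j)) Deg-id) (dB i j) (λ k _ → h i j k) b) a) q
  where
  const : ∀ x → Deg 1 (λ _ → x)
  const = Deg-const 1

-- The division below eliminates a only; exchanging the variables makes it available for the factor
-- `b - u`.
swap : Poly → Poly
swap (con c) = con c
swap varq    = varq
swap vara    = varb
swap varb    = vara
swap (p ⊕ r) = swap p ⊕ swap r
swap (p ⊗ r) = swap p ⊗ swap r
swap (⊖ p)   = ⊖ swap p

⟦swap⟧ : ∀ p q a b → ⟦ swap p ⟧ q a b ≡ ⟦ p ⟧ q b a
⟦swap⟧ (con c) q a b = refl
⟦swap⟧ varq    q a b = refl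
⟦swap⟧ vara    q a b = refl
⟦swap⟧ varb    q a b = refl
⟦swap⟧ (p ⊕ r) q a b = cong₂ _+_ (⟦swap⟧ p q a b) (⟦swap⟧ r q a b)
⟦swap⟧ (p ⊗ r) q a b = cong₂ _*_ (⟦swap⟧ p q a b) (⟦swap⟧ r q a b)
⟦swap⟧ (⊖ p)   q a b = cong (λ t → - t) (⟦swap⟧ p q a b)

-- Pseudo-division by `α q * a - β q`, by recursion on the syntax: a power of `α` takes the place of
-- inverting the leading coefficient. By `at-root` the remainder depends on `p` only through its
-- value at a root of the divisor, so its vanishing can be tested there.
module Elimination {α β : K → K} (α̂ β̂ : Poly)
  (α̂-value : ∀ q a b → ⟦ α̂ ⟧ q a b ≡ α q) (β̂-value : ∀ q a b → ⟦ β̂ ⟧ q a b ≡ β q) where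

  record Division (p : Poly) : Set where
    field
      exponent           : ℕ
      remainder quotient : Poly
      equation  : ∀ q a b → α q ^ exponent * ⟦ p ⟧ q a b ≡ ⟦ remainder ⟧ q a b + (α q * a - β q) * ⟦ quotient ⟧ q a b
      at-root   : ∀ q a b r → α q * r ≡ β q → ⟦ remainder ⟧ q a b ≡ α q ^ exponent * ⟦ p ⟧ q r b
  open Division

  α^ : ∀ e q a b → ⟦ α̂ ^P e ⟧ q a b ≡ α q ^ e
  α^ e q a b = trans (⟦⟧-^ α̂ e q a b) (cong (_^ e) (α̂-value q a b))

  independent : ∀ p → (∀ q a b r → ⟦ p ⟧ q a b ≡ ⟦ p ⟧ q r b) → Division p
  independent p ind = record
    { exponent  = 0
    ; remainder = p
    ; quotient  = 𝟘
    ; equation  = λ q a b → trans (solve 2 (λ x y → :1 :* x := x :+ y :* :0) refl (⟦ p ⟧ q a b) (α q * a - β q))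
        (cong (λ t → ⟦ p ⟧ q a b + (α q * a - β q) * t) (sym ι-0))
    ; at-root   = λ q a b r _ → trans (ind q a b r) (sym (K.*-identityˡ _))
    }

  divide : ∀ p → Division p
  divide (con c) = independent (con c) (λ _ _ _ _ → refl)
  divide varq    = independent varq (λ _ _ _ _ → refl)
  divide varb    = independent varb (λ _ _ _ _ → refl)
  divide vara    = record
    { exponent  = 1
    ; remainder = β̂
    ; quotient  = 𝟙
    ; equation  = λ q a b → trans (solve 3 (λ x a y → x :* :1 :* a := y :+ (x :* a :- y) :* :1) refl (α q) a (β q))
        (cong₂ (λ s t → s + (α q * a - β q) * t) (sym (β̂-value q a b)) (sym ι-1))
    ; at-root   = λ q a b r h → trans (β̂-value q a b) (trans (sym h) (cong (_* r) (sym (K.*-identityʳ (α q)))))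
    }
  divide (⊖ p) = record
    { exponent  = e
    ; remainder = ⊖ remainder P
    ; quotient  = ⊖ quotient P
    ; equation  = λ q a b → trans (solve 2 (λ x p → x :* (:- p) := :- (x :* p)) refl (α q ^ e) (⟦ p ⟧ q a b))
        (trans (cong (λ t → - t) (equation P q a b))
          (solve 3 (λ r l s → :- (r :+ l :* s) := :- r :+ l :* (:- s)) refl (⟦ remainder P ⟧ q a b) (α q * a - β q) (⟦ quotient P ⟧ q a b)))
    ; at-root   = λ q a b r h → trans (cong (λ t → - t) (at-root P q a b r h))
        (solve 2 (λ x p → :- (x :* p) := x :* (:- p)) refl (α q ^ e) (⟦ p ⟧ q r b))
    }
    where
    P = divide p
    e = exponent P
  divide (p ⊕ r) = record
    { exponent  = e ℕ.+ f
    ; remainder = (α̂ ^P f) ⊗ remainder P ⊕ (α̂ ^P e) ⊗ remainder R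
    ; quotient  = (α̂ ^P f) ⊗ quotient P ⊕ (α̂ ^P e) ⊗ quotient R
    ; equation  = λ q a b → trans (trans (cong (_* (⟦ p ⟧ q a b + ⟦ r ⟧ q a b)) (^-+ (α q) e f))
        (trans (solve 4 (λ x y p r → x :* y :* (p :+ r) := y :* (x :* p) :+ x :* (y :* r)) refl (α q ^ e) (α q ^ f) (⟦ p ⟧ q a b) (⟦ r ⟧ q a b))
        (trans (cong₂ (λ s t → α q ^ f * s + α q ^ e * t) (equation P q a b) (equation R q a b))
        (solve 7 (λ x y l p p′ r r′ → y :* (p :+ l :* p′) :+ x :* (r :+ l :* r′) := y :* p :+ x :* r :+ l :* (y :* p′ :+ x :* r′)) refl
          (α q ^ e) (α q ^ f) (α q * a - β q) (⟦ remainder P ⟧ q a b) (⟦ quotient P ⟧ q a b) (⟦ remainder R ⟧ q a b) (⟦ quotient R ⟧ q a b)))))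
        (cong₂ (λ s t → t * ⟦ remainder P ⟧ q a b + s * ⟦ remainder R ⟧ q a b
                 + (α q * a - β q) * (t * ⟦ quotient P ⟧ q a b + s * ⟦ quotient R ⟧ q a b)) (sym (α^ e q a b)) (sym (α^ f q a b)))
    ; at-root   = λ q a b v h → trans (cong₂ (λ s t → t * ⟦ remainder P ⟧ q a b + s * ⟦ remainder R ⟧ q a b) (α^ e q a b) (α^ f q a b))
        (trans (cong₂ (λ s t → α q ^ f * s + α q ^ e * t) (at-root P q a b v h) (at-root R q a b v h))
        (trans (solve 4 (λ x y p r → y :* (x :* p) :+ x :* (y :* r) := x :* y :* (p :+ r)) refl (α q ^ e) (α q ^ f) (⟦ p ⟧ q v b) (⟦ r ⟧ q v b))
        (cong (_* (⟦ p ⟧ q v b + ⟦ r ⟧ q v b)) (sym (^-+ (α q) e f)))))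
    }
    where
    P = divide p
    R = divide r
    e = exponent P
    f = exponent R
  divide (p ⊗ r) = record
    { exponent  = e ℕ.+ f
    ; remainder = remainder P ⊗ remainder R
    ; quotient  = quotient P ⊗ ((α̂ ^P f) ⊗ r) ⊕ remainder P ⊗ quotient R
    ; equation  = λ q a b → begin
        α q ^ (e ℕ.+ f) * (⟦ p ⟧ q a b * ⟦ r ⟧ q a b)
          ≡⟨ cong (_* (⟦ p ⟧ q a b * ⟦ r ⟧ q a b)) (^-+ (α q) e f) ⟩
        α q ^ e * α q ^ f * (⟦ p ⟧ q a b * ⟦ r ⟧ q a b)
          ≡⟨ solve 4 (λ x y p r → x :* y :* (p :* r) := x :* p :* (y :* r)) refl (α q ^ e) (α q ^ f) (⟦ p ⟧ q a b) (⟦ r ⟧ q a b) ⟩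
        α q ^ e * ⟦ p ⟧ q a b * (α q ^ f * ⟦ r ⟧ q a b)
          ≡⟨ cong (_* (α q ^ f * ⟦ r ⟧ q a b)) (equation P q a b) ⟩
        (⟦ remainder P ⟧ q a b + (α q * a - β q) * ⟦ quotient P ⟧ q a b) * (α q ^ f * ⟦ r ⟧ q a b)
          ≡⟨ solve 4 (λ m l s y → (m :+ l :* s) :* y := m :* y :+ l :* (s :* y)) refl (⟦ remainder P ⟧ q a b) (α q * a - β q) (⟦ quotient P ⟧ q a b) (α q ^ f * ⟦ r ⟧ q a b) ⟩
        ⟦ remainder P ⟧ q a b * (α q ^ f * ⟦ r ⟧ q a b) + (α q * a - β q) * (⟦ quotient P ⟧ q a b * (α q ^ f * ⟦ r ⟧ q a b))
          ≡⟨ cong₂ (λ s t → ⟦ remainder P ⟧ q a b * s + (α q * a - β q) * (⟦ quotient P ⟧ q a b * (t * ⟦ r ⟧ q a b))) (equation R q a b) (sym (α^ f q a b)) ⟩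
        ⟦ remainder P ⟧ q a b * (⟦ remainder R ⟧ q a b + (α q * a - β q) * ⟦ quotient R ⟧ q a b)
          + (α q * a - β q) * (⟦ quotient P ⟧ q a b * (⟦ α̂ ^P f ⟧ q a b * ⟦ r ⟧ q a b))
          ≡⟨ solve 5 (λ m m′ l s t → m :* (m′ :+ l :* s) :+ l :* t := m :* m′ :+ l :* (t :+ m :* s)) refl
               (⟦ remainder P ⟧ q a b) (⟦ remainder R ⟧ q a b) (α q * a - β q) (⟦ quotient R ⟧ q a b) (⟦ quotient P ⟧ q a b * (⟦ α̂ ^P f ⟧ q a b * ⟦ r ⟧ q a b)) ⟩
        ⟦ remainder P ⟧ q a b * ⟦ remainder R ⟧ q a b
          + (α q * a - β q) * (⟦ quotient P ⟧ q a b * (⟦ α̂ ^P f ⟧ q a b * ⟦ r ⟧ q a b) + ⟦ remainder P ⟧ q a b * ⟦ quotient R ⟧ q a b) ∎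
    ; at-root   = λ q a b v h → trans (cong₂ _*_ (at-root P q a b v h) (at-root R q a b v h))
        (trans (solve 4 (λ x y p r → x :* p :* (y :* r) := x :* y :* (p :* r)) refl (α q ^ e) (α q ^ f) (⟦ p ⟧ q v b) (⟦ r ⟧ q v b))
        (cong (_* (⟦ p ⟧ q v b * ⟦ r ⟧ q v b)) (sym (^-+ (α q) e f))))
    }
    where
    P = divide p
    R = divide r
    e = exponent P
    f = exponent R

  factor : ∀ p {Q : ℕ → K} {A : ℕ → ℕ → K} {B : ℕ → ℕ → ℕ → K} →
    Distinct Q → (∀ i → Distinct (A i)) → (∀ i j → Distinct (B i j)) →
    (∀ i j k → Σ K λ r → (α (Q i) * r ≡ β (Q i)) × (⟦ p ⟧ (Q i) r (B i j k) ≡ 0#)) →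
    Σ ℕ λ e → Σ Poly λ s → ∀ q a b → α q ^ e * ⟦ p ⟧ q a b ≡ (α q * a - β q) * ⟦ s ⟧ q a b
  factor p {Q} {A} {B} dQ dA dB h = exponent D , quotient D , λ q a b →
    trans (equation D q a b) (trans (cong (_+ (α q * a - β q) * ⟦ quotient D ⟧ q a b) (zero-on-dense (remainder D) dQ dA dB vanish q a b)) (K.+-identityˡ _))
    where
    D = divide p
    vanish : ∀ i j k → ⟦ remainder D ⟧ (Q i) (A i j) (B i j k) ≡ 0#
    vanish i j k with h i j k
    ... | r , αr≡β , pr≡0 = trans (at-root D (Q i) (A i j) (B i j k) r αr≡β) (trans (cong (α (Q i) ^ exponent D *_) pr≡0) (K.zeroʳ _))

-- Sample points and division by the three linear factors

ι-≢ : ∀ {x y} → x ≢ y → ι x - ι y ≢ 0#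
ι-≢ x≢y h = x≢y (ι-injective (x-y≡0⇒x≡y h))

-- At the points (qᵢ , aⱼ , bₖ) no denominator vanishes.
qᵢ aᵢ bᵢ : ℕ → K
qᵢ i = ι (+ (2 ℕ.+ i))
aᵢ i = ι -[1+ i ]
bᵢ i = ι (+ (2 ℕ.+ i))

qᵢ-distinct : Distinct qᵢ
qᵢ-distinct i<j = ι-≢ (λ e → ℕ.<⇒≢ i<j (sym (ℕ.+-cancelˡ-≡ 2 _ _ (ℤ.+-injective e))))

aᵢ-distinct : Distinct aᵢ
aᵢ-distinct i<j = ι-≢ (λ e → ℕ.<⇒≢ i<j (sym (ℤ.-[1+-injective e)))

ι-^ : ∀ m k → ι (+ m) ^ k ≡ ι (+ (m ℕ.^ k))
ι-^ m zero    = sym ι-1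
ι-^ m (suc k) = trans (cong (ι (+ m) *_) (ι-^ m k)) (trans (sym (ι-* (+ m) (+ (m ℕ.^ k)))) (cong ι (sym (ℤ.pos-* m (m ℕ.^ k)))))

qᵢ^≢1 : ∀ i k → 1# - qᵢ i ^ suc k ≢ 0#
qᵢ^≢1 i k h = ι-≢ {+ 1} {+ (m ℕ.^ suc k)} (λ e → ℕ.<⇒≢ (ℕ.≤-trans (s≤s (s≤s z≤n)) (ℕ.m≤m*n m (m ℕ.^ k) {{ℕ.m^n≢0 m k}})) (ℤ.+-injective e))
  (trans (cong₂ _-_ ι-1 (sym (ι-^ m (suc k)))) h)
  where m = 2 ℕ.+ i

qᵢ≢0 : ∀ i → qᵢ i ≢ 0#
qᵢ≢0 i h = ι-≢ {+ (2 ℕ.+ i)} {+ 0} (λ ()) (x≡y⇒x-y≡0 (trans h (sym ι-0)))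

aᵢ≡ : ∀ j → aᵢ j ≡ - ι (+ suc j)
aᵢ≡ j = ι-neg (+ suc j)

aᵢ-q^≢0 : ∀ i j k → aᵢ j - qᵢ i ^ k ≢ 0#
aᵢ-q^≢0 i j k h = ι-≢ { -[1+ j ]} {+ ((2 ℕ.+ i) ℕ.^ k)} (λ ()) (trans (cong (λ t → aᵢ j - t) (sym (ι-^ (2 ℕ.+ i) k))) h)

-- 1 - a m = 1 + (j + 1) m
1-aᵢ*≢0 : ∀ j m → 1# - aᵢ j * ι (+ m) ≢ 0#
1-aᵢ*≢0 j m h = ι-≢ {+ (1 ℕ.+ suc j ℕ.* m)} {+ 0} (λ ()) (begin
  ι (+ (1 ℕ.+ suc j ℕ.* m)) - ι (+ 0)              ≡⟨ cong₂ _-_ (trans (ι-+ (+ 1) (+ (suc j ℕ.* m))) (cong (λ t → ι (+ 1) + ι t) (ℤ.pos-* (suc j) m))) ι-0 ⟩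
  ι (+ 1) + ι (+ suc j ℤ.* + m) - 0#               ≡⟨ cong₂ (λ x y → x + y - 0#) ι-1 (ι-* (+ suc j) (+ m)) ⟩
  1# + ι (+ suc j) * ι (+ m) - 0#                  ≡⟨ solve 2 (λ x y → :1 :+ x :* y :- :0 := :1 :- (:- x) :* y) refl (ι (+ suc j)) (ι (+ m)) ⟩
  1# - - ι (+ suc j) * ι (+ m)                     ≡⟨ cong (λ t → 1# - t * ι (+ m)) (aᵢ≡ j) ⟨
  1# - aᵢ j * ι (+ m)                              ≡⟨ h ⟩
  0#                                               ∎)

1-aᵢq^≢0 : ∀ i j k → 1# - aᵢ j * qᵢ i ^ k ≢ 0#
1-aᵢq^≢0 i j k h = 1-aᵢ*≢0 j ((2 ℕ.+ i) ℕ.^ k) (trans (cong (λ t → 1# - aᵢ j * t) (sym (ι-^ (2 ℕ.+ i) k))) h)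

-- The factors are divided out in turn; a root of `Z` remains a root of the quotient because the
-- factors already removed do not vanish there. Since `1 - a u` is not monic in a, a power of u is
-- left, which is an admissible denominator.
three-factors : ∀ n Z →
  (∀ i k → ⟦ Z ⟧ (qᵢ i) (qᵢ i ^ suc n) (bᵢ k) ≡ 0#) →
  (∀ i k → ⟦ Z ⟧ (qᵢ i) (inv (qᵢ i ^ suc n)) (bᵢ k) ≡ 0#) →
  (∀ i j → ⟦ Z ⟧ (qᵢ i) (aᵢ j) (qᵢ i ^ suc n) ≡ 0#) →
  Σ ℕ λ e → Σ Poly λ Y → ∀ q a b → let u = q ^ suc n in
    u ^ e * ⟦ Z ⟧ q a b ≡ (1# - a * u) * (a - u) * (b - u) * ⟦ Y ⟧ q a b
three-factors n Z h₁ h₂ h₃ = e , swap (⊖ Y) , λ q a b → let u = q ^ suc n in begin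
  u ^ e * ⟦ Z ⟧ q a b
    ≡⟨ cong (u ^ e *_) (Z≡ q a b) ⟩
  u ^ e * ((a - u) * ⟦ X ⟧ q a b)
    ≡⟨ solve 3 (λ x y z → x :* (y :* z) := y :* (x :* z)) refl (u ^ e) (a - u) (⟦ X ⟧ q a b) ⟩
  (a - u) * (u ^ e * ⟦ X ⟧ q a b)
    ≡⟨ cong ((a - u) *_) (X≡ q a b) ⟩
  (a - u) * ((u * a - 1#) * ⟦ W ⟧ q a b)
    ≡⟨ cong (λ t → (a - u) * ((u * a - 1#) * t)) (W≡ q a b) ⟩
  (a - u) * ((u * a - 1#) * ((b - u) * ⟦ Y ⟧ q b a))
    ≡⟨ cong (λ t → (a - u) * ((u * a - 1#) * ((b - u) * t))) (⟦swap⟧ Y q a b) ⟨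
  (a - u) * ((u * a - 1#) * ((b - u) * ⟦ swap Y ⟧ q a b))
    ≡⟨ solve 4 (λ a u b y → (a :- u) :* ((u :* a :- :1) :* ((b :- u) :* y)) := (:1 :- a :* u) :* (a :- u) :* (b :- u) :* (:- y)) refl a u b (⟦ swap Y ⟧ q a b) ⟩
  (1# - a * u) * (a - u) * (b - u) * ⟦ swap (⊖ Y) ⟧ q a b ∎
  where
  u-value : ∀ q a b → ⟦ varq ^P suc n ⟧ q a b ≡ q ^ suc n
  u-value = ⟦⟧-^ varq (suc n)
  module F₁ = Elimination {λ _ → 1#} {λ q → q ^ suc n} 𝟙 (varq ^P suc n) (λ _ _ _ → ι-1) u-value
  module F₂ = Elimination {λ q → q ^ suc n} {λ _ → 1#} (varq ^P suc n) 𝟙 u-value (λ _ _ _ → ι-1)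

  1^ : ∀ e → 1# ^ e ≡ 1#
  1^ zero    = refl
  1^ (suc e) = trans (K.*-identityˡ _) (1^ e)

  monic : ∀ {p s : Poly} e → (∀ q a b → 1# ^ e * ⟦ p ⟧ q a b ≡ (1# * a - q ^ suc n) * ⟦ s ⟧ q a b) →
    ∀ q a b → ⟦ p ⟧ q a b ≡ (a - q ^ suc n) * ⟦ s ⟧ q a b
  monic {p} {s} e h q a b = begin
    ⟦ p ⟧ q a b                           ≡⟨ K.*-identityˡ _ ⟨
    1# * ⟦ p ⟧ q a b                      ≡⟨ cong (_* ⟦ p ⟧ q a b) (1^ e) ⟨
    1# ^ e * ⟦ p ⟧ q a b                  ≡⟨ h q a b ⟩
    (1# * a - q ^ suc n) * ⟦ s ⟧ q a b    ≡⟨ cong (λ t → (t - q ^ suc n) * ⟦ s ⟧ q a b) (K.*-identityˡ a) ⟩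
    (a - q ^ suc n) * ⟦ s ⟧ q a b         ∎

  step₁ = F₁.factor Z {A = λ _ → aᵢ} {B = λ _ _ → bᵢ} qᵢ-distinct (λ _ → aᵢ-distinct) (λ _ _ → qᵢ-distinct)
    (λ i j k → qᵢ i ^ suc n , K.*-identityˡ _ , h₁ i k)
  X = proj₁ (proj₂ step₁)
  Z≡ : ∀ q a b → ⟦ Z ⟧ q a b ≡ (a - q ^ suc n) * ⟦ X ⟧ q a b
  Z≡ = monic {Z} {X} (proj₁ step₁) (proj₂ (proj₂ step₁))

  X-root : ∀ i k → ⟦ X ⟧ (qᵢ i) (inv (qᵢ i ^ suc n)) (bᵢ k) ≡ 0#
  X-root i k = *-cancel-0 nonzero (trans (sym (Z≡ (qᵢ i) (inv u) (bᵢ k))) (h₂ i k))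
    where
    u = qᵢ i ^ suc n
    -- The factor `a - u` was removed before, so it must not vanish at `a = 1/u`: this is
    -- `u ^ 2 ≢ 1`.
    nonzero : inv u - u ≢ 0#
    nonzero h = qᵢ^≢1 i (n ℕ.+ suc n) (begin
      1# - qᵢ i ^ (suc n ℕ.+ suc n)    ≡⟨ cong₂ _-_ (sym (*-inv (^-nonzero (qᵢ≢0 i) (suc n)))) (^-+ (qᵢ i) (suc n) (suc n)) ⟩
      u * inv u - u * u                ≡⟨ solve 2 (λ u v → u :* v :- u :* u := u :* (v :- u)) refl u (inv u) ⟩
      u * (inv u - u)                  ≡⟨ cong (u *_) h ⟩
      u * 0#                           ≡⟨ K.zeroʳ u ⟩
      0#                               ∎)
  step₂ = F₂.factor X {A = λ _ → aᵢ} {B = λ _ _ → bᵢ} qᵢ-distinct (λ _ → aᵢ-distinct) (λ _ _ → qᵢ-distinct)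
    (λ i j k → inv (qᵢ i ^ suc n) , *-inv (^-nonzero (qᵢ≢0 i) (suc n)) , X-root i k)
  e = proj₁ step₂
  W = proj₁ (proj₂ step₂)
  X≡ : ∀ q a b → (q ^ suc n) ^ e * ⟦ X ⟧ q a b ≡ (q ^ suc n * a - 1#) * ⟦ W ⟧ q a b
  X≡ = proj₂ (proj₂ step₂)

  W-root : ∀ i j → ⟦ W ⟧ (qᵢ i) (aᵢ j) (qᵢ i ^ suc n) ≡ 0#
  W-root i j = *-cancel-0 nonzero (trans (sym (X≡ q a u)) (trans (cong (u ^ e *_) X≡0) (K.zeroʳ _)))
    where
    q = qᵢ i
    a = aᵢ j
    u = q ^ suc n
    X≡0 : ⟦ X ⟧ q a u ≡ 0#
    X≡0 = *-cancel-0 (aᵢ-q^≢0 i j (suc n)) (trans (sym (Z≡ q a u)) (h₃ i j))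
    nonzero : u * a - 1# ≢ 0#
    nonzero h = 1-aᵢq^≢0 i j (suc n) (trans (solve 2 (λ a u → :1 :- a :* u := :- (u :* a :- :1)) refl a u)
      (trans (cong (λ t → - t) h) (solve 0 (:- :0 := :0) refl)))
  step₃ = F₁.factor (swap W) {A = λ _ → bᵢ} {B = λ _ _ → aᵢ} qᵢ-distinct (λ _ → qᵢ-distinct) (λ _ _ → aᵢ-distinct)
    (λ i k j → qᵢ i ^ suc n , K.*-identityˡ _ , trans (⟦swap⟧ W (qᵢ i) (qᵢ i ^ suc n) (aᵢ j)) (W-root i j))
  Y = proj₁ (proj₂ step₃)
  W≡ : ∀ q a b → ⟦ W ⟧ q a b ≡ (b - q ^ suc n) * ⟦ Y ⟧ q b a
  W≡ q a b = trans (sym (⟦swap⟧ W q b a)) (monic {swap W} {Y} (proj₁ step₃) (proj₂ (proj₂ step₃)) q b a)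

-- Coprimality of the admissible denominators to the modulus

good-coprime : ∀ t → (∀ i → 4 ℕ.* suc i ≢ suc (2 ℕ.* t)) → ∀ {D} → Denominator D → CoprimeP D (modulus (suc (2 ℕ.* t)))
good-coprime t n≢ {D} (I , good) e (r , D≈er) (s , P≈es) = e , λ q a b → sym (ι-injective (x-y≡0⇒x≡y (begin
  ι (evalP q a b (e ⊗ e)) - ι (evalP q a b 𝟙)                    ≡⟨ cong₂ _-_ (sym (⟦⟧-ι (e ⊗ e) q a b)) (sym (⟦⟧-ι 𝟙 q a b)) ⟩
  ⟦ e ⊗ e ⊝ 𝟙 ⟧ (ι q) (ι a) (ι b)                                ≡⟨ zero-on-dense (e ⊗ e ⊝ 𝟙) {λ i → ι (X.q i)} {λ i j → ι (X.a i j)} {λ i j k → ι (X.b i j k)}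
                                                                     (λ i<j → ι-≢ (λ h → ℕ.<⇒≢ i<j (sym (X.q-injective h))))
                                                                     (λ i j<k → ι-≢ (λ h → ℕ.<⇒≢ j<k (sym (X.a-injective i h))))
                                                                     (λ i j k<l → ι-≢ (λ h → ℕ.<⇒≢ k<l (sym (X.b-injective i j h))))
                                                                     (λ i j k → vanish (X.q i) (X.a i j) (X.b i j k) (Bézout.good⊥modulus {I} {t} (X.point i j k) n≢ good))
                                                                     (ι q) (ι a) (ι b) ⟩
  0#                                                            ∎)))
  where
  n = suc (2 ℕ.* t)
  module X = Bézout.DensePoints (Bézout.dense-points I t)
  open Bézout using (_⊥_; bézout)
  square : ∀ {x y} → x ℤ.* y ≡ + 1 → x ℤ.* x ≡ + 1
  square {x} {y} h with ℕ.m*n≡1⇒m≡1 ℤ.∣ x ∣ ℤ.∣ y ∣ (trans (sym (ℤ.abs-* x y)) (cong ℤ.∣_∣ h))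
  square {+ 1}      _ | refl = refl
  square { -[1+ 0 ]} _ | refl = refl
  vanish : ∀ q a b → evalP q a b D ⊥ evalP q a b (modulus n) → ⟦ e ⊗ e ⊝ 𝟙 ⟧ (ι q) (ι a) (ι b) ≡ 0#
  vanish q a b (bézout σ τ h) = trans (⟦⟧-ι (e ⊗ e ⊝ 𝟙) q a b) (trans (cong (λ t → ι (t ℤ.- + 1)) (square {x} {σ ℤ.* y ℤ.+ τ ℤ.* z} (begin
    x ℤ.* (σ ℤ.* y ℤ.+ τ ℤ.* z)                ≡⟨ ℤ.*-distribˡ-+ x (σ ℤ.* y) (τ ℤ.* z) ⟩
    x ℤ.* (σ ℤ.* y) ℤ.+ x ℤ.* (τ ℤ.* z)        ≡⟨ cong₂ ℤ._+_ (exchange σ y) (exchange τ z) ⟩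
    σ ℤ.* (x ℤ.* y) ℤ.+ τ ℤ.* (x ℤ.* z)        ≡⟨ cong₂ (λ u v → σ ℤ.* u ℤ.+ τ ℤ.* v) (D≈er q a b) (P≈es q a b) ⟨
    σ ℤ.* evalP q a b D ℤ.+ τ ℤ.* evalP q a b (modulus n)    ≡⟨ h ⟩
    + 1                                        ∎))) ι-0)
    where
    x = evalP q a b e
    y = evalP q a b r
    z = evalP q a b s
    exchange : ∀ u v → x ℤ.* (u ℤ.* v) ≡ u ℤ.* (x ℤ.* v)
    exchange u v = trans (sym (ℤ.*-assoc x u v)) (trans (cong (ℤ._* v) (ℤ.*-comm x u)) (ℤ.*-assoc u x v))

^-^ : ∀ x m i → (x ^ m) ^ i ≡ (x ^ i) ^ m
^-^ x m i = trans (sym (^-* x i m)) (trans (cong (x ^_) (ℕ.*-comm i m)) (^-* x m i))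

/-^ : ∀ {x y} → y ≢ 0# → ∀ k → (x / y) ^ k * y ^ k ≡ x ^ k
/-^ y≢0 zero    = K.*-identityˡ 1#
/-^ {x} {y} y≢0 (suc k) = trans (solve 4 (λ d e y f → d :* e :* (y :* f) := d :* y :* (e :* f)) refl (x / y) ((x / y) ^ k) y (y ^ k))
  (cong₂ _*_ (/-* y≢0) (/-^ y≢0 k))

1-/ : ∀ {x} y z → x ≢ 0# → x * (1# - y / x * z) ≡ x - y * z
1-/ {x} y z x≢0 = trans (solve 4 (λ x y i z → x :* (:1 :- y :* i :* z) := x :- y :* z :* (x :* i)) refl x y (inv x) z)
  (trans (cong (λ t → x - y * z * t) (*-inv x≢0)) (solve 3 (λ x y z → x :- y :* z :* :1 := x :- y :* z) refl x y z))

-- Values of fractions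

module Value (q a b : K) where
  infix 4 _⇓_
  -- A relation rather than an evaluation function, so that the non-vanishing of the syntactic
  -- denominator is carried along with the value.
  record _⇓_ (x : Frac) (v : K) : Set where
    constructor _,,_
    field
      den≢0 : ⟦ den x ⟧ q a b ≢ 0#
      value : ⟦ num x ⟧ q a b ≡ v * ⟦ den x ⟧ q a b
  open _⇓_ public

  ⇓-resp : ∀ {x v w} → v ≡ w → x ⇓ v → x ⇓ w
  ⇓-resp refl h = h

  ⇓-poly : ∀ p → ↑ p ⇓ ⟦ p ⟧ q a b
  ⇓-poly p = (λ h → 1≢0 (trans (sym ι-1) h)) ,, sym (trans (cong (⟦ p ⟧ q a b *_) ι-1) (K.*-identityʳ _))

  ⇓-1 : 1F ⇓ 1#
  ⇓-1 = ⇓-resp ι-1 (⇓-poly 𝟙)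

  ⇓-* : ∀ {x y v w} → x ⇓ v → y ⇓ w → (x *F y) ⇓ v * w
  ⇓-* {v = v} {w} (d ,, e) (d′ ,, e′) = *-nonzero d d′ ,, trans (cong₂ _*_ e e′)
    (solve 4 (λ v x w y → v :* x :* (w :* y) := v :* w :* (x :* y)) refl v _ w _)

  ⇓-+ : ∀ {x y v w} → x ⇓ v → y ⇓ w → (x +F y) ⇓ v + w
  ⇓-+ {x} {y} {v} {w} (d ,, e) (d′ ,, e′) = *-nonzero d d′ ,, trans (cong₂ (λ s t → s * ⟦ den y ⟧ q a b + t * ⟦ den x ⟧ q a b) e e′)
    (solve 4 (λ v x w y → v :* x :* y :+ w :* y :* x := (v :+ w) :* (x :* y)) refl v (⟦ den x ⟧ q a b) w (⟦ den y ⟧ q a b))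

  ⇓-- : ∀ {x y v w} → x ⇓ v → y ⇓ w → (x -F y) ⇓ v - w
  ⇓-- {x} {y} {v} {w} (d ,, e) (d′ ,, e′) = *-nonzero d d′ ,, trans (cong₂ (λ s t → s * ⟦ den y ⟧ q a b - t * ⟦ den x ⟧ q a b) e e′)
    (solve 4 (λ v x w y → v :* x :* y :- w :* y :* x := (v :- w) :* (x :* y)) refl v (⟦ den x ⟧ q a b) w (⟦ den y ⟧ q a b))

  ⇓-/ : ∀ {x y v w} → x ⇓ v → y ⇓ w → w ≢ 0# → (x /F y) ⇓ v / w
  ⇓-/ {x} {y} {v} {w} (d ,, e) (d′ ,, e′) w≢0 = *-nonzero d (λ h → *-nonzero w≢0 d′ (trans (sym e′) h)) ,, (begin
    ⟦ num x ⟧ q a b * Y              ≡⟨ cong (_* Y) e ⟩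
    v * X * Y                        ≡⟨ solve 3 (λ v x y → v :* x :* y := v :* :1 :* (x :* y)) refl v X Y ⟩
    v * 1# * (X * Y)                 ≡⟨ cong (λ t → v * t * (X * Y)) (*-inv w≢0) ⟨
    v * (w * inv w) * (X * Y)        ≡⟨ solve 5 (λ v w i x y → v :* (w :* i) :* (x :* y) := v :* i :* (x :* (w :* y))) refl v w (inv w) X Y ⟩
    v / w * (X * (w * Y))            ≡⟨ cong (λ t → v / w * (X * t)) e′ ⟨
    v / w * (X * ⟦ num y ⟧ q a b)    ∎)
    where
    X = ⟦ den x ⟧ q a b
    Y = ⟦ den y ⟧ q a b

  ⇓-^ : ∀ {x v} → x ⇓ v → ∀ k → (x ^F k) ⇓ v ^ k
  ⇓-^ h zero    = ⇓-1
  ⇓-^ h (suc k) = ⇓-* h (⇓-^ h k)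

  ⇓-poch : ∀ {x p v w} → x ⇓ v → p ⇓ w → ∀ k → poch x p k ⇓ ∏ k (λ i → 1# - v * w ^ i)
  ⇓-poch h h′ zero    = ⇓-1
  ⇓-poch h h′ (suc k) = ⇓-* (⇓-poch h h′ k) (⇓-- ⇓-1 (⇓-* h (⇓-^ h′ k)))

  ⇓-sum : ∀ {f v} → (∀ k → f k ⇓ v k) → ∀ n → sumF n f ⇓ ∑ n v
  ⇓-sum h zero    = ⇓-resp ι-0 (⇓-poly 𝟘)
  ⇓-sum h (suc n) = ⇓-+ (⇓-sum h n) (h n)

  ⇓-Q : Q ⇓ q
  ⇓-Q = ⇓-poly varq

  ⇓-A : A ⇓ a
  ⇓-A = ⇓-poly vara

  ⇓-B : B ⇓ b
  ⇓-B = ⇓-poly varb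

  -- The left-hand side at a point

  module LeftSide (ω : Ω q a b) (a≢0 : a ≢ 0#) (b≢0 : b ≢ 0#) where
    open Ω ω
    open Series q a
    open Terminating generic

    qint-⟦⟧ : ∀ n → (1# - q) * ⟦ qint n ⟧ q a b ≡ 1# - q ^ n
    qint-⟦⟧ zero    = trans (cong ((1# - q) *_) ι-0) (solve 1 (λ q → (:1 :- q) :* :0 := :1 :- :1) refl q)
    qint-⟦⟧ (suc n) = trans (K.distribˡ (1# - q) _ _) (trans (cong₂ (λ s t → s + (1# - q) * t) (qint-⟦⟧ n) (⟦⟧-^ varq n q a b))
      (solve 2 (λ q x → :1 :- x :+ (:1 :- q) :* x := :1 :- q :* x) refl q (q ^ n)))

    c : K
    c = b ^ 3

    c≢0 : c ≢ 0#
    c≢0 = ^-nonzero b≢0 3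

    T₁ T₂ T₃ T₄ B₁ B₂ B₃ B₄ top bottom : ℕ → K
    T₁ k = ∏ k (λ i → 1# - q * (q ^ 2) ^ i)
    T₂ k = ∏ k (λ i → 1# - a * q * (q ^ 2) ^ i)
    T₃ k = ∏ k (λ i → 1# - q / a * (q ^ 2) ^ i)
    T₄ k = ∏ k (λ i → 1# - q / c * (q ^ 4) ^ i)
    B₁ k = ∏ k (λ i → 1# - q ^ 4 * (q ^ 4) ^ i)
    B₂ k = ∏ k (λ i → 1# - q ^ 4 / a * (q ^ 4) ^ i)
    B₃ k = ∏ k (λ i → 1# - a * q ^ 4 * (q ^ 4) ^ i)
    B₄ k = ∏ k (λ i → 1# - c * q ^ 2 * (q ^ 2) ^ i)
    top k = T₁ k * T₂ k * T₃ k * T₄ k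
    bottom k = B₁ k * B₂ k * B₃ k * B₄ k

    bottom-factors : ∀ i → a * ((1# - q ^ 4 * (q ^ 4) ^ i) * (1# - q ^ 4 / a * (q ^ 4) ^ i) * (1# - a * q ^ 4 * (q ^ 4) ^ i) * (1# - c * q ^ 2 * (q ^ 2) ^ i))
      ≡ M c (q ^ i)
    bottom-factors i = begin
      a * ((1# - q ^ 4 * w) * (1# - q ^ 4 / a * w) * (1# - a * q ^ 4 * w) * (1# - c * q ^ 2 * (q ^ 2) ^ i))
        ≡⟨ solve 5 (λ a x y z w → a :* (x :* y :* z :* w) := x :* (a :* y) :* z :* w) refl a (1# - q ^ 4 * w) (1# - q ^ 4 / a * w) (1# - a * q ^ 4 * w) (1# - c * q ^ 2 * (q ^ 2) ^ i) ⟩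
      (1# - q ^ 4 * w) * (a * (1# - q ^ 4 / a * w)) * (1# - a * q ^ 4 * w) * (1# - c * q ^ 2 * (q ^ 2) ^ i)
        ≡⟨ cong (λ t → (1# - q ^ 4 * w) * t * (1# - a * q ^ 4 * w) * (1# - c * q ^ 2 * (q ^ 2) ^ i)) (1-/ (q ^ 4) w a≢0) ⟩
      (1# - q ^ 4 * w) * (a - q ^ 4 * w) * (1# - a * q ^ 4 * w) * (1# - c * q ^ 2 * (q ^ 2) ^ i)
        ≡⟨ cong₂ (λ s t → (1# - q ^ 4 * s) * (a - q ^ 4 * s) * (1# - a * q ^ 4 * s) * (1# - c * q ^ 2 * t)) (^-^ q 4 i) (^-^ q 2 i) ⟩
      (1# - q ^ 4 * z ^ 4) * (a - q ^ 4 * z ^ 4) * (1# - a * q ^ 4 * z ^ 4) * (1# - c * q ^ 2 * z ^ 2)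
        ≡⟨ cong₂ (λ s t → (1# - q ^ 4 * z ^ 4) * (a - q ^ 4 * z ^ 4) * (1# - s) * (1# - t)) (K.*-assoc _ _ _) (K.*-assoc _ _ _) ⟩
      M c z ∎
      where
      z = q ^ i
      w = (q ^ 4) ^ i

    top-factors : ∀ i → a * ((1# - q * (q ^ 2) ^ i) * (1# - a * q * (q ^ 2) ^ i) * (1# - q / a * (q ^ 2) ^ i) * (1# - q / c * (q ^ 4) ^ i)) * (q ^ 2 * (q ^ i) ^ 2 * c)
      ≡ N c (q ^ i)
    top-factors i = begin
      a * ((1# - q * w) * (1# - a * q * w) * (1# - q / a * w) * (1# - q / c * (q ^ 4) ^ i)) * (q ^ 2 * z ^ 2 * c)
        ≡⟨ solve 7 (λ a c x y s t u → a :* (x :* y :* s :* t) :* (u :* c) := x :* y :* (a :* s) :* u :* (c :* t)) refl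
             a c (1# - q * w) (1# - a * q * w) (1# - q / a * w) (1# - q / c * (q ^ 4) ^ i) (q ^ 2 * z ^ 2) ⟩
      (1# - q * w) * (1# - a * q * w) * (a * (1# - q / a * w)) * (q ^ 2 * z ^ 2) * (c * (1# - q / c * (q ^ 4) ^ i))
        ≡⟨ cong₂ (λ s t → (1# - q * w) * (1# - a * q * w) * s * (q ^ 2 * z ^ 2) * t) (1-/ q w a≢0) (1-/ q ((q ^ 4) ^ i) c≢0) ⟩
      (1# - q * w) * (1# - a * q * w) * (a - q * w) * (q ^ 2 * z ^ 2) * (c - q * (q ^ 4) ^ i)
        ≡⟨ cong₂ (λ s t → (1# - q * s) * (1# - a * q * s) * (a - q * s) * (q ^ 2 * z ^ 2) * (c - q * t)) (^-^ q 2 i) (^-^ q 4 i) ⟩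
      (1# - q * z ^ 2) * (1# - a * q * z ^ 2) * (a - q * z ^ 2) * (q ^ 2 * z ^ 2) * (c - q * z ^ 4)
        ≡⟨ cong (λ s → (1# - q * z ^ 2) * (1# - s) * (a - q * z ^ 2) * (q ^ 2 * z ^ 2) * (c - q * z ^ 4)) (K.*-assoc _ _ _) ⟩
      N c z ∎
      where
      z = q ^ i
      w = (q ^ 2) ^ i

    M-nonzero : ∀ i → M c (q ^ i) ≢ 0#
    M-nonzero i = *-nonzero (μ≢0 i) (1-b³q≢0 i)

    bottom-suc : ∀ k → a * bottom (suc k) ≡ bottom k * M c (q ^ k)
    bottom-suc k = trans
      (solve 9 (λ a s t u v w x y z → a :* (s :* w :* (t :* x) :* (u :* y) :* (v :* z)) := s :* t :* u :* v :* (a :* (w :* x :* y :* z))) refl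
        a (B₁ k) (B₂ k) (B₃ k) (B₄ k) _ _ _ _)
      (cong (bottom k *_) (bottom-factors k))

    bottom≢0 : ∀ k → bottom k ≢ 0#
    bottom≢0 zero    = *-nonzero (*-nonzero (*-nonzero 1≢0 1≢0) 1≢0) 1≢0
    bottom≢0 (suc k) = *-nonzeroʳ (λ h → *-nonzero (bottom≢0 k) (M-nonzero k) (trans (sym (bottom-suc k)) h))

    -- Both sides have the same ratio of consecutive terms. The powers of q and b grow by q^(2k+2)
    -- b³; the first factor is part of `ν`, and b³ = c clears the q/b³ in the last numerator.
    P-bottom : ∀ k → P c k * bottom k ≡ top k * (q ^ (k ℕ.* k ℕ.+ k) * b ^ (3 ℕ.* k))
    P-bottom zero    = solve 0 (:1 :* (:1 :* :1 :* :1 :* :1) := :1 :* :1 :* :1 :* :1 :* (:1 :* :1)) refl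
    P-bottom (suc k) = *-cancel a≢0 (begin
      a * (P c (suc k) * bottom (suc k))
        ≡⟨ solve 3 (λ a p b → a :* (p :* b) := p :* (a :* b)) refl a (P c (suc k)) (bottom (suc k)) ⟩
      P c (suc k) * (a * bottom (suc k))
        ≡⟨ cong (P c (suc k) *_) (bottom-suc k) ⟩
      P c k * (N c z / M c z) * (bottom k * M c z)
        ≡⟨ solve 4 (λ p f b m → p :* f :* (b :* m) := p :* b :* (f :* m)) refl (P c k) (N c z / M c z) (bottom k) (M c z) ⟩
      P c k * bottom k * (N c z / M c z * M c z)
        ≡⟨ cong₂ _*_ (P-bottom k) (/-* (M-nonzero k)) ⟩
      top k * (x * y) * N c z
        ≡⟨ cong (top k * (x * y) *_) (top-factors k) ⟨
      top k * (x * y) * (a * (_ * _ * _ * _) * (q ^ 2 * z ^ 2 * c))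
        ≡⟨ solve 14 (λ a s t u v w₁ w₂ w₃ w₄ x y q z b →
             s :* t :* u :* v :* (x :* y) :* (a :* (w₁ :* w₂ :* w₃ :* w₄) :* (q :^ 2 :* z :^ 2 :* b :^ 3))
             := a :* (s :* w₁ :* (t :* w₂) :* (u :* w₃) :* (v :* w₄) :* (x :* (q :* q :* z :* z) :* (b :^ 3 :* y)))) refl
             a (T₁ k) (T₂ k) (T₃ k) (T₄ k) _ _ _ _ x y q z b ⟩
      a * (top (suc k) * (x * (q * q * z * z) * (c * y)))
        ≡⟨ cong₂ (λ s t → a * (top (suc k) * (s * t))) (begin
             x * (q * q * z * z)                      ≡⟨ solve 3 (λ x q z → x :* (q :* q :* z :* z) := q :* z :* (x :* (q :* z))) refl x q z ⟩
             q ^ suc k * (x * q ^ suc k)              ≡⟨ cong (q ^ suc k *_) (^-+ q (k ℕ.* k ℕ.+ k) (suc k)) ⟨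
             q ^ suc k * q ^ (k ℕ.* k ℕ.+ k ℕ.+ suc k)    ≡⟨ ^-+ q (suc k) _ ⟨
             q ^ (suc k ℕ.+ (k ℕ.* k ℕ.+ k ℕ.+ suc k))    ≡⟨ cong (q ^_) (trans (sym (ℕ.+-assoc (suc k) _ (suc k))) (cong (ℕ._+ suc k) (cong (suc k ℕ.+_) (trans (ℕ.+-comm (k ℕ.* k) k) (sym (ℕ.*-suc k k)))))) ⟩
             q ^ (suc k ℕ.* suc k ℕ.+ suc k)          ∎)
           (trans (sym (^-+ b 3 (3 ℕ.* k))) (cong (b ^_) (sym (ℕ.*-suc 3 k)))) ⟩
      a * (top (suc k) * (q ^ (suc k ℕ.* suc k ℕ.+ suc k) * b ^ (3 ℕ.* suc k))) ∎)
      where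
      z = q ^ k
      x = q ^ (k ℕ.* k ℕ.+ k)
      y = b ^ (3 ℕ.* k)

    [_] : ℕ → K
    [ n ] = ⟦ qint n ⟧ q a b

    lhsTerm-⇓ : ∀ k → lhsTerm k ⇓ [ 6 ℕ.* k ℕ.+ 1 ] * P c k
    lhsTerm-⇓ k = ⇓-resp (begin
      [ 6 ℕ.* k ℕ.+ 1 ] * top k / bottom k * x * y      ≡⟨ solve 5 (λ f t i x y → f :* t :* i :* x :* y := f :* (t :* (x :* y) :* i)) refl [ 6 ℕ.* k ℕ.+ 1 ] (top k) (inv (bottom k)) x y ⟩
      [ 6 ℕ.* k ℕ.+ 1 ] * (top k * (x * y) / bottom k)  ≡⟨ cong ([ 6 ℕ.* k ℕ.+ 1 ] *_) (≡-/ (bottom≢0 k) (P-bottom k)) ⟨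
      [ 6 ℕ.* k ℕ.+ 1 ] * P c k                         ∎)
      (⇓-* (⇓-* (⇓-/ (⇓-* (⇓-poly (qint (6 ℕ.* k ℕ.+ 1)))
        (⇓-* (⇓-* (⇓-* (⇓-poch ⇓-Q (⇓-^ ⇓-Q 2) k) (⇓-poch (⇓-* ⇓-A ⇓-Q) (⇓-^ ⇓-Q 2) k)) (⇓-poch (⇓-/ ⇓-Q ⇓-A a≢0) (⇓-^ ⇓-Q 2) k))
          (⇓-poch (⇓-/ ⇓-Q (⇓-^ ⇓-B 3) c≢0) (⇓-^ ⇓-Q 4) k)))
        (⇓-* (⇓-* (⇓-* (⇓-poch (⇓-^ ⇓-Q 4) (⇓-^ ⇓-Q 4) k) (⇓-poch (⇓-/ (⇓-^ ⇓-Q 4) ⇓-A a≢0) (⇓-^ ⇓-Q 4) k))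
          (⇓-poch (⇓-* ⇓-A (⇓-^ ⇓-Q 4)) (⇓-^ ⇓-Q 4) k)) (⇓-poch (⇓-* (⇓-^ ⇓-B 3) (⇓-^ ⇓-Q 2)) (⇓-^ ⇓-Q 2) k)) (bottom≢0 k))
        (⇓-^ ⇓-Q (k ℕ.* k ℕ.+ k))) (⇓-^ ⇓-B (3 ℕ.* k)))
      where
      x = q ^ (k ℕ.* k ℕ.+ k)
      y = b ^ (3 ℕ.* k)

    lhs : ℕ → K
    lhs n = ∑ n (λ k → [ 6 ℕ.* k ℕ.+ 1 ] * P c k)

    LHS-⇓ : ∀ n → LHS n ⇓ lhs n
    LHS-⇓ = ⇓-sum lhsTerm-⇓

    lhs-S : ∀ n → (1# - q) * lhs n ≡ S c n
    lhs-S n = trans (∑-distribˡ n (1# - q)) (∑-cong n (λ k _ → trans (sym (K.*-assoc _ _ _)) (cong (_* P c k) (begin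
      (1# - q) * [ 6 ℕ.* k ℕ.+ 1 ]    ≡⟨ qint-⟦⟧ (6 ℕ.* k ℕ.+ 1) ⟩
      1# - q ^ (6 ℕ.* k ℕ.+ 1)        ≡⟨ cong (λ t → 1# - q ^ t) (ℕ.+-comm (6 ℕ.* k) 1) ⟩
      1# - q * q ^ (6 ℕ.* k)          ≡⟨ cong (λ t → 1# - q * t) (^-* q 6 k) ⟩
      g (q ^ k)                       ∎))))

-- The difference of the two sides, divided by [n]

unit-resp : ∀ {f g} → (∀ q a b → f q a b ≡ g q a b) → Unit f → Unit g
unit-resp e (unit d n v) = unit d (λ ω h → n ω (trans (e _ _ _) h)) (λ ω → trans (v ω) (e _ _ _))

-- Throughout n = 3 + 4 m, written as suc (2 t) with t = suc (2 m), and r = (3 n - 1) / 4.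
module Residue (m : ℕ) where
  t n r : ℕ
  t = suc (2 ℕ.* m)
  n = suc (2 ℕ.* t)
  r = suc m ℕ.+ suc (2 ℕ.* m)

  n≡ : n ≡ 3 ℕ.+ m ℕ.* 4
  n≡ = begin
    suc (2 ℕ.* suc (2 ℕ.* m))     ≡⟨ cong suc (ℕ.*-suc 2 (2 ℕ.* m)) ⟩
    3 ℕ.+ 2 ℕ.* (2 ℕ.* m)         ≡⟨ cong (3 ℕ.+_) (trans (sym (ℕ.*-assoc 2 2 m)) (ℕ.*-comm 4 m)) ⟩
    3 ℕ.+ m ℕ.* 4                 ∎

  r<n : r ℕ.< n
  r<n = s≤s (ℕ.≤-trans (ℕ.+-monoˡ-≤ (suc (2 ℕ.* m)) (s≤s (ℕ.m≤m+n m (m ℕ.+ 0)))) (ℕ.≤-reflexive (cong (t ℕ.+_) (sym (ℕ.+-identityʳ t)))))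

  4i≢n : ∀ i → 4 ℕ.* suc i ≢ n
  4i≢n i h = ℕ.even≢odd (2 ℕ.* suc i) t (trans (sym (ℕ.*-assoc 2 2 (suc i))) h)

  q^n : ∀ q → q ^ n ≡ q ^ 3 * (q ^ m) ^ 4
  q^n q = trans (cong (q ^_) n≡) (trans (^-+ q 3 (m ℕ.* 4)) (cong (λ t → q ^ 3 * t) (trans (cong (q ^_) (ℕ.*-comm m 4)) (^-* q 4 m))))

  q^r : ∀ q → q * (q ^ r) ^ 4 ≡ (q ^ n) ^ 3
  q^r q = begin
    q * (q ^ r) ^ 4                             ≡⟨ cong (λ x → q * x ^ 4) (trans (^-+ q (suc m) t) (cong (λ x → q ^ suc m * (q * x)) (^-* q 2 m))) ⟩
    q * (q * y * (q * y ^ 2)) ^ 4               ≡⟨ solve 2 (λ q y → q :* (q :* y :* (q :* y :^ 2)) :^ 4 := (q :^ 3 :* y :^ 4) :^ 3) refl q y ⟩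
    (q ^ 3 * y ^ 4) ^ 3                         ≡⟨ cong (_^ 3) (q^n q) ⟨
    (q ^ n) ^ 3                                 ∎
    where y = q ^ m

  E C β : Function
  E q a b = (a - b) * (1# - a * b)
  C q a b = (b - q ^ n) * (a * b - 1# - a ^ 2 + a * q ^ n)
  β q a b = (1# - a * q ^ n) * (a - q ^ n)

  -- The right-hand side is a Chinese remainder formula: `C / E` is 0 modulo `b - u` and 1 modulo
  -- `(1 - a u)(a - u)`, and `β / E` is the reverse. Their sum is 1 by this identity.
  E-C≡β : ∀ q a b → E q a b ≡ C q a b + β q a b
  E-C≡β q a b = solve 3 (λ a b u → (a :- b) :* (:1 :- a :* b) := (b :- u) :* (a :* b :- :1 :- a :^ 2 :+ a :* u) :+ (:1 :- a :* u) :* (a :- u)) refl a b (q ^ n)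

  Num Den : Function
  Num q _ b = ∏ (suc m) (λ i → b ^ 3 - (q ^ i) ^ 4)
  Den q _ b = ∏ (suc m) (λ i → 1# - b ^ 3 * (q ^ 2 * (q ^ i) ^ 4))

  -- Each of the three pieces has been divided by `1 - u`. Their combination is kept multiplied by
  -- `E`, which avoids dividing by `a - b` at points where it may vanish.
  ρ₁ ρ₂ S/[n] remainder : Function
  ρ₁ q a b = - Num q a b * inv (q ^ m * Den q a b)
  -- The factor of `R r` at index `m` contains `1 - q ^ 3 * W = 1 - u`; it is left out here, and the
  -- product is split around it.
  ρ₂ q a b = (1# - q) * (∏ m f * ((1# - q ^ 5 * W) * a / L W) * ∏ (suc (2 ℕ.* m)) (λ i → f (suc m ℕ.+ i)))
    where
    open Series q a
    W = (q ^ m) ^ 4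
    f : ℕ → K
    f i = Λ ((q ^ i) ^ 4) / L ((q ^ i) ^ 4)
  S/[n] q a b = inv (∏ (2 ℕ.* t) (λ i → 1# - b ^ 3 * (q ^ 2 * (q ^ i) ^ 2)))
    * ∑ n (λ j → weight j (2 ℕ.* t ℕ.∸ j) q a b * ∏-except (2 ℕ.* t) j (λ i → b ^ 3 - q * (q ^ i) ^ 4))
  remainder q a b = E q a b * S/[n] q a b - C q a b * ρ₁ q a b - β q a b * ρ₂ q a b

  module _ {q a b : K} (ω : Ω q a b) where
    open Ω ω
    open Series q a
    open Terminating generic using (L≢0; evaluation)
    open Interpolated generic using (expansion; c_; module Second)
    open Second m using (evaluation₂)
    private
      u = q ^ n
      c = b ^ 3

    1-b³q⁴≢0 : ∀ i → 1# - c * (q ^ 2 * (q ^ i) ^ 4) ≢ 0#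
    1-b³q⁴≢0 i h = 1-b³q≢0 (i ℕ.+ i) (trans (cong (λ t → 1# - c * (q ^ 2 * t)) (trans (cong (_^ 2) (^-+ q i i))
      (solve 1 (λ x → (x :* x) :^ 2 := x :^ 4) refl (q ^ i)))) h)

    yB≢0 : q ^ m * Den q a b ≢ 0#
    yB≢0 = *-nonzero (^-nonzero q≢0 m) (∏-nonzero (suc m) 1-b³q⁴≢0)

    S≡ : S c n ≡ (1# - u) * S/[n] q a b
    S≡ = *-cancel D≢0 (begin
      D * S c n                                   ≡⟨ K.*-comm _ _ ⟩
      S c n * D                                   ≡⟨ expansion (2 ℕ.* t) 1-b³q≢0 ⟩
      ∑ n (λ j → _ * _)                           ≡⟨ ∑-cong n (λ j j<n → trans (cong (_* e j) (weight≡ j (ℕ.s≤s⁻¹ j<n))) (K.*-assoc _ _ _)) ⟩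
      ∑ n (λ j → (1# - u) * (w j * e j))          ≡⟨ ∑-distribˡ n (1# - u) ⟨
      (1# - u) * ∑ n (λ j → w j * e j)            ≡⟨ solve 2 (λ u s → u :* s := :1 :* (u :* s)) refl (1# - u) (∑ n (λ j → w j * e j)) ⟩
      1# * ((1# - u) * ∑ n (λ j → w j * e j))     ≡⟨ cong (_* ((1# - u) * ∑ n (λ j → w j * e j))) (*-inv D≢0) ⟨
      D * inv D * ((1# - u) * ∑ n (λ j → w j * e j))    ≡⟨ solve 4 (λ d i u s → d :* i :* (u :* s) := d :* (u :* (i :* s))) refl D (inv D) (1# - u) (∑ n (λ j → w j * e j)) ⟩
      D * ((1# - u) * S/[n] q a b)                ∎)
      where
      D = ∏ (2 ℕ.* t) (λ i → 1# - c * (q ^ 2 * (q ^ i) ^ 2))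
      D≢0 : D ≢ 0#
      D≢0 = ∏-nonzero (2 ℕ.* t) 1-b³q≢0
      w e : ℕ → K
      w j = weight j (2 ℕ.* t ℕ.∸ j) q a b
      e j = ∏-except (2 ℕ.* t) j (λ i → c - c_ i)
      weight≡ : ∀ j → j ℕ.≤ 2 ℕ.* t → (1# - q) * R j * Interpolated.E generic (2 ℕ.* t) (c_ j) / ∏-except (2 ℕ.* t) j (λ i → c_ j - c_ i) ≡ (1# - u) * w j
      weight≡ j j≤ = subst (λ k → (1# - q) * R j * Interpolated.E generic k (c_ j) / ∏-except k j (λ i → c_ j - c_ i) ≡ (1# - q ^ suc k) * w j)
        (ℕ.m+[n∸m]≡n j≤) (weight-correct {b = b} generic j (2 ℕ.* t ℕ.∸ j))

    ρ₁≡ : q ^ m * Den q a b * ((1# - u) * ρ₁ q a b) ≡ (u - 1#) * Num q a b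
    ρ₁≡ = trans (solve 4 (λ d u a i → d :* ((:1 :- u) :* ((:- a) :* i)) := d :* i :* ((u :- :1) :* a)) refl (q ^ m * Den q a b) u (Num q a b) (inv (q ^ m * Den q a b)))
      (trans (cong (_* ((u - 1#) * Num q a b)) (*-inv yB≢0)) (K.*-identityˡ _))

    ρ₂≡ : (1# - q) * R r ≡ (1# - u) * ρ₂ q a b
    ρ₂≡ = begin
      (1# - q) * R r
        ≡⟨ cong ((1# - q) *_) (∏-split (suc m) (suc (2 ℕ.* m)) f) ⟩
      (1# - q) * (∏ m f * ((1# - q ^ 3 * W) * (1# - q ^ 5 * W) * a / L W) * X)
        ≡⟨ solve 7 (λ q f x y a i X → (:1 :- q) :* (f :* (x :* y :* a :* i) :* X) := x :* ((:1 :- q) :* (f :* (y :* a :* i) :* X))) refl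
             q (∏ m f) (1# - q ^ 3 * W) (1# - q ^ 5 * W) a (inv (L W)) X ⟩
      (1# - q ^ 3 * W) * ρ₂ q a b
        ≡⟨ cong (λ t → (1# - t) * ρ₂ q a b) (q^n q) ⟨
      (1# - u) * ρ₂ q a b ∎
      where
      W = (q ^ m) ^ 4
      f : ℕ → K
      f i = Λ ((q ^ i) ^ 4) / L ((q ^ i) ^ 4)
      X = ∏ (suc (2 ℕ.* m)) (λ i → f (suc m ℕ.+ i))

    remainder≡ : (1# - u) * remainder q a b ≡ E q a b * S c n - C q a b * ((1# - u) * ρ₁ q a b) - β q a b * ((1# - q) * R r)
    remainder≡ = trans (solve 7 (λ u e s c x d y → (:1 :- u) :* (e :* s :- c :* x :- d :* y) := e :* ((:1 :- u) :* s) :- c :* ((:1 :- u) :* x) :- d :* ((:1 :- u) :* y)) refl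
        u (E q a b) (S/[n] q a b) (C q a b) (ρ₁ q a b) (β q a b) (ρ₂ q a b))
      (cong₂ (λ x y → E q a b * x - C q a b * ((1# - u) * ρ₁ q a b) - β q a b * y) (sym S≡) (sym ρ₂≡))

    -- Where `β` vanishes, `E` and `C` agree, so that only `S c n ≡ (1 - u) ρ₁` is needed, which
    -- `evaluation₂` provides.
    vanishes-at-a : β q a b ≡ 0# → remainder q a b ≡ 0#
    vanishes-at-a β≡0 = *-cancel-0 (1-q^≢0 (2 ℕ.* t)) (begin
      (1# - u) * remainder q a b
        ≡⟨ remainder≡ ⟩
      E q a b * S c n - C q a b * ((1# - u) * ρ₁ q a b) - β q a b * ((1# - q) * R r)
        ≡⟨ cong₂ (λ x y → x * S c n - C q a b * y - β q a b * ((1# - q) * R r)) (E-C≡β q a b) (sym S≡ρ₁) ⟩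
      (C q a b + β q a b) * S c n - C q a b * S c n - β q a b * ((1# - q) * R r)
        ≡⟨ cong (λ x → (C q a b + x) * S c n - C q a b * S c n - x * ((1# - q) * R r)) β≡0 ⟩
      (C q a b + 0#) * S c n - C q a b * S c n - 0# * ((1# - q) * R r)
        ≡⟨ solve 3 (λ c s x → (c :+ :0) :* s :- c :* s :- :0 :* x := :0) refl (C q a b) (S c n) ((1# - q) * R r) ⟩
      0# ∎)
      where
      root : (a - q ^ 3 * (q ^ m) ^ 4) * (1# - a * (q ^ 3 * (q ^ m) ^ 4)) ≡ 0#
      root = trans (cong (λ x → (a - x) * (1# - a * x)) (sym (q^n q))) (trans (K.*-comm _ _) β≡0)
      S≡ρ₁ : S c n ≡ (1# - u) * ρ₁ q a b
      S≡ρ₁ = *-cancel yB≢0 (trans (subst (λ k → q ^ m * Den q a b * S c (suc k) ≡ (q ^ 3 * (q ^ m) ^ 4 - 1#) * Num q a b) (cong (t ℕ.+_) (sym (ℕ.+-identityʳ t)))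
        (evaluation₂ root 1-b³q≢0)) (trans (cong (λ x → (x - 1#) * Num q a b) (sym (q^n q))) (sym ρ₁≡)))

    -- Here `C` vanishes and `E` equals `β`; moreover 4 r + 1 = 3 n makes `b ^ 3` the node of index
    -- `r`.
    vanishes-at-b : b ≡ u → remainder q a b ≡ 0#
    vanishes-at-b b≡u = *-cancel-0 (1-q^≢0 (2 ℕ.* t)) (begin
      (1# - u) * remainder q a b
        ≡⟨ remainder≡ ⟩
      E q a b * S c n - C q a b * x - β q a b * ((1# - q) * R r)
        ≡⟨ cong₂ (λ x′ y → x′ * y - C q a b * x - β q a b * ((1# - q) * R r)) (E-C≡β q a b)
             (trans (cong (λ z → S z n) (trans (cong (_^ 3) b≡u) (sym (q^r q)))) (evaluation r n r<n)) ⟩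
      (C q a b + β q a b) * s - C q a b * x - β q a b * s
        ≡⟨ cong (λ d → (d * k + β q a b) * s - d * k * x - β q a b * s) (x≡y⇒x-y≡0 b≡u) ⟩
      (0# * k + β q a b) * s - 0# * k * x - β q a b * s
        ≡⟨ solve 4 (λ k d s x → (:0 :* k :+ d) :* s :- :0 :* k :* x :- d :* s := :0) refl k (β q a b) s x ⟩
      0# ∎)
      where
      x = (1# - u) * ρ₁ q a b
      k = a * b - 1# - a ^ 2 + a * u
      s = (1# - q) * R r

  abstract
    local-remainder : Local remainder
    local-remainder = local-- (local-- (local-* (local-* (local-- local-a local-b) (local-- local-1 (local-* local-a local-b))) local-S)
        (local-* (local-* (local-- local-b local-u) (local-+ (local-- (local-- (local-* local-a local-b) local-1) (local-^ local-a 2)) (local-* local-a local-u))) local-ρ₁))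
      (local-* (local-* (local-- local-1 (local-* local-a local-u)) (local-- local-a local-u)) local-ρ₂)
      where
      local-u : Local (λ q _ _ → q ^ n)
      local-u = local-^ local-q n
      local-S : Local S/[n]
      local-S = local-* (local-inv (unit-∏ (2 ℕ.* t) unit-1-b³q)) (local-∑ n (λ j _ → local-* (local-weight j (2 ℕ.* t ℕ.∸ j))
        (local-* (local-∏ j (λ i → factor i)) (local-∏ (2 ℕ.* t ℕ.∸ j) (λ i → factor (suc j ℕ.+ i))))))
        where
        factor : ∀ i → Local (λ q _ b → b ^ 3 - q * (q ^ i) ^ 4)
        factor i = local-- (local-^ local-b 3) (local-* local-q (local-^ (local-^ local-q i) 4))
      local-ρ₁ : Local ρ₁
      local-ρ₁ = local-* (local-neg (local-∏ (suc m) (λ i → local-- (local-^ local-b 3) (local-^ (local-^ local-q i) 4))))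
        (local-inv (unit-* (unit-^ unit-q m) (unit-∏ (suc m) (λ i → unit-resp (λ q a b → cong (λ x → 1# - b ^ 3 * (q ^ 2 * x))
          (trans (cong (_^ 2) (^-+ q i i)) (solve 1 (λ x → (x :* x) :^ 2 := x :^ 4) refl (q ^ i)))) (unit-1-b³q (i ℕ.+ i))))))
      local-1-q : ∀ k i → Local (λ q _ _ → 1# - q ^ k * (q ^ i) ^ 4)
      local-1-q k i = local-- local-1 (local-* (local-^ local-q k) (local-^ (local-^ local-q i) 4))
      local-1/L : ∀ i → Local (λ q a _ → inv (Series.L q a ((q ^ i) ^ 4)))
      local-1/L i = local-inv (unit-* (unit-1-aq i) (unit-a-q i))
      local-f : ∀ i → Local (λ q a _ → Series.Λ q a ((q ^ i) ^ 4) / Series.L q a ((q ^ i) ^ 4))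
      local-f i = local-* (local-* (local-* (local-1-q 3 i) (local-1-q 5 i)) local-a) (local-1/L i)
      local-ρ₂ : Local ρ₂
      local-ρ₂ = local-* (local-- local-1 local-q) (local-* (local-* (local-∏ m local-f)
        (local-* (local-* (local-1-q 5 m) local-a) (local-1/L m))) (local-∏ (suc (2 ℕ.* m)) (λ i → local-f (suc m ℕ.+ i))))

-- Non-vanishing of the denominators at the sample points

q^k≢q^l : ∀ {q} → q ≢ 0# → (∀ i → 1# - q ^ suc i ≢ 0#) → ∀ {k l} → k ℕ.< l → q ^ k - q ^ l ≢ 0#
q^k≢q^l {q} q≢0 1-q^≢0 {k} {l} k<l h = *-nonzero (^-nonzero q≢0 k) (1-q^≢0 d) (begin
  q ^ k * (1# - q ^ suc d)        ≡⟨ solve 2 (λ x y → x :* (:1 :- y) := x :- x :* y) refl (q ^ k) (q ^ suc d) ⟩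
  q ^ k - q ^ k * q ^ suc d       ≡⟨ cong (λ x → q ^ k - x) (^-+ q k (suc d)) ⟨
  q ^ k - q ^ (k ℕ.+ suc d)       ≡⟨ cong (λ e → q ^ k - q ^ e) (trans (ℕ.+-suc k d) (ℕ.m+[n∸m]≡n k<l)) ⟩
  q ^ k - q ^ l                   ≡⟨ h ⟩
  0#                              ∎)
  where d = l ℕ.∸ suc k

q⁴q^4≡ : ∀ q i → q ^ 4 * (q ^ i) ^ 4 ≡ q ^ (4 ℕ.* suc i)
q⁴q^4≡ q i = trans (cong (q ^ 4 *_) (sym (^-* q 4 i))) (trans (sym (^-+ q 4 (4 ℕ.* i))) (cong (q ^_) (sym (ℕ.*-suc 4 i))))

module Region (i : ℕ) where
  q : K
  q = qᵢ i

  q≢0 : q ≢ 0#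
  q≢0 = qᵢ≢0 i

  -- b³ q² q²ʲ ≥ b > 1
  1-bᵢq≢0 : ∀ k j → 1# - bᵢ k ^ 3 * (q ^ 2 * (q ^ j) ^ 2) ≢ 0#
  1-bᵢq≢0 k j h = ι-≢ {+ 1} {+ (x ℕ.^ 3 ℕ.* y)} (λ e → absurd (ℤ.+-injective e)) (begin
    ι (+ 1) - ι (+ (x ℕ.^ 3 ℕ.* y))                ≡⟨ cong₂ _-_ ι-1 (trans (cong ι (ℤ.pos-* (x ℕ.^ 3) y)) (ι-* (+ (x ℕ.^ 3)) (+ y))) ⟩
    1# - ι (+ (x ℕ.^ 3)) * ι (+ y)                 ≡⟨ cong₂ (λ s t → 1# - s * t) (ι-^ x 3) (ι-^ (2 ℕ.+ i) (2 ℕ.+ 2 ℕ.* j)) ⟨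
    1# - bᵢ k ^ 3 * q ^ (2 ℕ.+ 2 ℕ.* j)            ≡⟨ cong (λ t → 1# - bᵢ k ^ 3 * t) (trans (^-+ q 2 (2 ℕ.* j)) (cong (q ^ 2 *_) (^-* q 2 j))) ⟩
    1# - bᵢ k ^ 3 * (q ^ 2 * (q ^ j) ^ 2)          ≡⟨ h ⟩
    0#                                             ∎)
    where
    x y : ℕ
    x = 2 ℕ.+ k
    y = (2 ℕ.+ i) ℕ.^ (2 ℕ.+ 2 ℕ.* j)
    absurd : ¬ 1 ≡ x ℕ.^ 3 ℕ.* y
    absurd e with ℕ.m*n≡1⇒m≡1 x (x ℕ.* (x ℕ.* 1)) (ℕ.m*n≡1⇒m≡1 (x ℕ.^ 3) y (sym e))
    ... | ()

  1-q^bq≢0 : ∀ k j → 1# - (q ^ suc k) ^ 3 * (q ^ 2 * (q ^ j) ^ 2) ≢ 0#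
  1-q^bq≢0 k j h = qᵢ^≢1 i (k ℕ.+ 2 ℕ.* suc k ℕ.+ (2 ℕ.+ 2 ℕ.* j)) (trans (cong (λ t → 1# - t) (trans (^-+ q (3 ℕ.* suc k) (2 ℕ.+ 2 ℕ.* j))
    (cong₂ _*_ (^-* q 3 (suc k)) (trans (^-+ q 2 (2 ℕ.* j)) (cong (q ^ 2 *_) (^-* q 2 j)))))) h)

  generic-integer : ∀ j → Generic q (aᵢ j)
  generic-integer j = record
    { q≢0    = q≢0
    ; 1-q^≢0 = qᵢ^≢1 i
    ; 1-aq≢0 = λ k h → 1-aᵢq^≢0 i j (4 ℕ.* suc k) (trans (cong (λ t → 1# - aᵢ j * t) (sym (q⁴q^4≡ q k))) h)
    ; a-q≢0  = λ k h → aᵢ-q^≢0 i j (4 ℕ.* suc k) (trans (cong (λ t → aᵢ j - t) (sym (q⁴q^4≡ q k))) h)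
    }

  -- At `a = u` the denominator `a - q ^ (4 i)`, and at `a = 1/u` the denominator `1 - a q ^ (4 i)`,
  -- vanish exactly if `q ^ (4 i) = u`; the hypothesis excludes this.
  module _ (n : ℕ) (4i≢ : ∀ i → 4 ℕ.* suc i ≢ suc n) where
    private
      u = q ^ suc n

    u≢0 : u ≢ 0#
    u≢0 = ^-nonzero q≢0 (suc n)

    u-q≢0 : ∀ k → u - q ^ 4 * (q ^ k) ^ 4 ≢ 0#
    u-q≢0 k h with ℕ.<-cmp (suc n) (4 ℕ.* suc k)
    ... | tri< lt _ _ = q^k≢q^l q≢0 (qᵢ^≢1 i) lt (trans (cong (λ t → u - t) (sym (q⁴q^4≡ q k))) h)
    ... | tri≈ _ eq _ = 4i≢ k (sym eq)
    ... | tri> _ _ gt = q^k≢q^l q≢0 (qᵢ^≢1 i) gt (begin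
      q ^ (4 ℕ.* suc k) - u          ≡⟨ cong (_- u) (q⁴q^4≡ q k) ⟨
      q ^ 4 * (q ^ k) ^ 4 - u        ≡⟨ solve 2 (λ x y → x :- y := :- (y :- x)) refl (q ^ 4 * (q ^ k) ^ 4) u ⟩
      - (u - q ^ 4 * (q ^ k) ^ 4)    ≡⟨ cong (λ t → - t) h ⟩
      - 0#                           ≡⟨ solve 0 (:- :0 := :0) refl ⟩
      0#                             ∎)

    1-uq≢0 : ∀ k → 1# - u * (q ^ 4 * (q ^ k) ^ 4) ≢ 0#
    1-uq≢0 k h = qᵢ^≢1 i (n ℕ.+ 4 ℕ.* suc k) (trans (cong (λ t → 1# - t) (trans (^-+ q (suc n) (4 ℕ.* suc k)) (cong (u *_) (sym (q⁴q^4≡ q k))))) h)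

    generic-u : Generic q u
    generic-u = record { q≢0 = q≢0 ; 1-q^≢0 = qᵢ^≢1 i ; 1-aq≢0 = 1-uq≢0 ; a-q≢0 = u-q≢0 }

    generic-1/u : Generic q (inv u)
    generic-1/u = record
      { q≢0    = q≢0
      ; 1-q^≢0 = qᵢ^≢1 i
      ; 1-aq≢0 = λ k h → u-q≢0 k (begin
          u - X k                 ≡⟨ solve 2 (λ u x → u :- x := u :- :1 :* x) refl u (X k) ⟩
          u - 1# * X k            ≡⟨ cong (λ s → u - s * X k) (*-inv u≢0) ⟨
          u - u * inv u * X k     ≡⟨ solve 3 (λ u v x → u :- u :* v :* x := u :* (:1 :- v :* x)) refl u (inv u) (X k) ⟩
          u * (1# - inv u * X k)  ≡⟨ cong (u *_) h ⟩
          u * 0#                  ≡⟨ K.zeroʳ u ⟩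
          0#                      ∎)
      ; a-q≢0  = λ k h → 1-uq≢0 k (begin
          1# - u * X k            ≡⟨ cong (_- u * X k) (*-inv u≢0) ⟨
          u * inv u - u * X k     ≡⟨ solve 3 (λ u v x → u :* v :- u :* x := u :* (v :- x)) refl u (inv u) (X k) ⟩
          u * (inv u - X k)       ≡⟨ cong (u *_) h ⟩
          u * 0#                  ≡⟨ K.zeroʳ u ⟩
          0#                      ∎)
      }
      where
      X : ℕ → K
      X k = q ^ 4 * (q ^ k) ^ 4

-- The right-hand side at a point

module RightSide (m : ℕ) {q a b : K} (ω : Ω q a b) (a≢0 : a ≢ 0#) (b≢0 : b ≢ 0#) (a-b≢0 : a - b ≢ 0#) (1-ab≢0 : 1# - a * b ≢ 0#) where
  open Ω ω
  open Series q a
  open Terminating generic using (L≢0)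
  open Interpolated generic using (c_; module Second)
  open Second m using (at-first-node)
  open Residue m
  open Value q a b
  private
    c u : K
    c = b ^ 3
    u = q ^ n

  c≢0 : c ≢ 0#
  c≢0 = ^-nonzero b≢0 3

  E≢0 : E q a b ≢ 0#
  E≢0 = *-nonzero a-b≢0 1-ab≢0

  T₁ T₂ B₁ B₂ T₃ B₃ B₄ : ℕ → K
  T₁ k = ∏ k (λ i → 1# - q ^ 3 * (q ^ 4) ^ i)
  T₂ k = ∏ k (λ i → 1# - 1# / c * (q ^ 4) ^ i)
  B₁ k = ∏ k (λ i → 1# - 1# / q * (q ^ 4) ^ i)
  B₂ k = ∏ k (λ i → 1# - c * q ^ 2 * (q ^ 4) ^ i)
  T₃ k = ∏ k (λ i → 1# - q ^ 5 * (q ^ 4) ^ i)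
  B₃ k = ∏ k (λ i → 1# - a * q ^ 4 * (q ^ 4) ^ i)
  B₄ k = ∏ k (λ i → 1# - q ^ 4 / a * (q ^ 4) ^ i)

  q-q⁴ⁱ≢0 : ∀ i → q - (q ^ 4) ^ i ≢ 0#
  q-q⁴ⁱ≢0 zero    h = 1-q^≢0 0 (begin
    1# - q * 1#    ≡⟨ solve 1 (λ q → :1 :- q :* :1 := :- (q :- :1)) refl q ⟩
    - (q - 1#)     ≡⟨ cong (λ t → - t) h ⟩
    - 0#           ≡⟨ solve 0 (:- :0 := :0) refl ⟩
    0#             ∎)
  q-q⁴ⁱ≢0 (suc i) h = q^k≢q^l q≢0 1-q^≢0 {1} {suc i ℕ.* 4} (s≤s (s≤s z≤n)) (trans (cong₂ _-_ (K.*-identityʳ q) (^-* q (suc i) 4)) h)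

  B₁≢0 : ∀ k → B₁ k ≢ 0#
  B₁≢0 k = ∏-nonzero k (λ i → *-nonzeroʳ {q} (λ h → q-q⁴ⁱ≢0 i (begin
    q - (q ^ 4) ^ i                        ≡⟨ solve 2 (λ x y → x :- y := x :- :1 :* y) refl q ((q ^ 4) ^ i) ⟩
    q - 1# * (q ^ 4) ^ i                   ≡⟨ 1-/ 1# ((q ^ 4) ^ i) q≢0 ⟨
    q * (1# - 1# / q * (q ^ 4) ^ i)     ≡⟨ h ⟩
    0#                                     ∎)))

  B₂-factor : ∀ i → 1# - c * q ^ 2 * (q ^ 4) ^ i ≡ 1# - c * (q ^ 2 * (q ^ i) ^ 4)
  B₂-factor i = cong (λ t → 1# - t) (trans (K.*-assoc _ _ _) (cong (λ t → c * (q ^ 2 * t)) (^-^ q 4 i)))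

  B₂≢0 : ∀ k → B₂ k ≢ 0#
  B₂≢0 k = ∏-nonzero k (λ i h → 1-b³q⁴≢0 ω i (trans (sym (B₂-factor i)) h))

  B₃B₄-factor : ∀ i → a * ((1# - a * q ^ 4 * (q ^ 4) ^ i) * (1# - q ^ 4 / a * (q ^ 4) ^ i)) ≡ L ((q ^ i) ^ 4)
  B₃B₄-factor i = begin
    a * ((1# - a * q ^ 4 * (q ^ 4) ^ i) * (1# - q ^ 4 / a * (q ^ 4) ^ i))
      ≡⟨ solve 3 (λ a x y → a :* (x :* y) := x :* (a :* y)) refl a (1# - a * q ^ 4 * (q ^ 4) ^ i) (1# - q ^ 4 / a * (q ^ 4) ^ i) ⟩
    (1# - a * q ^ 4 * (q ^ 4) ^ i) * (a * (1# - q ^ 4 / a * (q ^ 4) ^ i))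
      ≡⟨ cong₂ (λ s t → (1# - s) * t) (K.*-assoc _ _ _) (1-/ (q ^ 4) ((q ^ 4) ^ i) a≢0) ⟩
    (1# - a * (q ^ 4 * (q ^ 4) ^ i)) * (a - q ^ 4 * (q ^ 4) ^ i)
      ≡⟨ cong (λ t → (1# - a * (q ^ 4 * t)) * (a - q ^ 4 * t)) (^-^ q 4 i) ⟩
    L ((q ^ i) ^ 4) ∎

  B₃B₄≢0 : ∀ k → B₃ k * B₄ k ≢ 0#
  B₃B₄≢0 k h = ∏-nonzero k {λ i → (1# - a * q ^ 4 * (q ^ 4) ^ i) * (1# - q ^ 4 / a * (q ^ 4) ^ i)}
    (λ i → *-nonzeroʳ (λ e → L≢0 i (trans (sym (B₃B₄-factor i)) e))) (trans (∏-distrib k) h)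

  first second : ℕ → K
  first k = C q a b / E q a b * (T₁ k * T₂ k) / (B₁ k * B₂ k) * (c / q) ^ k
  second k = β q a b / E q a b * (T₁ k * T₃ k) / (B₃ k * B₄ k)

  RHS-⇓ : RHS n ⇓ first ((n ℕ.+ 1) ℕ./ 4) + second ((3 ℕ.* n ℕ.∸ 1) ℕ./ 4)
  RHS-⇓ = ⇓-+
    (⇓-* (⇓-/ (⇓-* (⇓-/ (⇓-* (⇓-- ⇓-B ⇓-q^n) (⇓-+ (⇓-- (⇓-- (⇓-* ⇓-A ⇓-B) ⇓-1) (⇓-^ ⇓-A 2)) (⇓-* ⇓-A ⇓-q^n))) ⇓-E E≢0)
      (⇓-* (⇓-poch (⇓-^ ⇓-Q 3) ⇓-q⁴ k) (⇓-poch (⇓-/ ⇓-1 (⇓-^ ⇓-B 3) c≢0) ⇓-q⁴ k)))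
      (⇓-* (⇓-poch (⇓-/ ⇓-1 ⇓-Q q≢0) ⇓-q⁴ k) (⇓-poch (⇓-* (⇓-^ ⇓-B 3) (⇓-^ ⇓-Q 2)) ⇓-q⁴ k)) (*-nonzero (B₁≢0 k) (B₂≢0 k)))
      (⇓-^ (⇓-/ (⇓-^ ⇓-B 3) ⇓-Q q≢0) k))
    (⇓-/ (⇓-* (⇓-/ (⇓-* (⇓-- ⇓-1 (⇓-* ⇓-A ⇓-q^n)) (⇓-- ⇓-A ⇓-q^n)) ⇓-E E≢0)
      (⇓-* (⇓-poch (⇓-^ ⇓-Q 3) ⇓-q⁴ l) (⇓-poch (⇓-^ ⇓-Q 5) ⇓-q⁴ l)))
      (⇓-* (⇓-poch (⇓-* ⇓-A ⇓-q⁴) ⇓-q⁴ l) (⇓-poch (⇓-/ ⇓-q⁴ ⇓-A a≢0) ⇓-q⁴ l)) (B₃B₄≢0 l))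
    where
    k = (n ℕ.+ 1) ℕ./ 4
    l = (3 ℕ.* n ℕ.∸ 1) ℕ./ 4
    ⇓-q⁴ = ⇓-^ ⇓-Q 4
    ⇓-q^n = ⇓-^ ⇓-Q n
    ⇓-E = ⇓-* (⇓-- ⇓-A ⇓-B) (⇓-- ⇓-1 (⇓-* ⇓-A ⇓-B))

  k≡ : (n ℕ.+ 1) ℕ./ 4 ≡ suc m
  k≡ = begin
    (n ℕ.+ 1) ℕ./ 4          ≡⟨ cong (ℕ._/ 4) (trans (ℕ.+-comm n 1) (cong suc n≡)) ⟩
    (suc m ℕ.* 4) ℕ./ 4      ≡⟨ m*n/n≡m (suc m) 4 ⟩
    suc m                  ∎

  l≡ : (3 ℕ.* n ℕ.∸ 1) ℕ./ 4 ≡ r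
  l≡ = begin
    (3 ℕ.* n ℕ.∸ 1) ℕ./ 4               ≡⟨ cong (λ t → (3 ℕ.* t ℕ.∸ 1) ℕ./ 4) n≡ ⟩
    (3 ℕ.* (3 ℕ.+ m ℕ.* 4) ℕ.∸ 1) ℕ./ 4 ≡⟨ cong (λ t → (t ℕ.∸ 1) ℕ./ 4) (ℕ.*-distribˡ-+ 3 3 (m ℕ.* 4)) ⟩
    (8 ℕ.+ 3 ℕ.* (m ℕ.* 4)) ℕ./ 4       ≡⟨ cong (λ t → (8 ℕ.+ t) ℕ./ 4) (sym (ℕ.*-assoc 3 m 4)) ⟩
    ((2 ℕ.+ 3 ℕ.* m) ℕ.* 4) ℕ./ 4       ≡⟨ m*n/n≡m (2 ℕ.+ 3 ℕ.* m) 4 ⟩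
    2 ℕ.+ 3 ℕ.* m                     ≡⟨ cong suc (ℕ.+-suc m (2 ℕ.* m)) ⟨
    r                                 ∎

  E*C/E : ∀ x → E q a b * (x * inv (E q a b)) ≡ x
  E*C/E x = trans (solve 3 (λ e x i → e :* (x :* i) := x :* (e :* i)) refl (E q a b) x (inv (E q a b))) (trans (cong (x *_) (*-inv E≢0)) (K.*-identityʳ x))

  -- (q³;q⁴)ₘ₊₁ / (1/q;q⁴)ₘ₊₁ = q (qⁿ - 1) / (1 - q), where the exponent of q comes from clearing 1/q.
  T₁/B₁ : (1# - q) * q ^ m * T₁ (suc m) ≡ (u - 1#) * (B₁ (suc m) * q ^ suc m)
  T₁/B₁ = begin
    (1# - q) * y * T₁ (suc m)
      ≡⟨ cong₂ (λ s t → s * y * t) (sym (K.*-identityʳ (1# - q))) (∏-cong (suc m) (λ i → trans (cong (λ t → 1# - q ^ 3 * t) (^-^ q 4 i))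
           (solve 2 (λ q z → :1 :- q :^ 3 :* z :^ 4 := :1 :- q :* :1 :^ 4 :* (q :^ 2 :* z :^ 4)) refl q (q ^ i)))) ⟩
    (1# - q) * 1# * y * ∏ (suc m) (λ i → 1# - c_ 0 * (q ^ 2 * (q ^ i) ^ 4))
      ≡⟨ at-first-node ⟩
    (q ^ 3 * y ^ 4 - 1#) * ∏ (suc m) (λ i → c_ 0 - (q ^ i) ^ 4)
      ≡⟨ cong₂ (λ s t → (s - 1#) * t) (sym (q^n q)) (∏-cong (suc m) (λ i → begin
           q * 1# ^ 4 - (q ^ i) ^ 4                 ≡⟨ cong₂ _-_ (solve 1 (λ q → q :* :1 :^ 4 := q) refl q) (^-^ q i 4) ⟩
           q - (q ^ 4) ^ i                          ≡⟨ solve 2 (λ q x → q :- x := q :- :1 :* x) refl q ((q ^ 4) ^ i) ⟩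
           q - 1# * (q ^ 4) ^ i                     ≡⟨ 1-/ 1# ((q ^ 4) ^ i) q≢0 ⟨
           q * (1# - 1# / q * (q ^ 4) ^ i)       ∎)) ⟩
    (u - 1#) * ∏ (suc m) (λ i → q * (1# - 1# / q * (q ^ 4) ^ i))
      ≡⟨ cong ((u - 1#) *_) (trans (∏-scale (suc m) q) (K.*-comm _ _)) ⟩
    (u - 1#) * (B₁ (suc m) * q ^ suc m) ∎
    where y = q ^ m

  T₂≡ : T₂ (suc m) * c ^ suc m ≡ Num q a b
  T₂≡ = trans (K.*-comm _ _) (trans (sym (∏-scale (suc m) c)) (∏-cong (suc m) (λ i → begin
    c * (1# - 1# / c * (q ^ 4) ^ i)    ≡⟨ 1-/ 1# ((q ^ 4) ^ i) c≢0 ⟩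
    c - 1# * (q ^ 4) ^ i                  ≡⟨ cong (λ t → c - t) (trans (K.*-identityˡ _) (^-^ q 4 i)) ⟩
    c - (q ^ i) ^ 4                       ∎)))

  -- The power of c/q is shared out: c^(m+1) turns (1/c;q⁴) into the polynomial `Num`, and q^(m+1)
  -- cancels against the power of q in `T₁/B₁`.
  first≡ : (1# - q) * (E q a b * first (suc m)) ≡ C q a b * ((1# - u) * ρ₁ q a b)
  first≡ = *-cancel (*-nonzero (yB≢0 ω) (^-nonzero q≢0 (suc m))) (begin
    y * D * Q′ * ((1# - q) * (E q a b * (C q a b / E q a b * (t₁ * t₂) * inv (b₁ * b₂) * (c / q) ^ suc m)))
      ≡⟨ solve 11 (λ y D Q o e c/e t₁ t₂ i f b → y :* D :* Q :* (o :* (e :* (c/e :* (t₁ :* t₂) :* i :* f)))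
           := (e :* c/e) :* (o :* y :* t₁) :* (t₂ :* (f :* Q)) :* (D :* i)) refl y D Q′ (1# - q) (E q a b) (C q a b / E q a b) t₁ t₂ (inv (b₁ * b₂)) ((c / q) ^ suc m) b ⟩
    E q a b * (C q a b / E q a b) * ((1# - q) * y * t₁) * (t₂ * ((c / q) ^ suc m * Q′)) * (D * inv (b₁ * b₂))
      ≡⟨ cong₂ (λ s t → s * ((1# - q) * y * t₁) * (t₂ * t) * (D * inv (b₁ * b₂))) (E*C/E (C q a b)) (/-^ q≢0 (suc m)) ⟩
    C q a b * ((1# - q) * y * t₁) * (t₂ * c ^ suc m) * (D * inv (b₁ * b₂))
      ≡⟨ cong₂ (λ s t → C q a b * s * t * (D * inv (b₁ * b₂))) T₁/B₁ T₂≡ ⟩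
    C q a b * ((u - 1#) * (b₁ * Q′)) * Num q a b * (D * inv (b₁ * b₂))
      ≡⟨ cong (λ s → C q a b * ((u - 1#) * (b₁ * Q′)) * Num q a b * (s * inv (b₁ * b₂))) (∏-cong (suc m) B₂-factor) ⟨
    C q a b * ((u - 1#) * (b₁ * Q′)) * Num q a b * (b₂ * inv (b₁ * b₂))
      ≡⟨ solve 7 (λ c u b₁ Q n b₂ i → c :* (u :* (b₁ :* Q)) :* n :* (b₂ :* i) := (b₁ :* b₂ :* i) :* (Q :* (c :* (u :* n)))) refl (C q a b) (u - 1#) b₁ Q′ (Num q a b) b₂ (inv (b₁ * b₂)) ⟩
    b₁ * b₂ * inv (b₁ * b₂) * (Q′ * (C q a b * ((u - 1#) * Num q a b)))
      ≡⟨ cong₂ (λ s t → s * (Q′ * (C q a b * t))) (*-inv (*-nonzero (B₁≢0 (suc m)) (B₂≢0 (suc m)))) (sym (ρ₁≡ ω)) ⟩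
    1# * (Q′ * (C q a b * (y * D * ((1# - u) * ρ₁ q a b))))
      ≡⟨ solve 4 (λ Q c d r → :1 :* (Q :* (c :* (d :* r))) := d :* Q :* (c :* r)) refl Q′ (C q a b) (y * D) ((1# - u) * ρ₁ q a b) ⟩
    y * D * Q′ * (C q a b * ((1# - u) * ρ₁ q a b)) ∎)
    where
    y = q ^ m
    D = Den q a b
    t₁ = T₁ (suc m)
    t₂ = T₂ (suc m)
    b₁ = B₁ (suc m)
    b₂ = B₂ (suc m)
    Q′ = q ^ suc m

  R≡ : ∀ k → R k * (B₃ k * B₄ k) ≡ T₁ k * T₃ k
  R≡ k = begin
    R k * (B₃ k * B₄ k)
      ≡⟨ cong (R k *_) (∏-distrib k) ⟨
    R k * ∏ k (λ i → (1# - a * q ^ 4 * (q ^ 4) ^ i) * (1# - q ^ 4 / a * (q ^ 4) ^ i))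
      ≡⟨ ∏-distrib k ⟨
    ∏ k (λ i → Λ ((q ^ i) ^ 4) / L ((q ^ i) ^ 4) * ((1# - a * q ^ 4 * (q ^ 4) ^ i) * (1# - q ^ 4 / a * (q ^ 4) ^ i)))
      ≡⟨ ∏-cong k factor ⟩
    ∏ k (λ i → (1# - q ^ 3 * (q ^ 4) ^ i) * (1# - q ^ 5 * (q ^ 4) ^ i))
      ≡⟨ ∏-distrib k ⟩
    T₁ k * T₃ k ∎
    where
    factor : ∀ i → Λ ((q ^ i) ^ 4) / L ((q ^ i) ^ 4) * ((1# - a * q ^ 4 * (q ^ 4) ^ i) * (1# - q ^ 4 / a * (q ^ 4) ^ i))
      ≡ (1# - q ^ 3 * (q ^ 4) ^ i) * (1# - q ^ 5 * (q ^ 4) ^ i)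
    factor i = *-cancel a≢0 (begin
      a * (Λ W / L W * X)                                      ≡⟨ solve 3 (λ a f x → a :* (f :* x) := f :* (a :* x)) refl a (Λ W / L W) X ⟩
      Λ W / L W * (a * X)                                      ≡⟨ cong (Λ W / L W *_) (B₃B₄-factor i) ⟩
      Λ W / L W * L W                                          ≡⟨ /-* (L≢0 i) ⟩
      (1# - q ^ 3 * W) * (1# - q ^ 5 * W) * a                     ≡⟨ K.*-comm _ a ⟩
      a * ((1# - q ^ 3 * W) * (1# - q ^ 5 * W))                   ≡⟨ cong (λ t → a * ((1# - q ^ 3 * t) * (1# - q ^ 5 * t))) (^-^ q i 4) ⟩
      a * ((1# - q ^ 3 * (q ^ 4) ^ i) * (1# - q ^ 5 * (q ^ 4) ^ i))    ∎)
      where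
      W = (q ^ i) ^ 4
      X = (1# - a * q ^ 4 * (q ^ 4) ^ i) * (1# - q ^ 4 / a * (q ^ 4) ^ i)

  second≡ : (1# - q) * (E q a b * second r) ≡ β q a b * ((1# - q) * R r)
  second≡ = begin
    (1# - q) * (E q a b * (β q a b / E q a b * (T₁ r * T₃ r) * inv (B₃ r * B₄ r)))
      ≡⟨ solve 5 (λ o e f t i → o :* (e :* (f :* t :* i)) := e :* f :* (o :* (t :* i))) refl (1# - q) (E q a b) (β q a b / E q a b) (T₁ r * T₃ r) (inv (B₃ r * B₄ r)) ⟩
    E q a b * (β q a b / E q a b) * ((1# - q) * ((T₁ r * T₃ r) * inv (B₃ r * B₄ r)))
      ≡⟨ cong₂ (λ s t → s * ((1# - q) * t)) (E*C/E (β q a b)) (sym (≡-/ (B₃B₄≢0 r) (R≡ r))) ⟩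
    β q a b * ((1# - q) * R r) ∎

-- Assembly of the congruence

-- `_≈F_` asks for a cross-multiplied identity at all integer points, including those where
-- denominators vanish. Values of fractions make sense only off these points, and density extends
-- the identity from the sample points.
difference-≈F : ∀ (f g : Frac) (N D : Poly) →
  (∀ i j k → let open Value (qᵢ i) (aᵢ j) (bᵢ k) in
    Σ K λ v → Σ K λ w → (f ⇓ v) × (g ⇓ w) × ((v - w) * ⟦ D ⟧ (qᵢ i) (aᵢ j) (bᵢ k) ≡ ⟦ N ⟧ (qᵢ i) (aᵢ j) (bᵢ k))) →
  (f -F g) ≈F (N ⁄ D)
difference-≈F f g N D h x y z = ι-injective (x-y≡0⇒x≡y (trans
  (cong₂ _-_ (sym (⟦⟧-ι (num (f -F g) ⊗ D) x y z)) (sym (⟦⟧-ι (N ⊗ den (f -F g)) x y z)))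
  (zero-on-dense (num (f -F g) ⊗ D ⊝ N ⊗ den (f -F g)) {qᵢ} {λ _ → aᵢ} {λ _ _ → bᵢ}
    qᵢ-distinct (λ _ → aᵢ-distinct) (λ _ _ → qᵢ-distinct) vanish (ι x) (ι y) (ι z))))
  where
  vanish : ∀ i j k → ⟦ num (f -F g) ⊗ D ⊝ N ⊗ den (f -F g) ⟧ (qᵢ i) (aᵢ j) (bᵢ k) ≡ 0#
  vanish i j k with h i j k
  ... | v , w , f⇓v , g⇓w , e = x≡y⇒x-y≡0 (begin
    ⟦ num (f -F g) ⟧ q a b * ⟦ D ⟧ q a b              ≡⟨ cong (_* ⟦ D ⟧ q a b) (value (⇓-- {f} {g} f⇓v g⇓w)) ⟩
    (v - w) * ⟦ den (f -F g) ⟧ q a b * ⟦ D ⟧ q a b    ≡⟨ solve 3 (λ x d y → x :* d :* y := x :* y :* d) refl (v - w) (⟦ den (f -F g) ⟧ q a b) (⟦ D ⟧ q a b) ⟩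
    (v - w) * ⟦ D ⟧ q a b * ⟦ den (f -F g) ⟧ q a b    ≡⟨ cong (_* ⟦ den (f -F g) ⟧ q a b) e ⟩
    ⟦ N ⟧ q a b * ⟦ den (f -F g) ⟧ q a b              ∎)
    where
    q = qᵢ i
    a = aᵢ j
    b = bᵢ k
    open Value q a b

module _ (m : ℕ) where
  open Residue m

  private
    module Rem = Local local-remainder
    Z = Rem.numer

    zero-at : ∀ {q a b} → Ω q a b → (Ω q a b → remainder q a b ≡ 0#) → ⟦ Z ⟧ q a b ≡ 0#
    zero-at {q} {a} {b} ω h = trans (sym (Rem.value ω)) (trans (cong (⟦ Rem.denom ⟧ q a b *_) (h ω)) (K.zeroʳ _))

    factored : Σ ℕ λ e → Σ Poly λ Y → ∀ q a b → let u = q ^ n in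
      u ^ e * ⟦ Z ⟧ q a b ≡ (1# - a * u) * (a - u) * (b - u) * ⟦ Y ⟧ q a b
    factored = three-factors (2 ℕ.* t) Z
      (λ i k → zero-at (record { generic = Region.generic-u i (2 ℕ.* t) 4i≢n ; 1-b³q≢0 = Region.1-bᵢq≢0 i k })
        (λ ω → vanishes-at-a ω (trans (cong ((1# - qᵢ i ^ n * qᵢ i ^ n) *_) (K.-‿inverseʳ (qᵢ i ^ n))) (K.zeroʳ _))))
      (λ i k → zero-at (record { generic = Region.generic-1/u i (2 ℕ.* t) 4i≢n ; 1-b³q≢0 = Region.1-bᵢq≢0 i k })
        (λ ω → vanishes-at-a ω (trans (cong (λ x → (1# - x) * (inv (qᵢ i ^ n) - qᵢ i ^ n)) (trans (K.*-comm _ _) (*-inv (^-nonzero (qᵢ≢0 i) n))))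
          (trans (cong (_* (inv (qᵢ i ^ n) - qᵢ i ^ n)) (K.-‿inverseʳ 1#)) (K.zeroˡ _)))))
      (λ i j → zero-at (record { generic = Region.generic-integer i j ; 1-b³q≢0 = Region.1-q^bq≢0 i (2 ℕ.* t) }) (λ ω → vanishes-at-b ω refl))
    e = proj₁ factored
    Y = proj₁ (proj₂ factored)

    good-q^ : ∀ k → Denominator (varq ^P k)
    good-q^ zero    = 0 , one
    good-q^ (suc k) = denominator-* (0 , q-good) (good-q^ k)

    good-q^^ : ∀ k → Denominator ((varq ^P n) ^P k)
    good-q^^ zero    = 0 , one
    good-q^^ (suc k) = denominator-* (good-q^ n) (good-q^^ k)

    D N : Poly
    -- The three factors come from the division by `1 - a u`, from the denominator of `remainder`,
    -- and from the multiplication by `E`.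
    D = (varq ^P n) ^P e ⊗ Rem.denom ⊗ ((vara ⊝ varb) ⊗ (𝟙 ⊝ vara ⊗ varb))
    N = modulus n ⊗ Y

    good-D : Denominator D
    good-D = denominator-* (denominator-* (good-q^^ e) Rem.good) (0 , times a-b 1-ab)

    difference : ∀ i j k → let open Value (qᵢ i) (aᵢ j) (bᵢ k) in
      Σ K λ v → Σ K λ w → (LHS n ⇓ v) × (RHS n ⇓ w) × ((v - w) * ⟦ D ⟧ (qᵢ i) (aᵢ j) (bᵢ k) ≡ ⟦ N ⟧ (qᵢ i) (aᵢ j) (bᵢ k))
    difference i j k = Lhs.lhs n , Rhs.first (suc m) + Rhs.second r , Lhs.LHS-⇓ n ,
      ⇓-resp {RHS n} (cong₂ (λ x y → Rhs.first x + Rhs.second y) Rhs.k≡ Rhs.l≡) Rhs.RHS-⇓ , (begin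
      δ * ⟦ D ⟧ q a b
        ≡⟨ cong (δ *_) D≡ ⟩
      δ * (u ^ e * z * E q a b)
        ≡⟨ solve 4 (λ δ x z e → δ :* (x :* z :* e) := x :* z :* (e :* δ)) refl δ (u ^ e) z (E q a b) ⟩
      u ^ e * z * (E q a b * δ)
        ≡⟨ cong (λ x → u ^ e * z * x) E*δ ⟩
      u ^ e * z * (w * remainder q a b)
        ≡⟨ solve 4 (λ x z w v → x :* z :* (w :* v) := w :* (x :* (z :* v))) refl (u ^ e) z w (remainder q a b) ⟩
      w * (u ^ e * (z * remainder q a b))
        ≡⟨ cong (λ x → w * (u ^ e * x)) (Rem.value ω) ⟩
      w * (u ^ e * ⟦ Z ⟧ q a b)
        ≡⟨ cong (w *_) (proj₂ (proj₂ factored) q a b) ⟩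
      w * ((1# - a * u) * (a - u) * (b - u) * ⟦ Y ⟧ q a b)
        ≡⟨ solve 5 (λ w x y z t → w :* (x :* y :* z :* t) := w :* x :* y :* z :* t) refl w (1# - a * u) (a - u) (b - u) (⟦ Y ⟧ q a b) ⟩
      w * (1# - a * u) * (a - u) * (b - u) * ⟦ Y ⟧ q a b
        ≡⟨ cong₂ (λ x y → w * (x - a * y) * (a - y) * (b - y) * ⟦ Y ⟧ q a b) ι-1 (⟦⟧-^ varq n q a b) ⟨
      ⟦ N ⟧ q a b ∎)
      where
      q = qᵢ i
      a = aᵢ j
      b = bᵢ k
      u = q ^ n
      w = ⟦ qint n ⟧ q a b
      z = ⟦ Rem.denom ⟧ q a b
      ω : Ω q a b
      ω = record { generic = Region.generic-integer i j ; 1-b³q≢0 = Region.1-bᵢq≢0 i k }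
      a≢0 : a ≢ 0#
      a≢0 h = ι-≢ { -[1+ j ]} {+ 0} (λ ()) (x≡y⇒x-y≡0 (trans h (sym ι-0)))
      a-b≢0 : a - b ≢ 0#
      -- The sampled values of a are negative and those of b positive.
      a-b≢0 = ι-≢ (λ ())
      open Value q a b
      module Lhs = LeftSide ω a≢0 (qᵢ≢0 k)
      module Rhs = RightSide m ω a≢0 (qᵢ≢0 k) a-b≢0 (1-aᵢ*≢0 j (2 ℕ.+ k))
      δ = Lhs.lhs n - (Rhs.first (suc m) + Rhs.second r)
      D≡ : ⟦ D ⟧ q a b ≡ u ^ e * z * E q a b
      D≡ = cong₂ (λ x y → x * z * ((a - b) * (y - a * b))) (trans (⟦⟧-^ (varq ^P n) e q a b) (cong (_^ e) (⟦⟧-^ varq n q a b))) ι-1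
      E*δ : E q a b * δ ≡ w * remainder q a b
      E*δ = *-cancel (λ h → Ω.1-q^≢0 ω 0 (trans (cong (λ x → 1# - x) (K.*-identityʳ q)) h)) (begin
        (1# - q) * (E q a b * (Lhs.lhs n - (Rhs.first (suc m) + Rhs.second r)))
          ≡⟨ solve 5 (λ o e l f s → o :* (e :* (l :- (f :+ s))) := e :* (o :* l) :- o :* (e :* f) :- o :* (e :* s)) refl
               (1# - q) (E q a b) (Lhs.lhs n) (Rhs.first (suc m)) (Rhs.second r) ⟩
        E q a b * ((1# - q) * Lhs.lhs n) - (1# - q) * (E q a b * Rhs.first (suc m)) - (1# - q) * (E q a b * Rhs.second r)
          ≡⟨ cong₂ _-_ (cong₂ (λ x y → E q a b * x - y) (Lhs.lhs-S n) Rhs.first≡) Rhs.second≡ ⟩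
        E q a b * Series.S q a (b ^ 3) n - C q a b * ((1# - u) * ρ₁ q a b) - β q a b * ((1# - q) * Series.R q a r)
          ≡⟨ remainder≡ ω ⟨
        (1# - u) * remainder q a b
          ≡⟨ cong (_* remainder q a b) (Lhs.qint-⟦⟧ n) ⟨
        (1# - q) * w * remainder q a b
          ≡⟨ K.*-assoc _ _ _ ⟩
        (1# - q) * (w * remainder q a b) ∎)

  congruence : ∀ {k} → n ≡ k → CongMod (modulus k) (LHS k) (RHS k)
  congruence refl = N , D , difference-≈F (LHS n) (RHS n) N D difference , (Y , λ _ _ _ → refl) , good-coprime t 4i≢n good-D

theorem2p1 : (n : ℕ) → n % 4 ≡ 3 → CongMod (modulus n) (LHS n) (RHS n)
theorem2p1 n h = congruence (n ℕ./ 4) (trans (Residue.n≡ (n ℕ./ 4)) (begin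
  3 ℕ.+ n ℕ./ 4 ℕ.* 4        ≡⟨ cong (ℕ._+ n ℕ./ 4 ℕ.* 4) h ⟨
  n % 4 ℕ.+ n ℕ./ 4 ℕ.* 4    ≡⟨ m≡m%n+[m/n]*n n 4 ⟨
  n                        ∎))
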